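{- The Gabidulin index $\mathrm{ind}(\mathcal C)$ and the value $h(\mathcal C)$ of the following $\mathbb F_{q^n}$-linear MRD codes $\mathcal C\subseteq\mathcal L_{n,q}$ of dimension $k$ are: (a) $\mathcal G_{k,s}=\langle x,x^{[s]},\ldots,x^{[s(k-1)]}\rangle_{\mathbb F_{q^n}}$ ($\gcd(s,n)=1$, $1\le k<n$): $\mathrm{ind}=k$, $h=k-1$; (b) $\mathcal H_{k,s}(\eta)=\langle x+\eta x^{[sk]},x^{[s]},\ldots,x^{[s(k-1)]}\rangle_{\mathbb F_{q^n}}$ ($\gcd(s,n)=1$, $1<k<n-1$, $\eta\ne0$, $\mathrm N_{q^n/q}(\eta)\ne(-1)^{nk}$): $\mathrm{ind}=k-1$, $h=k-2$; (c) $n=6$, $\mathcal C_1=\langle x,\delta x^{[1]}+x^{[4]}\rangle_{\mathbb F_{q^6}}$ ($q>4$, $\delta\in\mathbb F_{q^6}$ such that $\mathcal C_1$ is MRD): $\mathrm{ind}=1$, $h=0$; (d) $n=6$, $\mathcal C_2=\langle x,x^{[1]}+x^{[3]}+\delta x^{[5]}\rangle_{\mathbb F_{q^6}}$ ($q$ odd, $q\equiv0,\pm1\pmod 5$, $\delta\in\mathbb F_q$, $\delta^2+\delta=1$): $\mathrm{ind}=1$, $h=0$; (e) $n=7$, $\mathcal C_3=\langle x,x^{[s]},x^{[3s]}\rangle_{\mathbb F_{q^7}}$ ($q$ odd, $\gcd(s,7)=1$): $\mathrm{ind}=2$, $h=1$; (f) $n=8$, $\mathcal C_4=\langle x,\delta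 x^{[1]}+x^{[5]}\rangle_{\mathbb F_{q^8}}$ ($q$ odd, $\delta^2=-1$): $\mathrm{ind}=1$, $h=0$; (g) $n=8$, $\mathcal C_5=\langle x,x^{[s]},x^{[3s]}\rangle_{\mathbb F_{q^8}}$ ($q\equiv1\pmod3$, $\gcd(s,8)=1$): $\mathrm{ind}=2$, $h=1$; (h) $n=6$, $\mathcal D_1=\langle x^{[1]},x^{[2]},x^{[4]},x-\delta^{[5]}x^{[3]}\rangle_{\mathbb F_{q^6}}$ (with $q,\delta$ as in (c)): $\mathrm{ind}=2$, $h=2$; (i) $n=6$, $\mathcal D_2=\langle x^{[1]},x^{[3]},x-x^{[2]},x^{[4]}-\delta x\rangle_{\mathbb F_{q^6}}$ (with $q,\delta$ as in (d)): $\mathrm{ind}=2$, $h=2$; (j) $n=7$, $\mathcal D_3=\langle x,x^{[2s]},x^{[3s]},x^{[4s]}\rangle_{\mathbb F_{q^7}}$ ($q$ odd, $\gcd(s,7)=1$): $\mathrm{ind}=3$, $h=2$; (k) $n=8$, $\mathcal D_4=\langle x^{[1]},x^{[2]},x^{[3]},x^{[5]},x^{[6]},x-\delta x^{[4]}\rangle_{\mathbb F_{q^8}}$ ($q$ odd, $\delta^2=-1$): $\mathrm{ind}=3$, $h=4$; (l) $n=8$, $\mathcal D_5=\langle x,x^{[2s]},x^{[3s]},x^{[4s]},x^{[5s]}\rangle_{\mathbb F_{q^8}}$ ($q\equiv1\pmod3$, $\gcd(s,8)=1$): $\mathrm{ind}=4$, $h=3$.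
   Context: $q$ is a prime power, $[i]:=q^i$. $\mathcal L_{n,q}$ is the $\mathbb F_{q^n}$-vector space of linearized polynomials $f(x)=\sum_{i=0}^{n-1}a_ix^{[i]}$, $a_i\in\mathbb F_{q^n}$, identified with $\mathbb F_q$-linear maps of $\mathbb F_{q^n}$; rank distance is $\mathrm{rk}(f-g)$ and a code with minimum distance $d$ is MRD if $|\mathcal C|=q^{n(n-d+1)}$. For $f(x)=\sum_i a_ix^{[i]}$, $f(x)^{[j]}:=x^{[j]}\circ f(x)=\sum_i a_i^{[j]}x^{[(i+j)\bmod n]}$, and $\mathcal C^{[j]}=\{f^{[j]}\colon f\in\mathcal C\}$. $h(\mathcal C):=\max\{\dim_{\mathbb F_{q^n}}(\mathcal C\cap\mathcal C^{[j]})\colon 1\le j\le n-1,\ \gcd(j,n)=1\}$. A generalized Gabidulin code is any code equivalent to some $\mathcal G_{l,s}=\langle x,x^{[s]},\ldots,x^{[s(l-1)]}\rangle_{\mathbb F_{q^n}}$ with $\gcd(s,n)=1$, where codes $\mathcal C,\mathcal C'$ are equivalent if there are invertible $h,g\in\mathcal L_{n,q}$ and a field automorphism $\sigma$ (acting on coefficients) with $\{h\circ f^\sigma\circ g\colon f\in\mathcal C\}=\mathcal C'$. The Gabidulin index $\mathrm{ind}(\mathcal C)$ is the maximum dimension of an $\mathbb F_{q^n}$-subspace $\mathcal G\subseteq\mathcal C$ equivalent to a generalized Gabidulin code. $\mathrm N_{q^n/q}(\eta)=\prod_{i=0}^{n-1}\eta^{[i]}$. -}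

module Defs where

open import Algebra.Apartness.Structures using (IsHeytingField)
open import Algebra.Bundles.Raw using (RawRing)
open import Algebra.Core using (Op₁; Op₂)
open import Algebra.Module.Bundles.Raw using (RawLeftModule)
open import Algebra.Morphism.Structures using (module RingMorphisms)
import Algebra.Definitions.RawMonoid
import Algebra.Definitions.RawSemiring
open import Data.Fin.Base using (Fin; toℕ)
open import Data.List.Base using (List; length)
open import Data.List.Membership.Propositional renaming (_∈_ to _∈ˡ_) using ()
open import Data.List.Relation.Unary.Unique.Propositional using (Unique)
open import Data.Nat.Base using (ℕ; zero; suc; _+_; _*_; _^_; _∸_; _≤_; _<_; NonZero)
open import Data.Nat.DivMod using (_mod_)
open import Data.Nat.GCD using (gcd)
open import Data.Nat.Primality using (Prime)
open import Data.Product.Base using (Σ-syntax; ∃-syntax; _×_)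
open import Data.Vec.Base as Vec using (Vec; lookup; replicate; zipWith; _[_]≔_)
open import Data.Vec.Functional using (Vector; []; _∷_)
open import Function.Bundles using (_⇔_; _↔_)
open import Level using (0ℓ)
open import Relation.Binary.PropositionalEquality.Core using (_≡_; _≢_)
open import Relation.Unary using (Pred; _∈_; _⊆_; _≐_; _∩_; U)

IsPrimePower : ℕ → Set
IsPrimePower q = ∃[ p ] ∃[ e ] Prime p × 1 ≤ e × q ≡ p ^ e

IsMaximum : ∀ {ℓ} → Pred ℕ ℓ → ℕ → Set ℓ
IsMaximum P m = P m × (∀ k → P k → k ≤ m)

IsMinimum : ∀ {ℓ} → Pred ℕ ℓ → ℕ → Set ℓ
IsMinimum P m = P m × (∀ k → P k → m ≤ k)

-- Equality is propositional and apartness is its negation, so an enumerated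
-- Heyting field is just a field with exactly m elements.
record FiniteField (m : ℕ) : Set₁ where
  infix  8 -ᴷ_
  infixl 7 _*ᴷ_
  infixl 6 _+ᴷ_
  field
    Carrier        : Set
    _+ᴷ_           : Op₂ Carrier
    _*ᴷ_           : Op₂ Carrier
    -ᴷ_            : Op₁ Carrier
    0#             : Carrier
    1#             : Carrier
    isHeytingField : IsHeytingField _≡_ _≢_ _+ᴷ_ _*ᴷ_ -ᴷ_ 0# 1#
    enumeration    : Fin m ↔ Carrier

  rawRing : RawRing 0ℓ 0ℓ
  rawRing = record
    { Carrier = Carrier ; _≈_ = _≡_ ; _+_ = _+ᴷ_ ; _*_ = _*ᴷ_ ; -_ = -ᴷ_ ; 0# = 0# ; 1# = 1# }

-- Linear algebra in M where only the scalars in S are allowed; this gives both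
-- 𝔽_{q^n}-dimension (S = U) and 𝔽_q-dimension (S = the subfield).
module LinearAlgebra {m} (K : FiniteField m)
                     (S : Pred (FiniteField.Carrier K) 0ℓ)
                     (M : RawLeftModule (FiniteField.Carrier K) 0ℓ 0ℓ) where
  open FiniteField K using (Carrier; 0#)
  open RawLeftModule M using (Carrierᴹ; _≈ᴹ_; _*ₗ_; 0ᴹ; +ᴹ-rawMonoid)
  open Algebra.Definitions.RawMonoid +ᴹ-rawMonoid using (sum)

  lincomb : ∀ {d} → Vector Carrier d → Vector Carrierᴹ d → Carrierᴹ
  lincomb c b = sum (λ i → c i *ₗ b i)

  Span : ∀ {d} → Vector Carrierᴹ d → Pred Carrierᴹ 0ℓ
  Span b v = ∃[ c ] (∀ i → c i ∈ S) × v ≈ᴹ lincomb c b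

  LinearlyIndependent : ∀ {d} → Vector Carrierᴹ d → Set
  LinearlyIndependent b =
    ∀ c → (∀ i → c i ∈ S) → lincomb c b ≈ᴹ 0ᴹ → ∀ i → c i ≡ 0#

  -- In particular W is a subspace.
  HasDimension : ∀ {ℓ} → Pred Carrierᴹ ℓ → ℕ → Set ℓ
  HasDimension W d =
    Σ[ b ∈ Vector Carrierᴹ d ] LinearlyIndependent b × W ≐ Span b

module LinearizedPolynomials (q n : ℕ) .{{_ : NonZero n}} (K : FiniteField (q ^ n)) where
  open FiniteField K public renaming (Carrier to 𝔽)
  open RawRing rawRing using (rawSemiring)
  open Algebra.Definitions.RawSemiring rawSemiring public
    using () renaming (_^_ to _^ᴷ_; sum to sumᴷ; product to productᴷ)

  -- a ^[ j ] is a^{q^j}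
  infixr 8 _^[_]
  _^[_] : 𝔽 → ℕ → 𝔽
  a ^[ j ] = a ^ᴷ (q ^ j)

  -- The subfield 𝔽_q of 𝔽_{q^n}, as the set of roots of x^q - x.
  𝔽q : Pred 𝔽 0ℓ
  𝔽q a = a ^ᴷ q ≡ a

  norm : 𝔽 → 𝔽
  norm η = productᴷ {n} (λ i → η ^[ toℕ i ])

  -- Entry i is the coefficient of x^{[i]}.
  𝓛 : Set
  𝓛 = Vec 𝔽 n

  infixl 6 _⊕_ _⊖_
  infixr 7 _•_

  _⊕_ _⊖_ : Op₂ 𝓛
  _⊕_ = zipWith _+ᴷ_
  f ⊖ g = f ⊕ Vec.map -ᴷ_ g

  _•_ : 𝔽 → 𝓛 → 𝓛
  a • f = Vec.map (a *ᴷ_) f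

  𝓛-module : RawLeftModule 𝔽 0ℓ 0ℓ
  𝓛-module = record
    { Carrierᴹ = 𝓛 ; _≈ᴹ_ = _≡_ ; _+ᴹ_ = _⊕_ ; _*ₗ_ = _•_
    ; 0ᴹ = replicate n 0# ; -ᴹ_ = Vec.map -ᴷ_ }

  𝔽-module : RawLeftModule 𝔽 0ℓ 0ℓ
  𝔽-module = record
    { Carrierᴹ = 𝔽 ; _≈ᴹ_ = _≡_ ; _+ᴹ_ = _+ᴷ_ ; _*ₗ_ = _*ᴷ_ ; 0ᴹ = 0# ; -ᴹ_ = -ᴷ_ }

  open Algebra.Definitions.RawMonoid (RawLeftModule.+ᴹ-rawMonoid 𝓛-module)
    using () renaming (sum to sumᴸ)

  -- Exponents are reduced mod n, since x^{[n]} = x as a map on 𝔽_{q^n}.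
  infix 8 _·x^[_]
  _·x^[_] : 𝔽 → ℕ → 𝓛
  a ·x^[ i ] = replicate n 0# [ i mod n ]≔ a

  x^[_] : ℕ → 𝓛
  x^[ i ] = 1# ·x^[ i ]

  eval : 𝓛 → 𝔽 → 𝔽
  eval f x = sumᴷ {n} (λ i → lookup f i *ᴷ x ^[ toℕ i ])

  -- x^{[j]} ∘ f
  shift : ℕ → 𝓛 → 𝓛
  shift j f = sumᴸ {n} (λ i → (lookup f i ^[ j ]) ·x^[ toℕ i + j ])

  -- (Σ aᵢ x^{[i]}) ∘ g = Σ aᵢ g^{[i]}
  infixr 9 _∘ᴸ_
  _∘ᴸ_ : Op₂ 𝓛
  f ∘ᴸ g = sumᴸ {n} (λ i → lookup f i • shift (toℕ i) g)

  Invertible : 𝓛 → Set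
  Invertible f = ∃[ g ] (f ∘ᴸ g ≡ x^[ 0 ]) × (g ∘ᴸ f ≡ x^[ 0 ])

  module Over𝔽q = LinearAlgebra K 𝔽q 𝔽-module
  open LinearAlgebra K U 𝓛-module public using () renaming (Span to ⟨_⟩; HasDimension to HasDim)

  Code : Set₁
  Code = Pred 𝓛 0ℓ

  HasRank : 𝓛 → ℕ → Set
  HasRank f = Over𝔽q.HasDimension (λ y → ∃[ x ] y ≡ eval f x)

  HasMinimumDistance : Code → ℕ → Set
  HasMinimumDistance C = IsMinimum λ r →
    ∃[ f ] ∃[ g ] f ∈ C × g ∈ C × f ≢ g × HasRank (f ⊖ g) r

  HasCardinality : Code → ℕ → Set
  HasCardinality C N =
    Σ[ fs ∈ List 𝓛 ] Unique fs × (∀ f → f ∈ C ⇔ f ∈ˡ fs) × length fs ≡ N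

  IsMRD : Code → Set
  IsMRD C = ∃[ d ] HasMinimumDistance C d × HasCardinality C (q ^ (n * (n ∸ d + 1)))

  shiftCode : ℕ → Code → Code
  shiftCode j C p = ∃[ f ] f ∈ C × p ≡ shift j f

  infix 4 h[_]≡_ ind[_]≡_

  -- h(C) = m
  h[_]≡_ : Code → ℕ → Set
  h[ C ]≡ m = IsMaximum
    (λ d → ∃[ j ] 1 ≤ j × j ≤ n ∸ 1 × gcd j n ≡ 1 × HasDim (C ∩ shiftCode j C) d) m

  Equivalent : Code → Code → Set
  Equivalent C C′ = ∃[ h ] ∃[ g ] Σ[ σ ∈ (𝔽 → 𝔽) ]
    Invertible h × Invertible g × IsRingIsomorphism σ ×
    (λ p → ∃[ f ] f ∈ C × p ≡ h ∘ᴸ Vec.map σ f ∘ᴸ g) ≐ C′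
    where open RingMorphisms rawRing rawRing using (IsRingIsomorphism)

  𝒢 : ℕ → ℕ → Code
  𝒢 l s = ⟨ (λ (i : Fin l) → x^[ s * toℕ i ]) ⟩

  IsGeneralizedGabidulin : Code → Set
  IsGeneralizedGabidulin C =
    ∃[ l ] ∃[ s ] 1 ≤ l × l ≤ n × gcd s n ≡ 1 × Equivalent C (𝒢 l s)

  -- ind(C) = m
  ind[_]≡_ : Code → ℕ → Set₁
  ind[ C ]≡ m = IsMaximum
    (λ d → Σ[ G ∈ Code ] G ⊆ C × HasDim G d ×
           (Σ[ D ∈ Code ] IsGeneralizedGabidulin D × Equivalent G D)) m

  ℋ : ℕ → ℕ → 𝔽 → Code
  ℋ k s η = ⟨ x^[ 0 ] ⊕ η ·x^[ s * k ] ∷ (λ (i : Fin (k ∸ 1)) → x^[ s * suc (toℕ i) ]) ⟩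

  𝒞₁ 𝒞₂ 𝒞₄ 𝒟₁ 𝒟₂ 𝒟₄ : 𝔽 → Code
  𝒞₁ δ = ⟨ x^[ 0 ] ∷ δ ·x^[ 1 ] ⊕ x^[ 4 ] ∷ [] ⟩
  𝒞₂ δ = ⟨ x^[ 0 ] ∷ x^[ 1 ] ⊕ x^[ 3 ] ⊕ δ ·x^[ 5 ] ∷ [] ⟩
  𝒞₄ δ = ⟨ x^[ 0 ] ∷ δ ·x^[ 1 ] ⊕ x^[ 5 ] ∷ [] ⟩
  𝒟₁ δ = ⟨ x^[ 1 ] ∷ x^[ 2 ] ∷ x^[ 4 ] ∷ x^[ 0 ] ⊖ (δ ^[ 5 ]) ·x^[ 3 ] ∷ [] ⟩
  𝒟₂ δ = ⟨ x^[ 1 ] ∷ x^[ 3 ] ∷ x^[ 0 ] ⊖ x^[ 2 ] ∷ x^[ 4 ] ⊖ δ ·x^[ 0 ] ∷ [] ⟩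
  𝒟₄ δ = ⟨ x^[ 1 ] ∷ x^[ 2 ] ∷ x^[ 3 ] ∷ x^[ 5 ] ∷ x^[ 6 ] ∷ x^[ 0 ] ⊖ δ ·x^[ 4 ] ∷ [] ⟩

  𝒞₃ 𝒞₅ 𝒟₃ 𝒟₅ : ℕ → Code
  𝒞₃ s = ⟨ x^[ 0 ] ∷ x^[ s ] ∷ x^[ 3 * s ] ∷ [] ⟩
  𝒞₅ s = ⟨ x^[ 0 ] ∷ x^[ s ] ∷ x^[ 3 * s ] ∷ [] ⟩
  𝒟₃ s = ⟨ x^[ 0 ] ∷ x^[ 2 * s ] ∷ x^[ 3 * s ] ∷ x^[ 4 * s ] ∷ [] ⟩
  𝒟₅ s = ⟨ x^[ 0 ] ∷ x^[ 2 * s ] ∷ x^[ 3 * s ] ∷ x^[ 4 * s ] ∷ x^[ 5 * s ] ∷ [] ⟩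

{-# OPTIONS --safe #-}

-- Let G be an 𝔽_{q^n}-subspace equivalent to 𝒢 l s with l < n, say 𝒢 l s = h ∘ G^σ ∘ g.  The left
-- idealizer of 𝒢 l s consists of the scalars, so h normalizes the scalars and, by comparing
-- coefficients, is a monomial a x^{[k]}.  Hence G is spanned by u, u^{[s]}, …, u^{[s(l−1)]} for a
-- bijective u, and G ∩ G^{[s]} has dimension at least l − 1.  This gives ind C ≤ h(C) + 1.
--
-- Each code is described by linear relations between coefficients, those of C^{[j]} being the
-- relations of C moved by j.  They bound C ∩ C^{[j]}, and the bounds are attained by explicit bases.
-- The resulting bound on the index is attained by monomial subcodes, except for 𝒟₁, 𝒟₂ and 𝒟₄, where
-- the relations for u, u^{[s]}, u^{[2s]}, … ∈ C make longer chains impossible.  In 𝒟₂ the extremal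
-- chain starts at x^{[3]} − δ x^{[1]}, which is invertible because δ³ ≠ 1.
module Submission where

open import Defs
open import Algebra.Apartness.Structures using (IsHeytingField)
open import Algebra.Bundles using (CommutativeMonoid; CommutativeRing)
open import Algebra.Bundles.Raw using (RawRing)
import Algebra.Definitions.RawMonoid
import Algebra.Definitions.RawSemiring
open import Algebra.Module.Bundles.Raw using (RawLeftModule)
import Algebra.Morphism.Construct.Composition
import Algebra.Morphism.Construct.Identity
open import Algebra.Morphism.Structures using (module RingMorphisms)
import Algebra.Properties.CommutativeMonoid.Sum
import Algebra.Properties.CommutativeSemiring.Binomial
import Algebra.Properties.CommutativeSemiring.Exp
import Algebra.Properties.Ring
import Algebra.Properties.Semiring.Mult
import Algebra.Properties.Semiring.Sum
open import Data.Empty using (⊥-elim)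
open import Data.Fin.Base as Fin using (Fin; zero; suc; toℕ; fromℕ; fromℕ<; inject₁; inject≤; punchIn; punchOut; finToFun; funToFin)
open import Data.Fin.Patterns using (0F; 1F; 2F; 3F; 4F; 5F; 6F; 7F)
open import Data.Fin.Permutation using (Permutation; permutation)
open import Data.Fin.Properties
  using (toℕ-injective; toℕ<n; toℕ-fromℕ; toℕ-fromℕ<; toℕ-inject₁; fromℕ<-cong; inject≤-injective; injective⇒≤; punchIn-punchOut; punchOut-injective
        ; funToFin-finToFin; finToFun-funToFin; any?; all?; ¬∀⟶∃¬)
  renaming (_≟_ to _≟ᶠ_; suc-injective to sucᶠ-injective)
open import Data.Fin.Relation.Unary.Top using (view; ‵fromℕ; ‵inject₁)
open import Data.List.Base as List using (List; length; filter; allFin)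
open import Data.List.Membership.Propositional.Properties using (∈-filter⁺; ∈-allFin; ∈-lookup)
open import Data.List.Relation.Unary.All as All using ()
open import Data.List.Relation.Unary.AllPairs as AllPairs using ()
open import Data.List.Relation.Unary.Any as Any using ()
open import Data.List.Relation.Unary.Any.Properties using (lookup-index)
open import Data.List.Relation.Unary.Unique.Propositional using (Unique)
open import Data.Nat.Base hiding (compare)
open import Data.Nat.Combinatorics using (nCn≡1; nC1≡n; nCk+nC[k+1]≡[n+1]C[k+1]) renaming (_C_ to _choose_)
open import Data.Nat.Combinatorics.Specification using (k>n⇒nCk≡0)
open import Data.Nat.Coprimality using (gcd≡1⇒coprime; coprime⇒gcd≡1; coprime-Bézout; 1-coprimeTo)
open import Data.Nat.DivMod
open import Data.Nat.Divisibility using (_∣_; divides; ∣⇒≤; m∣m*n; ∣m+n∣m⇒∣n; ∣m∣n⇒∣m+n; ∣n⇒∣m*n)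
open import Data.Nat.GCD using (gcd; module Bézout)
open import Data.Nat.Primality using (Prime; euclidsLemma; prime⇒nonTrivial)
open import Data.Nat.Properties as ℕ using ()
open import Data.Product.Base hiding (swap)
open import Data.Sum.Base using (_⊎_; inj₁; inj₂)
open import Data.Vec.Base as Vec using (lookup; replicate)
open import Data.Vec.Functional using (Vector; []; _∷_)
open import Data.Vec.Properties
  using (tabulate∘lookup; tabulate-cong; lookup-map; lookup-zipWith; lookup-replicate; lookup∘update; lookup∘update′; map-∘; map-id)
open import Function.Base using (_∘_; id)
open import Function.Bundles using (Equivalence; Inverse)
open import Level using (0ℓ)
open import Relation.Binary.Definitions using (tri<; tri≈; tri>)
open import Relation.Binary.PropositionalEquality
open import Relation.Nullary using (¬_; Dec; yes; no; contradiction; decidable-stable)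
open import Relation.Nullary.Decidable using (map′; _×-dec_; _→-dec_; toWitness)
open import Relation.Unary using (Pred; _∈_; _⊆_; _≐_; _∩_; U)

-- Arithmetic modulo n

-- Dimensions over 𝔽_{q^n} are compared by counting: a subspace is bounded by naming e coefficients
-- that determine its elements, since an injection 𝔽^d → 𝔽^e forces d ≤ e. This suits subspaces
-- given as bare predicates, and also the map G → 𝒢 l s, which is not known to respect scalars
-- before h is recognized as a monomial. The parameter s is removed by renaming positions: s is a
-- unit modulo n, so every position has the form s i and every admissible shift the form j ≡ s r,
-- and C ∩ C^{[j]} becomes a question about the positions i and i + r. Identities between
-- compositions are checked on values, because a nonzero linearized polynomial of degree below q^n
-- has too few roots to vanish on the whole field. The argument for 𝒟₁ uses δ ≠ 0, which the MRD
-- property of 𝒞₁ supplies: for δ = 0 that code would contain x^{[4]} - x, of rank at most 4,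
-- whereas q^{6(7 - d)} ≤ q^{12} forces d ≥ 5.

module Congruence (n : ℕ) .{{_ : NonZero n}} where
  infix 4 _≋_
  _≋_ : ℕ → ℕ → Set
  a ≋ b = a % n ≡ b % n

  ≋-+ : ∀ {a b c d} → a ≋ b → c ≋ d → a + c ≋ b + d
  ≋-+ {a} {b} {c} {d} p q = begin
    (a + c) % n  ≡⟨ %-distribˡ-+ a c n ⟩
    (a % n + c % n) % n  ≡⟨ cong₂ (λ x y → (x + y) % n) p q ⟩
    (b % n + d % n) % n  ≡⟨ %-distribˡ-+ b d n ⟨
    (b + d) % n             ∎
    where open ≡-Reasoning

  ≋-*ˡ : ∀ c {a b} → a ≋ b → c * a ≋ c * b
  ≋-*ˡ c {a} {b} p = begin
    (c * a) % n  ≡⟨ %-distribˡ-* c a n ⟩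
    (c % n * (a % n)) % n  ≡⟨ cong (λ x → (c % n * x) % n) p ⟩
    (c % n * (b % n)) % n  ≡⟨ %-distribˡ-* c b n ⟨
    (c * b) % n             ∎
    where open ≡-Reasoning

  ≋-*ʳ : ∀ c {a b} → a ≋ b → a * c ≋ b * c
  ≋-*ʳ c {a} {b} p = subst₂ _≋_ (ℕ.*-comm c a) (ℕ.*-comm c b) (≋-*ˡ c p)

  %-≋ : ∀ a → a % n ≋ a
  %-≋ a = m%n%n≡m%n a n

  +n-≋ : ∀ a → a + n ≋ a
  +n-≋ a = [m+n]%n≡m%n a n

  +*n-≋ : ∀ a k → a + k * n ≋ a
  +*n-≋ a k = [m+kn]%n≡m%n a k n

  -- Multiplication by n - 1 negates modulo n for every a, whereas n ∸ a would truncate once a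
  -- exceeds n.
  neg : ℕ → ℕ
  neg a = a * (n ∸ 1)

  +neg : ∀ a b → b + (a + neg a) ≋ b
  +neg a b = begin
    (b + (a + a * (n ∸ 1))) % n  ≡⟨ cong (λ x → (b + x) % n) (sym (ℕ.*-suc a (n ∸ 1))) ⟩
    (b + a * suc (n ∸ 1)) % n  ≡⟨ cong (λ x → (b + a * x) % n) (ℕ.suc-pred n) ⟩
    (b + a * n) % n  ≡⟨ +*n-≋ b a ⟩
    b % n                         ∎
    where open ≡-Reasoning

  ≋-cancelʳ : ∀ {a b} c → a + c ≋ b + c → a ≋ b
  ≋-cancelʳ {a} {b} c p = trans (sym (+neg c a)) (trans (subst₂ _≋_ (ℕ.+-assoc a c _) (ℕ.+-assoc b c _) (≋-+ p refl))
      (+neg c b))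

  ≋-small : ∀ {a b} → a < n → b < n → a ≋ b → a ≡ b
  ≋-small a<n b<n p = trans (sym (m<n⇒m%n≡m a<n)) (trans p (m<n⇒m%n≡m b<n))

  coprime-≋ : ∀ {a b} → a ≋ b → gcd a n ≡ 1 → gcd b n ≡ 1
  coprime-≋ {a} {b} p ga = coprime⇒gcd≡1 λ {d} (d∣b , d∣n) → gcd≡1⇒coprime ga (transport d∣n d∣b , d∣n)
    where
    %∣ : ∀ {d} x → d ∣ n → d ∣ x → d ∣ x % n
    %∣ {d} x d∣n d∣x = ∣m+n∣m⇒∣n (subst (d ∣_) (trans (m≡m%n+[m/n]*n x n) (ℕ.+-comm (x % n) _)) d∣x) (∣n⇒∣m*n (x / n) d∣n)
    ∣% : ∀ {d} x → d ∣ n → d ∣ x % n → d ∣ x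
    ∣% {d} x d∣n d∣x = subst (d ∣_) (sym (m≡m%n+[m/n]*n x n)) (∣m∣n⇒∣m+n d∣x (∣n⇒∣m*n (x / n) d∣n))
    transport : ∀ {d} → d ∣ n → d ∣ b → d ∣ a
    transport {d} d∣n d∣b = ∣% a d∣n (subst (d ∣_) (sym p) (%∣ b d∣n d∣b))

  coprime-*ʳ : ∀ s r → gcd (s * r) n ≡ 1 → gcd r n ≡ 1
  coprime-*ʳ s r g = coprime⇒gcd≡1 λ (d∣r , d∣n) → gcd≡1⇒coprime g (∣n⇒∣m*n s d∣r , d∣n)

  inverse : ∀ s → gcd s n ≡ 1 → ∃[ t ] t * s ≋ 1
  inverse s g with coprime-Bézout (gcd≡1⇒coprime g)
  ... | Bézout.+- x y eq = x , trans (cong (_% n) (sym eq)) (+*n-≋ 1 y)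
  -- Here 1 + x s = y n, so the inverse of s is -x.
  ... | Bézout.-+ x y eq = neg x , (begin
      (neg x * s) % n  ≡⟨ +*n-≋ _ y ⟨
      (neg x * s + y * n) % n  ≡⟨ cong (λ z → (neg x * s + z) % n) (sym eq) ⟩
      (neg x * s + (1 + x * s)) % n  ≡⟨ cong (_% n) rearrange ⟩
      (1 + (x * s + neg (x * s))) % n  ≡⟨ +neg (x * s) 1 ⟩
      1 % n ∎)
    where
    open ≡-Reasoning
    rearrange : neg x * s + (1 + x * s) ≡ 1 + (x * s + neg (x * s))
    rearrange = trans (ℕ.+-comm (neg x * s) _) (cong (λ z → 1 + (x * s + z))
        (trans (ℕ.*-assoc x _ s) (trans (cong (x *_) (ℕ.*-comm _ s)) (sym (ℕ.*-assoc x s _)))))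

  module Unit (s : ℕ) (g : gcd s n ≡ 1) where
    s⁻¹ : ℕ
    s⁻¹ = proj₁ (inverse s g)

    s*s⁻¹* : ∀ a → s * (s⁻¹ * a) ≋ a
    s*s⁻¹* a = begin
      (s * (s⁻¹ * a)) % n  ≡⟨ cong (_% n) (trans (sym (ℕ.*-assoc s s⁻¹ a)) (cong (_* a) (ℕ.*-comm s s⁻¹))) ⟩
      (s⁻¹ * s * a) % n  ≡⟨ ≋-*ʳ a (proj₂ (inverse s g)) ⟩
      (1 * a) % n  ≡⟨ cong (_% n) (ℕ.*-identityˡ a) ⟩
      a % n                 ∎
      where open ≡-Reasoning

    ≋-cancel-* : ∀ {a b} → s * a ≋ s * b → a ≋ b
    ≋-cancel-* {a} {b} p = trans (sym (s⁻¹*s* a)) (trans (≋-*ˡ s⁻¹ p) (s⁻¹*s* b))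
      where
      s⁻¹*s* : ∀ a → s⁻¹ * (s * a) ≋ a
      s⁻¹*s* a = trans (cong (_% n) (sym (ℕ.*-assoc s⁻¹ s a)))
          (trans (≋-*ʳ a (proj₂ (inverse s g))) (cong (_% n) (ℕ.*-identityˡ a)))

    -- Multiplication by the unit s permutes the residues. This renames positions, so that codes
    -- with parameter s are handled through consecutive indices r.
    index : ∀ j → ∃[ r ] r < n × s * r ≋ j
    index j = (s⁻¹ * j) % n , m%n<n _ n , trans (≋-*ˡ s (%-≋ (s⁻¹ * j))) (s*s⁻¹* j)

-- Finite fields

^-cancelˡ-≤ : ∀ b → 2 ≤ b → ∀ {d e} → b ^ d ≤ b ^ e → d ≤ e
^-cancelˡ-≤ b 2≤b p = ℕ.≮⇒≥ λ e<d → ℕ.<⇒≱ (ℕ.^-monoʳ-< b 2≤b e<d) p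

module MonoidSums (M : CommutativeMonoid 0ℓ 0ℓ) where
  open CommutativeMonoid M using (Carrier; _≈_; ε; ∙-cong; ∙-congˡ; identityˡ; identityʳ) renaming (trans to ≈-trans)
  open Algebra.Properties.CommutativeMonoid.Sum M

  sum-zero : ∀ {d} (g : Vector Carrier d) → (∀ i → g i ≈ ε) → sum g ≈ ε
  sum-zero {d} g g≈ε = ≈-trans (sum-cong-≋ g≈ε) (sum-replicate-zero d)

  sum-single : ∀ {d} (g : Vector Carrier d) j → (∀ i → i ≢ j → g i ≈ ε) → sum g ≈ g j
  sum-single g zero z = ≈-trans (∙-congˡ (sum-zero (g ∘ suc) λ i → z (suc i) λ ())) (identityʳ _)
  sum-single g (suc j) z = ≈-trans (∙-cong (z zero λ ()) (sum-single (g ∘ suc) j λ i i≢j → z (suc i)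
      (i≢j ∘ sucᶠ-injective))) (identityˡ _)

module FieldProperties {m} (K : FiniteField m) where
  open FiniteField K

  open IsHeytingField isHeytingField public
    using (isCommutativeRing; +-assoc; +-comm; *-assoc; *-comm; distribˡ; distribʳ; zeroˡ; zeroʳ
          ; +-identityˡ; +-identityʳ; *-identityˡ; *-identityʳ; -‿inverseˡ; -‿inverseʳ)

  commutativeRing : CommutativeRing 0ℓ 0ℓ
  commutativeRing = record { isCommutativeRing = isCommutativeRing }

  open CommutativeRing commutativeRing public
    using (ring; semiring; commutativeSemiring; +-commutativeMonoid; *-commutativeMonoid)
  open Algebra.Properties.Ring ring public
    using (-‿distribˡ-*; -‿distribʳ-*; -1*x≈-x; -0#≈0#; -‿involutive; +-cancelˡ; +-cancelʳ; -‿+-comm)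
    renaming (+-inverseˡ-unique to -‿uniqueˡ; x∙y⁻¹≈ε⇒x≈y to x-y≡0⇒x≡y)
  open Algebra.Properties.CommutativeSemiring.Exp commutativeSemiring public
    using (^-assocʳ; ^-distrib-*) renaming (_^_ to _^ᴷ_)
  open Algebra.Properties.Semiring.Sum semiring public
    using (sum; sum-cong-≗; sum-replicate; sum-replicate-zero; sum-init-last; ∑-distrib-+; *-distribˡ-sum; sum-permute)
  open MonoidSums +-commutativeMonoid public
  open Algebra.Definitions.RawSemiring (RawRing.rawSemiring rawRing) public using () renaming
      (_×_ to _×ᴷ_; product to productᴷ)

  element : Fin m → Carrier
  element = Inverse.to enumeration

  index : Carrier → Fin m
  index = Inverse.from enumeration

  element-index : ∀ x → element (index x) ≡ x
  element-index x = Inverse.inverseˡ enumeration refl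

  private
    module ∏ = Algebra.Properties.CommutativeMonoid.Sum *-commutativeMonoid

    index-element : ∀ i → index (element i) ≡ i
    index-element i = Inverse.inverseʳ enumeration refl

  element-injective : ∀ {i j} → element i ≡ element j → i ≡ j
  element-injective {i} {j} p = trans (sym (index-element i)) (trans (cong index p) (index-element j))

  index-injective : ∀ {x y} → index x ≡ index y → x ≡ y
  index-injective {x} {y} p = trans (sym (element-index x)) (trans (cong element p) (element-index y))

  infix 4 _≟_
  _≟_ : (x y : Carrier) → Dec (x ≡ y)
  x ≟ y = map′ index-injective (cong index) (index x ≟ᶠ index y)

  -- If 1 = 0, every element equals 1 and the difference 0 - 0 is invertible. Invertible differences
  -- are apart, and apartness is inequality, so 0 would differ from itself.
  1≢0 : 1# ≢ 0#
  1≢0 1≡0 = IsHeytingField.invertible⇒# isHeytingField {0#} {0#} (0# , all1 , all1) refl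
    where
    all1 : ∀ {x} → x ≡ 1#
    all1 {x} = trans (trans (sym (*-identityʳ x)) (trans (cong (x *ᴷ_) 1≡0) (zeroʳ x))) (sym 1≡0)

  reciprocal : ∀ x → x ≢ 0# → ∃[ y ] y *ᴷ x ≡ 1#
  reciprocal x x≢0 with y , yx , _ ← IsHeytingField.#⇒invertible isHeytingField x≢0 =
    y , trans (cong (y *ᴷ_) (sym (trans (cong (x +ᴷ_) -0#≈0#) (+-identityʳ x)))) yx

  *-cancelˡ : ∀ x {y z} → x ≢ 0# → x *ᴷ y ≡ x *ᴷ z → y ≡ z
  *-cancelˡ x {y} {z} x≢0 p with w , wx ← reciprocal x x≢0 = trans (sym (undo y)) (trans (cong (w *ᴷ_) p) (undo z))
    where
    undo : ∀ a → w *ᴷ (x *ᴷ a) ≡ a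
    undo a = trans (sym (*-assoc w x a)) (trans (cong (_*ᴷ a) wx) (*-identityˡ a))

  x*y≡0⇒y≡0 : ∀ {x y} → x ≢ 0# → x *ᴷ y ≡ 0# → y ≡ 0#
  x*y≡0⇒y≡0 {x} x≢0 p = *-cancelˡ x x≢0 (trans p (sym (zeroʳ x)))

  x^k≡0⇒x≡0 : ∀ {x} k → x ^ᴷ k ≡ 0# → x ≡ 0#
  x^k≡0⇒x≡0 zero p = contradiction p 1≢0
  x^k≡0⇒x≡0 {x} (suc k) p with x ≟ 0#
  ... | yes x≡0 = x≡0
  ... | no x≢0 = x^k≡0⇒x≡0 k (x*y≡0⇒y≡0 x≢0 p)

  x*0+y : ∀ {x y z} → y ≡ 0# → x *ᴷ y +ᴷ z ≡ z
  x*0+y {x} {y} {z} p = trans (cong (λ w → x *ᴷ w +ᴷ z) p) (trans (cong (_+ᴷ z) (zeroʳ x)) (+-identityˡ z))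

  private
    funToFin-cong : ∀ {a b} {f g : Fin a → Fin b} → (∀ i → f i ≡ g i) → funToFin f ≡ funToFin g
    funToFin-cong {zero} p = refl
    funToFin-cong {suc a} p = cong₂ Fin.combine (p zero) (funToFin-cong (p ∘ suc))

  finToFun-injective : ∀ {a b} {k l : Fin (b ^ a)} → (∀ i → finToFun {b} {a} k i ≡ finToFun l i) → k ≡ l
  finToFun-injective {a} {b} {k} {l} p = trans (sym (funToFin-finToFin {a} {b} k))
      (trans (funToFin-cong p) (funToFin-finToFin {a} {b} l))

  -- Vectors of length e over the field are coded by the numbers below m^e.
  count-vectors : ∀ {N e} (F : Fin N → Vector Carrier e) → (∀ {k l} → (∀ i → F k i ≡ F l i) → k ≡ l) → N ≤ m ^ e
  count-vectors {N} {e} F inj = injective⇒≤ {f = λ k → funToFin (index ∘ F k)} λ {k} {l} p → inj λ j → index-injective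
    (trans (sym (finToFun-funToFin (index ∘ F k) j)) (trans (cong (λ z → finToFun z j) p)
        (finToFun-funToFin (index ∘ F l) j)))

  -- Linearity of the injection plays no part: m^d ≤ m^e already gives d ≤ e. Every comparison of
  -- 𝔽_{q^n}-dimensions goes through this count, without exchanging bases.
  vectors-injective⇒≤ : 2 ≤ m → ∀ {d e} (F : Vector Carrier d → Vector Carrier e) →
    (∀ c c′ → (∀ i → F c i ≡ F c′ i) → ∀ i → c i ≡ c′ i) → d ≤ e
  vectors-injective⇒≤ 2≤m {d} {e} F inj = ^-cancelˡ-≤ m 2≤m (count-vectors (λ (k : Fin (m ^ d)) → F (element ∘ finToFun k))
    λ p → finToFun-injective {d} λ i → element-injective (inj _ _ p i))

  private
    permute : (f g : Carrier → Carrier) → (∀ x → f (g x) ≡ x) → (∀ x → g (f x) ≡ x) → Permutation m m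
    permute f g fg gf = permutation (index ∘ f ∘ element) (index ∘ g ∘ element)
      (λ i → trans (cong (index ∘ f) (element-index _)) (trans (cong index (fg _)) (index-element i)))
      (λ i → trans (cong (index ∘ g) (element-index _)) (trans (cong index (gf _)) (index-element i)))

  -- Adding 1 permutes the field, so the sum of all elements is unchanged by adding m · 1 to it.
  m×1≡0 : m ×ᴷ 1# ≡ 0#
  m×1≡0 = +-cancelˡ total _ _ (begin
    total +ᴷ m ×ᴷ 1#  ≡⟨ cong (total +ᴷ_) (sum-replicate m) ⟨
    total +ᴷ sum {m} (λ _ → 1#)  ≡⟨ ∑-distrib-+ element (λ _ → 1#) ⟨
    sum (λ i → element i +ᴷ 1#)  ≡⟨ sum-cong-≗ (λ i → element-index (element i +ᴷ 1#)) ⟨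
    sum (λ i → element (index (element i +ᴷ 1#)))  ≡⟨ sum-permute element (permute (_+ᴷ 1#) (_+ᴷ (-ᴷ 1#))
                                                          (λ x → cancel x (-‿inverseˡ 1#))
                                                              (λ x → cancel x (-‿inverseʳ 1#))) ⟨
    total  ≡⟨ +-identityʳ total ⟨
    total +ᴷ 0#                                     ∎)
    where
    open ≡-Reasoning
    total : Carrier
    total = sum element
    cancel : ∀ x {a b} → a +ᴷ b ≡ 0# → x +ᴷ a +ᴷ b ≡ x
    cancel x p = trans (+-assoc x _ _) (trans (cong (x +ᴷ_) p) (+-identityʳ x))

  -- Multiplication by a permutes the nonzero elements; the factors at 0 are
  -- replaced by 1 so that the product over all of K is invertible.
  fermat : ∀ a → a ^ᴷ m ≡ a
  fermat a with a ≟ 0#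
  fermat a | yes a≡0 = 0^suc m (index 0#)
    where
    0^suc : ∀ k → Fin k → a ^ᴷ k ≡ a
    0^suc (suc k) _ = trans (cong (_*ᴷ a ^ᴷ k) a≡0) (trans (zeroˡ _) (sym a≡0))
  fermat a | no a≢0 = begin
    a ^ᴷ m  ≡⟨ ∏.sum-replicate m ⟨
    -- The m factors a split into those at the m - 1 nonzero elements, whose product is 1, and the
    -- single factor a at 0.
    productᴷ {m} (λ _ → a)  ≡⟨ ∏.sum-cong-≗ (λ i → sym (if-* (element i))) ⟩
    productᴷ (λ i → nz (element i) *ᴷ z (element i)) ≡⟨ ∏.∑-distrib-+ (nz ∘ element) (z ∘ element) ⟩
    productᴷ (nz ∘ element) *ᴷ productᴷ (z ∘ element) ≡⟨ cong₂ _*ᴷ_ ∏nz ∏z ⟩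
    1# *ᴷ a  ≡⟨ *-identityˡ a ⟩
    a                              ∎
    where
    open ≡-Reasoning
    choose : Carrier → Carrier → Carrier → Carrier
    choose u v x with x ≟ 0#
    ... | yes _ = u
    ... | no _ = v
    nz z self : Carrier → Carrier
    nz = choose 1# a
    z = choose a 1#
    self x = choose 1# x x
    if-* : ∀ x → nz x *ᴷ z x ≡ a
    if-* x with x ≟ 0#
    ... | yes _ = *-identityˡ a
    ... | no _ = *-identityʳ a
    self-* : ∀ x → self (a *ᴷ x) ≡ nz x *ᴷ self x
    self-* x with x ≟ 0# | a *ᴷ x ≟ 0#
    ... | yes _   | yes _    = sym (*-identityˡ 1#)
    ... | no _    | no _     = refl
    ... | yes x≡0 | no ax≢0  = contradiction (trans (cong (a *ᴷ_) x≡0) (zeroʳ a)) ax≢0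
    ... | no x≢0  | yes ax≡0 = contradiction (x*y≡0⇒y≡0 a≢0 ax≡0) x≢0
    self≢0 : ∀ x → self x ≢ 0#
    self≢0 x with x ≟ 0#
    ... | yes _ = 1≢0
    ... | no x≢0 = x≢0
    ∏≢0 : ∀ {d} (g : Vector Carrier d) → (∀ i → g i ≢ 0#) → productᴷ g ≢ 0#
    ∏≢0 {zero} g _ = 1≢0
    ∏≢0 {suc d} g g≢0 p = ∏≢0 (g ∘ suc) (g≢0 ∘ suc) (x*y≡0⇒y≡0 (g≢0 zero) p)
    a⁻¹ : Carrier
    a⁻¹ = proj₁ (reciprocal a a≢0)
    a⁻¹*a : a⁻¹ *ᴷ a ≡ 1#
    a⁻¹*a = proj₂ (reciprocal a a≢0)
    undo : ∀ {u v} x → u *ᴷ v ≡ 1# → u *ᴷ (v *ᴷ x) ≡ x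
    undo x p = trans (sym (*-assoc _ _ x)) (trans (cong (_*ᴷ x) p) (*-identityˡ x))
    ∏nz : productᴷ (nz ∘ element) ≡ 1#
    ∏nz = *-cancelˡ P (∏≢0 (self ∘ element) (self≢0 ∘ element)) (begin
      P *ᴷ productᴷ (nz ∘ element)  ≡⟨ *-comm P _ ⟩
      productᴷ (nz ∘ element) *ᴷ P  ≡⟨ ∏.∑-distrib-+ (nz ∘ element) (self ∘ element) ⟨
      productᴷ (λ i → nz (element i) *ᴷ self (element i)) ≡⟨ ∏.sum-cong-≗ (λ i → sym (self-* (element i))) ⟩
      productᴷ (λ i → self (a *ᴷ element i)) ≡⟨ ∏.sum-cong-≗ (λ i → cong self (sym (element-index (a *ᴷ element i)))) ⟩
      productᴷ (λ i → self (element (index (a *ᴷ element i)))) ≡⟨ ∏.sum-permute (self ∘ element) (permute (a *ᴷ_) (a⁻¹ *ᴷ_)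
                                          (λ x → undo x (trans (*-comm a a⁻¹) a⁻¹*a)) (λ x → undo x a⁻¹*a)) ⟨
      P  ≡⟨ *-identityʳ P ⟨
      P *ᴷ 1#                        ∎)
      where
      P : Carrier
      P = productᴷ (self ∘ element)
    ∏z : productᴷ (z ∘ element) ≡ a
    ∏z = trans (MonoidSums.sum-single *-commutativeMonoid (z ∘ element) (index 0#) others) (at0 (element-index 0#))
      where
      others : ∀ i → i ≢ index 0# → z (element i) ≡ 1#
      others i i≢ with element i ≟ 0#
      ... | yes p = contradiction (trans (sym (index-element i)) (cong index p)) i≢
      ... | no _ = refl
      at0 : ∀ {x} → x ≡ 0# → z x ≡ a
      at0 {x} p with x ≟ 0#
      ... | yes _ = refl
      ... | no x≢0 = contradiction p x≢0

  -- Polynomial functions in Horner form: Poly d means degree less than d, Monic d degree exactly d.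
  data Poly : ℕ → (Carrier → Carrier) → Set where
    zero : ∀ {φ} → (∀ x → φ x ≡ 0#) → Poly 0 φ
    step : ∀ {d φ ψ} c → Poly d ψ → (∀ x → φ x ≡ x *ᴷ ψ x +ᴷ c) → Poly (suc d) φ

  data Monic : ℕ → (Carrier → Carrier) → Set where
    one  : ∀ {φ} → (∀ x → φ x ≡ 1#) → Monic 0 φ
    step : ∀ {d φ ψ} c → Monic d ψ → (∀ x → φ x ≡ x *ᴷ ψ x +ᴷ c) → Monic (suc d) φ

  +-interchange : ∀ a b c d → (a +ᴷ b) +ᴷ (c +ᴷ d) ≡ (a +ᴷ c) +ᴷ (b +ᴷ d)
  +-interchange a b c d = trans (+-assoc a b _) (trans (cong (a +ᴷ_) (trans (sym (+-assoc b c d))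
    (trans (cong (_+ᴷ d) (+-comm b c)) (+-assoc c b d)))) (sym (+-assoc a c _)))

  private
    step-+ : ∀ x u v c d → (x *ᴷ u +ᴷ c) +ᴷ (x *ᴷ v +ᴷ d) ≡ x *ᴷ (u +ᴷ v) +ᴷ (c +ᴷ d)
    step-+ x u v c d = trans (+-interchange _ _ _ _) (cong (_+ᴷ (c +ᴷ d)) (sym (distribˡ x u v)))

  poly-+ : ∀ {d φ ψ} → Poly d φ → Poly d ψ → Poly d (λ x → φ x +ᴷ ψ x)
  poly-+ (zero p) (zero q) = zero λ x → trans (cong₂ _+ᴷ_ (p x) (q x)) (+-identityˡ 0#)
  poly-+ (step c φ p) (step d ψ q) = step (c +ᴷ d) (poly-+ φ ψ) λ x → trans (cong₂ _+ᴷ_ (p x) (q x)) (step-+ x _ _ c d)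

  monic-+ : ∀ {d φ ψ} → Monic d φ → Poly d ψ → Monic d (λ x → φ x +ᴷ ψ x)
  monic-+ (one p) (zero q) = one λ x → trans (cong₂ _+ᴷ_ (p x) (q x)) (+-identityʳ 1#)
  monic-+ (step c φ p) (step d ψ q) = step (c +ᴷ d) (monic-+ φ ψ) λ x → trans (cong₂ _+ᴷ_ (p x) (q x)) (step-+ x _ _ c d)

  poly-scale : ∀ {d φ} a → Poly d φ → Poly d (λ x → a *ᴷ φ x)
  poly-scale a (zero p) = zero λ x → trans (cong (a *ᴷ_) (p x)) (zeroʳ a)
  poly-scale a (step {ψ = ψ} c φ p) = step (a *ᴷ c) (poly-scale a φ) λ x → trans (cong (a *ᴷ_) (p x))
    (trans (distribˡ a _ c) (cong (_+ᴷ a *ᴷ c) (trans (sym (*-assoc a x _))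
        (trans (cong (_*ᴷ ψ x) (*-comm a x)) (*-assoc x a _)))))

  poly-zero : ∀ d {φ} → (∀ x → φ x ≡ 0#) → Poly d φ
  poly-zero zero p = zero p
  poly-zero (suc d) p = step 0# (poly-zero d {λ _ → 0#} λ _ → refl) λ x → trans (p x) (sym (x*0+y refl))

  poly-≤ : ∀ {d e φ} → d ≤ e → Poly d φ → Poly e φ
  poly-≤ {e = e} z≤n (zero p) = poly-zero e p
  poly-≤ (s≤s d≤e) (step c φ p) = step c (poly-≤ d≤e φ) p

  poly-^ : ∀ k → Poly (suc k) (_^ᴷ k)
  poly-^ zero = step 1# (zero {λ _ → 0#} λ _ → refl) λ x → sym (x*0+y refl)
  poly-^ (suc k) = step 0# (poly-^ k) λ x → sym (+-identityʳ _)

  monic-^ : ∀ k → Monic k (_^ᴷ k)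
  monic-^ zero = one λ _ → refl
  monic-^ (suc k) = step 0# (monic-^ k) λ x → sym (+-identityʳ _)

  poly-sum : ∀ {d e} (φ : Fin e → Carrier → Carrier) → (∀ i → Poly d (φ i)) → Poly d (λ x → sum (λ i → φ i x))
  poly-sum {d} {zero} φ p = poly-zero d λ _ → refl
  poly-sum {d} {suc e} φ p = poly-+ (p zero) (poly-sum (φ ∘ suc) (p ∘ suc))

  monic-ext : ∀ {d φ ψ} → (∀ x → ψ x ≡ φ x) → Monic d φ → Monic d ψ
  monic-ext e (one p) = one λ x → trans (e x) (p x)
  monic-ext e (step c φ p) = step c φ λ x → trans (e x) (p x)

  -- Synthetic division: the coefficients of the quotient by x - r are the intermediate Horner
  -- values at r, and the last Horner value is the remainder.
  monic-divide : ∀ {d φ} → Monic (suc d) φ → ∀ r → ∃[ ψ ] Monic d ψ × (∀ x → φ x ≡ (x +ᴷ (-ᴷ r)) *ᴷ ψ x +ᴷ φ r)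
  monic-divide {φ = φ} (step {ψ = ψ} c (one e) p) r = (λ _ → 1#) , one (λ _ → refl) , λ x → begin
    φ x  ≡⟨ p x ⟩
    x *ᴷ ψ x +ᴷ c  ≡⟨ cong (λ w → w *ᴷ ψ x +ᴷ c) (x≡x-r+r x) ⟩
    (x +ᴷ (-ᴷ r) +ᴷ r) *ᴷ ψ x +ᴷ c  ≡⟨ cong (_+ᴷ c) (distribʳ (ψ x) _ r) ⟩
    ((x +ᴷ (-ᴷ r)) *ᴷ ψ x +ᴷ r *ᴷ ψ x) +ᴷ c  ≡⟨ +-assoc _ _ c ⟩
    (x +ᴷ (-ᴷ r)) *ᴷ ψ x +ᴷ (r *ᴷ ψ x +ᴷ c)  ≡⟨ cong₂ (λ u v → (x +ᴷ (-ᴷ r)) *ᴷ u +ᴷ v) (e x)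
                                                          (trans (cong (λ w → r *ᴷ w +ᴷ c) (trans (e x) (sym (e r))))
                                                              (sym (p r))) ⟩
    (x +ᴷ (-ᴷ r)) *ᴷ 1# +ᴷ φ r                       ∎
    where
    open ≡-Reasoning
    x≡x-r+r : ∀ x → x ≡ x +ᴷ (-ᴷ r) +ᴷ r
    x≡x-r+r x = sym (trans (+-assoc x _ r) (trans (cong (x +ᴷ_) (-‿inverseˡ r)) (+-identityʳ x)))
  monic-divide {φ = φ} (step {ψ = ψ} c M@(step _ _ _) p) r with χ , Mχ , e ← monic-divide M r =
    (λ x → x *ᴷ χ x +ᴷ ψ r) , step (ψ r) Mχ (λ _ → refl) , λ x → let y = x +ᴷ (-ᴷ r) in begin
    φ x  ≡⟨ p x ⟩
    x *ᴷ ψ x +ᴷ c  ≡⟨ cong (λ w → x *ᴷ w +ᴷ c) (e x) ⟩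
    x *ᴷ (y *ᴷ χ x +ᴷ ψ r) +ᴷ c  ≡⟨ cong (_+ᴷ c) (distribˡ x _ _) ⟩
    (x *ᴷ (y *ᴷ χ x) +ᴷ x *ᴷ ψ r) +ᴷ c  ≡⟨ cong (λ w → (x *ᴷ (y *ᴷ χ x) +ᴷ w *ᴷ ψ r) +ᴷ c) (x≡x-r+r x) ⟩
    (x *ᴷ (y *ᴷ χ x) +ᴷ (y +ᴷ r) *ᴷ ψ r) +ᴷ c  ≡⟨ cong₂ (λ u v → (u +ᴷ v) +ᴷ c) (swap x y (χ x)) (distribʳ (ψ r) y r) ⟩
    (y *ᴷ (x *ᴷ χ x) +ᴷ (y *ᴷ ψ r +ᴷ r *ᴷ ψ r)) +ᴷ c ≡⟨ cong (_+ᴷ c) (+-assoc _ _ _) ⟨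
    ((y *ᴷ (x *ᴷ χ x) +ᴷ y *ᴷ ψ r) +ᴷ r *ᴷ ψ r) +ᴷ c ≡⟨ +-assoc _ _ c ⟩
    (y *ᴷ (x *ᴷ χ x) +ᴷ y *ᴷ ψ r) +ᴷ (r *ᴷ ψ r +ᴷ c) ≡⟨ cong₂ _+ᴷ_ (sym (distribˡ y _ _)) (sym (p r)) ⟩
    y *ᴷ (x *ᴷ χ x +ᴷ ψ r) +ᴷ φ r                    ∎
    where
    open ≡-Reasoning
    x≡x-r+r : ∀ x → x ≡ x +ᴷ (-ᴷ r) +ᴷ r
    x≡x-r+r x = sym (trans (+-assoc x _ r) (trans (cong (x +ᴷ_) (-‿inverseˡ r)) (+-identityʳ x)))
    swap : ∀ a b c → a *ᴷ (b *ᴷ c) ≡ b *ᴷ (a *ᴷ c)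
    swap a b c = trans (sym (*-assoc a b c)) (trans (cong (_*ᴷ c) (*-comm a b)) (*-assoc b a c))

  -- After division by x - e(0), the remaining e(i) are roots of the quotient, because they differ
  -- from e(0).
  monic-roots : ∀ {d N φ} → Monic d φ → (e : Fin N → Carrier) → (∀ {i j} → e i ≡ e j → i ≡ j) → (∀ i → φ (e i) ≡ 0#) → N ≤ d
  monic-roots {N = zero} _ e inj root = z≤n
  monic-roots {d = zero} {suc N} (one p) e inj root = contradiction (trans (sym (p _)) (root zero)) 1≢0
  monic-roots {d = suc d} {suc N} {φ} M e inj root with ψ , Mψ , div ← monic-divide M (e zero) =
    s≤s (monic-roots Mψ (e ∘ suc) (sucᶠ-injective ∘ inj) λ i → x*y≡0⇒y≡0
      (λ p → contradiction (inj (x-y≡0⇒x≡y _ _ p)) λ ())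
      (trans (sym (+-identityʳ _)) (trans (cong ((e (suc i) +ᴷ (-ᴷ e zero)) *ᴷ ψ (e (suc i)) +ᴷ_) (sym (root zero)))
        (trans (sym (div _)) (root (suc i))))))

  monic-roots-all : ∀ {d φ} → Monic d φ → (∀ x → φ x ≡ 0#) → m ≤ d
  monic-roots-all M root = monic-roots M element element-injective (root ∘ element)

-- Frobenius powers

absorption : ∀ n k → suc k * (suc n choose suc k) ≡ suc n * (n choose k)
absorption n zero = trans (ℕ.*-identityˡ _) (trans (nC1≡n (suc n)) (sym (ℕ.*-identityʳ _)))
absorption zero (suc k) = trans (cong (suc (suc k) *_) (k>n⇒nCk≡0 {1} {suc (suc k)} (s<s z<s)))
    (trans (ℕ.*-zeroʳ k) (sym (trans (ℕ.*-identityˡ _) (k>n⇒nCk≡0 {0} {suc k} z<s))))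
absorption (suc n) (suc k) = begin
  suc (suc k) * (suc (suc n) choose suc (suc k))  ≡⟨ cong (suc (suc k) *_) (nCk+nC[k+1]≡[n+1]C[k+1] (suc n) (suc k)) ⟨
  suc (suc k) * (A + (suc n choose suc (suc k)))  ≡⟨ ℕ.*-distribˡ-+ (suc (suc k)) A _ ⟩
  (A + suc k * A) + suc (suc k) * (suc n choose suc (suc k))  ≡⟨ cong₂ (λ x y → (A + x) + y) (absorption n k)
      (absorption n (suc k)) ⟩
  (A + suc n * (n choose k)) + suc n * (n choose suc k)  ≡⟨ ℕ.+-assoc A _ _ ⟩
  A + (suc n * (n choose k) + suc n * (n choose suc k))  ≡⟨ cong (A +_)
      (ℕ.*-distribˡ-+ (suc n) (n choose k) (n choose suc k)) ⟨
  A + suc n * ((n choose k) + (n choose suc k))  ≡⟨ cong (λ x → A + suc n * x) (nCk+nC[k+1]≡[n+1]C[k+1] n k) ⟩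
  A + suc n * A                                          ∎
  where
  open ≡-Reasoning
  A : ℕ
  A = suc n choose suc k

-- By absorption the prime divides k + 1 times the binomial coefficient, and it is too large to
-- divide k + 1.
prime∣binomial : ∀ {p} → Prime (suc p) → ∀ k → k < p → suc p ∣ suc p choose suc k
prime∣binomial {p} pp k k<p with euclidsLemma (suc k) (suc p choose suc k) pp
    (subst (suc p ∣_) (sym (absorption p k)) (m∣m*n (p choose k)))
... | inj₁ p∣k = contradiction (∣⇒≤ p∣k) (ℕ.<⇒≱ (s<s k<p))
... | inj₂ p∣C = p∣C

prime⇒2≤ : ∀ {p} → Prime p → 2 ≤ p
prime⇒2≤ {p} pp = nonTrivial⇒n>1 p {{prime⇒nonTrivial pp}}

primePower⇒2≤ : ∀ {q} → IsPrimePower q → 2 ≤ q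
primePower⇒2≤ (p , suc e , pp , _ , refl) = ℕ.≤-trans (prime⇒2≤ pp)
    (ℕ.m≤m*n p (p ^ e) {{ℕ.m^n≢0 p e {{>-nonZero (ℕ.<-trans z<s (prime⇒2≤ pp))}}}})

module FrobeniusProperties {q n : ℕ} .{{_ : NonZero n}} (q-primePower : IsPrimePower q) (K : FiniteField (q ^ n)) where
  open LinearizedPolynomials q n K
  open FieldProperties K hiding (_^ᴷ_; productᴷ)
  open Congruence n
  open Algebra.Properties.Semiring.Mult semiring using (×1-homo-*; ×-assoc-*; ×-assocˡ)

  2≤q : 2 ≤ q
  2≤q = primePower⇒2≤ q-primePower

  private
    p e : ℕ
    p = proj₁ q-primePower
    e = proj₁ (proj₂ q-primePower)
    p-prime : Prime p
    p-prime = proj₁ (proj₂ (proj₂ q-primePower))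

    q^j≡p^ej : ∀ j → q ^ j ≡ p ^ (e * j)
    q^j≡p^ej j = trans (cong (_^ j) (proj₂ (proj₂ (proj₂ (proj₂ q-primePower))))) (ℕ.^-*-assoc p e j)

    -- The characteristic is p: the power (p · 1)^{en} equals q^n · 1, which is 0.
    p×1≡0 : p ×ᴷ 1# ≡ 0#
    p×1≡0 = x^k≡0⇒x≡0 (e * n) (trans (sym (^×1 (e * n))) (subst (λ N → N ×ᴷ 1# ≡ 0#) (q^j≡p^ej n) m×1≡0))
      where
      ^×1 : ∀ k → (p ^ k) ×ᴷ 1# ≡ (p ×ᴷ 1#) ^ᴷ k
      ^×1 zero = +-identityʳ 1#
      ^×1 (suc k) = trans (×1-homo-* p (p ^ k)) (cong ((p ×ᴷ 1#) *ᴷ_) (^×1 k))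

    p∣k⇒k×x≡0 : ∀ {k} x → p ∣ k → k ×ᴷ x ≡ 0#
    p∣k⇒k×x≡0 x (divides j refl) = trans (sym (×-assocˡ x j p)) (trans (cong (j ×ᴷ_) p×x≡0) (j×0≡0 j))
      where
      p×x≡0 : p ×ᴷ x ≡ 0#
      p×x≡0 = trans (cong (p ×ᴷ_) (sym (*-identityˡ x))) (trans (sym (×-assoc-* p 1# x))
          (trans (cong (_*ᴷ x) p×1≡0) (zeroˡ x)))
      j×0≡0 : ∀ j → j ×ᴷ 0# ≡ 0#
      j×0≡0 zero = refl
      j×0≡0 (suc j) = trans (+-identityˡ _) (j×0≡0 j)

    -- The prime is quantified afresh because the ambient `p` is a projection and cannot be matched
    -- as a successor, which the split into first, middle and last binomial terms requires.
    ^p-+ : ∀ x y p → Prime p → (∀ {k} x → p ∣ k → k ×ᴷ x ≡ 0#) → (x +ᴷ y) ^ᴷ p ≡ x ^ᴷ p +ᴷ y ^ᴷ p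
    ^p-+ x y zero pp _ = contradiction (prime⇒2≤ pp) λ ()
    ^p-+ x y (suc p) pp vanish = begin
      (x +ᴷ y) ^ᴷ suc p  ≡⟨ theorem (suc p) x y ⟩
      term zero +ᴷ sum (term ∘ suc)  ≡⟨ cong₂ _+ᴷ_ first rest ⟩
      y ^ᴷ suc p +ᴷ x ^ᴷ suc p  ≡⟨ +-comm _ _ ⟩
      x ^ᴷ suc p +ᴷ y ^ᴷ suc p         ∎
      where
      open ≡-Reasoning
      open Algebra.Properties.CommutativeSemiring.Binomial commutativeSemiring using (theorem; binomialTerm)
      term : Fin (suc (suc p)) → 𝔽
      term = binomialTerm x y (suc p)
      first : term zero ≡ y ^ᴷ suc p
      first = trans (+-identityʳ _) (*-identityˡ _)
      last-term : ∀ j → j ≡ suc p → (suc p choose j) ×ᴷ (x ^ᴷ j *ᴷ y ^ᴷ (suc p ∸ j)) ≡ x ^ᴷ suc p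
      last-term _ refl = trans (cong (_×ᴷ (x ^ᴷ suc p *ᴷ y ^ᴷ (p ∸ p))) (nCn≡1 (suc p))) (trans (+-identityʳ _)
        (trans (cong (λ z → x ^ᴷ suc p *ᴷ y ^ᴷ z) (ℕ.n∸n≡0 p)) (*-identityʳ _)))
      rest : sum (term ∘ suc) ≡ x ^ᴷ suc p
      rest = trans (sum-single (term ∘ suc) (fromℕ p) middle) (last-term (suc (toℕ (fromℕ p))) (cong suc (toℕ-fromℕ p)))
        where
        middle : ∀ i → i ≢ fromℕ p → term (suc i) ≡ 0#
        middle i i≢p = vanish _ (prime∣binomial pp (toℕ i) (ℕ.≤∧≢⇒< (s≤s⁻¹ (toℕ<n i))
          λ i≡p → i≢p (toℕ-injective (trans i≡p (sym (toℕ-fromℕ p))))))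

  ^[]-+ : ∀ x y j → (x +ᴷ y) ^[ j ] ≡ x ^[ j ] +ᴷ y ^[ j ]
  ^[]-+ x y j = subst (λ N → (x +ᴷ y) ^ᴷ N ≡ x ^ᴷ N +ᴷ y ^ᴷ N) (sym (q^j≡p^ej j)) (^p^k-+ x y (e * j))
    where
    ^p^k-+ : ∀ x y k → (x +ᴷ y) ^ᴷ (p ^ k) ≡ x ^ᴷ (p ^ k) +ᴷ y ^ᴷ (p ^ k)
    ^p^k-+ x y zero = trans (*-identityʳ _) (sym (cong₂ _+ᴷ_ (*-identityʳ x) (*-identityʳ y)))
    ^p^k-+ x y (suc k) = trans (sym (^-assocʳ _ p _)) (trans (cong (_^ᴷ (p ^ k)) (^p-+ x y p p-prime p∣k⇒k×x≡0))
      (trans (^p^k-+ _ _ k) (cong₂ _+ᴷ_ (^-assocʳ x p _) (^-assocʳ y p _))))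

  ^[]-* : ∀ x y j → (x *ᴷ y) ^[ j ] ≡ x ^[ j ] *ᴷ y ^[ j ]
  ^[]-* x y j = ^-distrib-* x y (q ^ j)

  ^[]-1 : ∀ j → 1# ^[ j ] ≡ 1#
  ^[]-1 j = 1^k≡1 (q ^ j)
    where
    1^k≡1 : ∀ k → 1# ^ᴷ k ≡ 1#
    1^k≡1 zero = refl
    1^k≡1 (suc k) = trans (*-identityˡ _) (1^k≡1 k)

  ^[]-0 : ∀ j → 0# ^[ j ] ≡ 0#
  ^[]-0 j = +-cancelˡ (0# ^[ j ]) _ _ (trans (sym (^[]-+ 0# 0# j))
      (trans (cong (_^[ j ]) (+-identityˡ 0#)) (sym (+-identityʳ _))))

  ^[]-neg : ∀ x j → (-ᴷ x) ^[ j ] ≡ -ᴷ (x ^[ j ])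
  ^[]-neg x j = -‿uniqueˡ _ _ (trans (sym (^[]-+ (-ᴷ x) x j)) (trans (cong (_^[ j ]) (-‿inverseˡ x)) (^[]-0 j)))

  ^[]-^[] : ∀ x i j → (x ^[ i ]) ^[ j ] ≡ x ^[ i + j ]
  ^[]-^[] x i j = trans (^-assocʳ x (q ^ i) (q ^ j)) (cong (x ^ᴷ_) (sym (ℕ.^-distribˡ-+-* q i j)))

  ^[0] : ∀ x → x ^[ 0 ] ≡ x
  ^[0] x = *-identityʳ x

  ^[1] : ∀ x → x ^[ 1 ] ≡ x ^ᴷ q
  ^[1] x = cong (x ^ᴷ_) (ℕ.*-identityʳ q)

  ∈𝔽q⇒^[] : ∀ {x} → x ∈ 𝔽q → ∀ j → x ^[ j ] ≡ x
  ∈𝔽q⇒^[] {x} x∈ zero = ^[0] x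
  ∈𝔽q⇒^[] {x} x∈ (suc j) = trans (sym (^[]-^[] x 1 j)) (trans (cong (_^[ j ]) (trans (^[1] x) x∈)) (∈𝔽q⇒^[] x∈ j))

  ^[]-cong : ∀ {i j} x → i ≋ j → x ^[ i ] ≡ x ^[ j ]
  ^[]-cong {i} {j} x i≋j = trans (reduce i) (trans (cong (x ^[_]) i≋j) (sym (reduce j)))
    where
    ^[kn] : ∀ k → x ^[ k * n ] ≡ x
    ^[kn] zero = ^[0] x
    ^[kn] (suc k) = trans (sym (^[]-^[] x n (k * n))) (trans (cong (_^[ k * n ]) (fermat x)) (^[kn] k))
    reduce : ∀ i → x ^[ i ] ≡ x ^[ i % n ]
    reduce i = trans (cong (x ^[_]) (trans (m≡m%n+[m/n]*n i n) (ℕ.+-comm (i % n) _)))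
      (trans (sym (^[]-^[] x (i / n * n) (i % n))) (cong (_^[ i % n ]) (^[kn] (i / n))))

  ^[]-undo : ∀ x j → (x ^[ j ]) ^[ neg j ] ≡ x
  ^[]-undo x j = trans (^[]-^[] x j (neg j)) (trans (^[]-cong x (+neg j 0)) (^[0] x))

  ^[]-undo′ : ∀ x j → (x ^[ neg j ]) ^[ j ] ≡ x
  ^[]-undo′ x j = trans (^[]-^[] x (neg j) j) (trans (cong (x ^[_]) (ℕ.+-comm (neg j) j))
      (trans (^[]-cong x (+neg j 0)) (^[0] x)))

  ^[]-injective : ∀ {x y} j → x ^[ j ] ≡ y ^[ j ] → x ≡ y
  ^[]-injective {x} {y} j p = trans (sym (^[]-undo x j)) (trans (cong (_^[ neg j ]) p) (^[]-undo y j))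

  ^[]≡0⇒≡0 : ∀ {x} j → x ^[ j ] ≡ 0# → x ≡ 0#
  ^[]≡0⇒≡0 j p = x^k≡0⇒x≡0 (q ^ j) p

  ^[]-sum : ∀ {d} (g : Vector 𝔽 d) j → sum g ^[ j ] ≡ sum (λ i → g i ^[ j ])
  ^[]-sum {zero} g j = ^[]-0 j
  ^[]-sum {suc d} g j = trans (^[]-+ _ _ j) (cong (g zero ^[ j ] +ᴷ_) (^[]-sum (g ∘ suc) j))

  2≤q^ : ∀ k → 1 ≤ k → 2 ≤ q ^ k
  2≤q^ (suc k) _ = ℕ.≤-trans 2≤q (ℕ.m≤m*n q (q ^ k) {{ℕ.m^n≢0 q k {{>-nonZero (ℕ.<-trans z<s 2≤q)}}}})

  2≤q^n : 2 ≤ q ^ n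
  2≤q^n = 2≤q^ n (>-nonZero⁻¹ n)

  -- If the top coefficient were nonzero, all q^n elements would be roots of a monic
  -- polynomial of smaller degree.
  linearized-zero : ∀ d → d ≤ n → (c : Vector 𝔽 d) → (∀ x → sum (λ i → c i *ᴷ x ^[ toℕ i ]) ≡ 0#) → ∀ i → c i ≡ 0#
  linearized-zero (suc d) d<n c vanish = all
    where
    init : Vector 𝔽 d
    init = c ∘ inject₁
    top : 𝔽
    top = c (fromℕ d)
    low : 𝔽 → 𝔽
    low x = sum (λ i → init i *ᴷ x ^[ toℕ i ])
    split : ∀ x → low x +ᴷ top *ᴷ x ^[ d ] ≡ 0#
    split x = trans (sym (trans (sum-init-last (λ i → c i *ᴷ x ^[ toℕ i ]))
      (cong₂ _+ᴷ_ (sum-cong-≗ λ i → cong (λ j → init i *ᴷ x ^[ j ]) (toℕ-inject₁ i))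
                  (cong (λ j → top *ᴷ x ^[ j ]) (toℕ-fromℕ d))))) (vanish x)
    low-poly : Poly (q ^ d) low
    low-poly = poly-sum _ λ i → poly-≤ (ℕ.^-monoʳ-< q 2≤q (toℕ<n i)) (poly-scale (init i) (poly-^ (q ^ toℕ i)))
    top≡0 : top ≡ 0#
    top≡0 with top ≟ 0#
    ... | yes p = p
    ... | no top≢0 = contradiction (monic-roots-all (monic-+ (monic-^ (q ^ d)) (poly-scale u low-poly)) root)
        (ℕ.<⇒≱ (ℕ.^-monoʳ-< q 2≤q d<n))
      where
      u : 𝔽
      u = proj₁ (reciprocal top top≢0)
      root : ∀ x → x ^[ d ] +ᴷ u *ᴷ low x ≡ 0#
      root x = begin
        x ^[ d ] +ᴷ u *ᴷ low x  ≡⟨ cong (_+ᴷ u *ᴷ low x) (*-identityˡ _) ⟨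
        1# *ᴷ x ^[ d ] +ᴷ u *ᴷ low x  ≡⟨ cong (λ w → w *ᴷ x ^[ d ] +ᴷ u *ᴷ low x) (proj₂ (reciprocal top top≢0)) ⟨
        u *ᴷ top *ᴷ x ^[ d ] +ᴷ u *ᴷ low x  ≡⟨ cong (_+ᴷ u *ᴷ low x) (*-assoc u top _) ⟩
        u *ᴷ (top *ᴷ x ^[ d ]) +ᴷ u *ᴷ low x  ≡⟨ distribˡ u _ _ ⟨
        u *ᴷ (top *ᴷ x ^[ d ] +ᴷ low x)  ≡⟨ cong (u *ᴷ_) (trans (+-comm _ _) (split x)) ⟩
        u *ᴷ 0#  ≡⟨ zeroʳ u ⟩
        0#                                       ∎
        where open ≡-Reasoning
    init≡0 : ∀ i → init i ≡ 0#
    init≡0 = linearized-zero d (ℕ.<⇒≤ d<n) init λ x → trans (sym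
        (trans (cong (low x +ᴷ_) (trans (cong (_*ᴷ x ^[ d ]) top≡0) (zeroˡ _))) (+-identityʳ _))) (split x)
    all : ∀ i → c i ≡ 0#
    all i with view i
    ... | ‵fromℕ = top≡0
    ... | ‵inject₁ j = init≡0 j

-- Linearized polynomials

module LinearizedAlgebra {q n : ℕ} .{{_ : NonZero n}} (q-primePower : IsPrimePower q) (K : FiniteField (q ^ n)) where
  open LinearizedPolynomials q n K
  open FieldProperties K hiding (_^ᴷ_; productᴷ)
  open FrobeniusProperties q-primePower K
  open Congruence n
  open LinearAlgebra K U 𝓛-module public using (lincomb; LinearlyIndependent)
  open Algebra.Definitions.RawMonoid (RawLeftModule.+ᴹ-rawMonoid 𝓛-module) renaming (sum to sumᴸ) using ()

  0ᴸ : 𝓛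
  0ᴸ = replicate n 0#

  mod-cong : ∀ {i j} → i ≋ j → i mod n ≡ j mod n
  mod-cong {i} {j} p = fromℕ<-cong (i % n) (j % n) p (m%n<n i n) (m%n<n j n)

  toℕ-mod : ∀ i → toℕ i mod n ≡ i
  toℕ-mod i = toℕ-injective (trans (toℕ-fromℕ< (m%n<n (toℕ i) n)) (m<n⇒m%n≡m (toℕ<n i)))

  mod-≋ : ∀ k → toℕ (k mod n) ≋ k
  mod-≋ k = trans (cong (_% n) (toℕ-fromℕ< (m%n<n k n))) (%-≋ k)

  𝓛-lookup-ext : ∀ {f g : 𝓛} → (∀ i → lookup f i ≡ lookup g i) → f ≡ g
  𝓛-lookup-ext {f} {g} p = trans (sym (tabulate∘lookup f)) (trans (tabulate-cong p) (tabulate∘lookup g))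

  -- Opaque so that f can be inferred from coef f k.
  opaque
    coef : 𝓛 → ℕ → 𝔽
    coef f k = lookup f (k mod n)

    coef-cong : ∀ {i j} f → i ≋ j → coef f i ≡ coef f j
    coef-cong f p = cong (lookup f) (mod-cong p)

    coef-mod : ∀ f k → lookup f (k mod n) ≡ coef f k
    coef-mod f k = refl

    𝓛-ext : ∀ {f g} → (∀ k → coef f k ≡ coef g k) → f ≡ g
    𝓛-ext {f} {g} p = 𝓛-lookup-ext λ i → trans (cong (lookup f) (sym (toℕ-mod i)))
        (trans (p (toℕ i)) (cong (lookup g) (toℕ-mod i)))

    coef-⊕ : ∀ f g k → coef (f ⊕ g) k ≡ coef f k +ᴷ coef g k
    coef-⊕ f g k = lookup-zipWith _+ᴷ_ (k mod n) f g

    coef-• : ∀ a f k → coef (a • f) k ≡ a *ᴷ coef f k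
    coef-• a f k = lookup-map (k mod n) (a *ᴷ_) f

    coef-⊖ : ∀ f g k → coef (f ⊖ g) k ≡ coef f k +ᴷ (-ᴷ coef g k)
    coef-⊖ f g k = trans (coef-⊕ f _ k) (cong (coef f k +ᴷ_) (lookup-map (k mod n) -ᴷ_ g))

    coef-0 : ∀ k → coef 0ᴸ k ≡ 0#
    coef-0 k = lookup-replicate (k mod n) 0#

    coef-monomial-≋ : ∀ {i k} a → k ≋ i → coef (a ·x^[ i ]) k ≡ a
    coef-monomial-≋ {i} {k} a p = trans (cong (lookup (a ·x^[ i ])) (mod-cong p)) (lookup∘update (i mod n) 0ᴸ a)

    coef-monomial-≋̸ : ∀ {i k} a → ¬ k ≋ i → coef (a ·x^[ i ]) k ≡ 0#
    coef-monomial-≋̸ {i} {k} a p = trans (lookup∘update′ (λ e → p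
        (trans (sym (mod-≋ k)) (trans (cong (λ z → toℕ z % n) e) (mod-≋ i)))) 0ᴸ a) (coef-0 k)

  f⊖g≡0⇒f≡g : ∀ {f g} → f ⊖ g ≡ 0ᴸ → f ≡ g
  f⊖g≡0⇒f≡g {f} {g} p = 𝓛-ext λ k → x-y≡0⇒x≡y _ _ (trans (sym (coef-⊖ f g k)) (trans (cong (λ h → coef h k) p) (coef-0 k)))

  coef-sumᴸ : ∀ {d} (F : Vector 𝓛 d) k → coef (sumᴸ F) k ≡ sum (λ i → coef (F i) k)
  coef-sumᴸ {zero} F k = coef-0 k
  coef-sumᴸ {suc d} F k = trans (coef-⊕ (F zero) _ k) (cong (coef (F zero) k +ᴷ_) (coef-sumᴸ (F ∘ suc) k))

  coef-lincomb : ∀ {d} c (b : Vector 𝓛 d) k → coef (lincomb c b) k ≡ sum (λ i → c i *ᴷ coef (b i) k)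
  coef-lincomb c b k = trans (coef-sumᴸ (λ i → c i • b i) k) (sum-cong-≗ λ i → coef-• (c i) (b i) k)

  coef-shift : ∀ j f k → coef (shift j f) (k + j) ≡ coef f k ^[ j ]
  coef-shift j f k = trans (coef-sumᴸ {n} _ (k + j)) (trans (sum-single _ (k mod n) others)
      (trans (coef-monomial-≋ (lookup f (k mod n) ^[ j ]) (≋-+ {k} {toℕ (k mod n)} {j} {j} (sym (mod-≋ k)) refl))
          (cong (_^[ j ]) (coef-mod f k))))
    where
    others : ∀ i → i ≢ k mod n → coef ((lookup f i ^[ j ]) ·x^[ toℕ i + j ]) (k + j) ≡ 0#
    others i i≢k = coef-monomial-≋̸ _ λ p → i≢k (trans (sym (toℕ-mod i)) (mod-cong (sym (≋-cancelʳ j p))))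

  coef-shift′ : ∀ j f k l → k + j ≋ l → coef (shift j f) l ≡ coef f k ^[ j ]
  coef-shift′ j f k l p = trans (coef-cong (shift j f) (sym p)) (coef-shift j f k)

  shift-coef : ∀ j f k → coef (shift j f) k ≡ coef f (k + neg j) ^[ j ]
  shift-coef j f k = coef-shift′ j f (k + neg j) k (trans (cong (_% n)
      (trans (ℕ.+-assoc k _ j) (cong (k +_) (ℕ.+-comm (neg j) j)))) (+neg j k))

  shift-cong : ∀ {i j} f → i ≋ j → shift i f ≡ shift j f
  shift-cong {i} {j} f p = 𝓛-ext λ k → trans (shift-coef i f k) (trans (^[]-cong _ p)
    (sym (coef-shift′ j f (k + neg i) k (trans (≋-+ {k + neg i} refl (sym p))
        (trans (cong (_% n) (trans (ℕ.+-assoc k _ i) (cong (k +_) (ℕ.+-comm (neg i) i)))) (+neg i k))))))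

  shift-shift : ∀ i j f → shift j (shift i f) ≡ shift (i + j) f
  shift-shift i j f = 𝓛-ext λ k → let l = k + neg (i + j) in
    trans (coef-shift′ j (shift i f) (l + i) k (trans (cong (_% n)
        (trans (ℕ.+-assoc l i j) (trans (ℕ.+-assoc k _ (i + j)) (cong (k +_) (ℕ.+-comm _ (i + j)))))) (+neg (i + j) k)))
      (trans (cong (_^[ j ]) (coef-shift i f l)) (trans (^[]-^[] _ i j) (sym (shift-coef (i + j) f k))))

  shift-monomial : ∀ j a i → shift j (a ·x^[ i ]) ≡ (a ^[ j ]) ·x^[ i + j ]
  shift-monomial j a i = 𝓛-ext λ k → trans (shift-coef j _ k) (by-cases k ((k + neg j) % n ℕ.≟ i % n))
    where
    k≋ : ∀ k → k + neg j + j ≋ k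
    k≋ k = trans (cong (_% n) (trans (ℕ.+-assoc k _ j) (cong (k +_) (ℕ.+-comm (neg j) j)))) (+neg j k)
    by-cases : ∀ k → Dec (k + neg j ≋ i) → coef (a ·x^[ i ]) (k + neg j) ^[ j ] ≡ coef ((a ^[ j ]) ·x^[ i + j ]) k
    by-cases k (yes p) = trans (cong (_^[ j ]) (coef-monomial-≋ a p))
        (sym (coef-monomial-≋ _ (trans (sym (k≋ k)) (≋-+ p refl))))
    by-cases k (no ¬p) = trans (cong (_^[ j ]) (coef-monomial-≋̸ a ¬p)) (trans (^[]-0 j)
      (sym (coef-monomial-≋̸ _ λ p → ¬p (≋-cancelʳ j (trans (k≋ k) p)))))

  x^[]-cong : ∀ {i j} → i ≋ j → x^[ i ] ≡ x^[ j ]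
  x^[]-cong p = cong (λ m → 0ᴸ Vec.[ m ]≔ 1#) (mod-cong p)

  shift-x^[] : ∀ j i → shift j x^[ i ] ≡ x^[ i + j ]
  shift-x^[] j i = trans (shift-monomial j 1# i) (cong (_·x^[ i + j ]) (^[]-1 j))

  shift-⊕ : ∀ j f g → shift j (f ⊕ g) ≡ shift j f ⊕ shift j g
  shift-⊕ j f g = 𝓛-ext λ k → trans (shift-coef j _ k) (trans (cong (_^[ j ]) (coef-⊕ f g _))
    (trans (^[]-+ _ _ j) (trans (sym (cong₂ _+ᴷ_ (shift-coef j f k) (shift-coef j g k))) (sym (coef-⊕ _ _ k)))))

  shift-⊖ : ∀ j f g → shift j (f ⊖ g) ≡ shift j f ⊖ shift j g
  shift-⊖ j f g = 𝓛-ext λ k → trans (shift-coef j _ k) (trans (cong (_^[ j ]) (coef-⊖ f g _))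
    (trans (^[]-+ _ _ j) (trans (cong₂ _+ᴷ_ (sym (shift-coef j f k))
        (trans (^[]-neg _ j) (cong -ᴷ_ (sym (shift-coef j g k))))) (sym (coef-⊖ _ _ k)))))

  shift-• : ∀ j a f → shift j (a • f) ≡ (a ^[ j ]) • shift j f
  shift-• j a f = 𝓛-ext λ k → trans (shift-coef j _ k) (trans (cong (_^[ j ]) (coef-• a f _))
    (trans (^[]-* _ _ j) (trans (cong ((a ^[ j ]) *ᴷ_) (sym (shift-coef j f k))) (sym (coef-• _ _ k)))))

  shift-0ᴸ : ∀ j → shift j 0ᴸ ≡ 0ᴸ
  shift-0ᴸ j = 𝓛-ext λ k → trans (shift-coef j _ k) (trans (cong (_^[ j ]) (coef-0 _)) (trans (^[]-0 j) (sym (coef-0 k))))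

  -- Subspaces of linearized polynomials and their dimension

  record IsSubspace (W : Code) : Set where
    field
      0∈ : 0ᴸ ∈ W
      ⊕∈ : ∀ {f g} → f ∈ W → g ∈ W → f ⊕ g ∈ W
      •∈ : ∀ a {f} → f ∈ W → a • f ∈ W

    lincomb∈ : ∀ {d} c (b : Vector 𝓛 d) → (∀ i → b i ∈ W) → lincomb c b ∈ W
    lincomb∈ {zero} c b _ = 0∈
    lincomb∈ {suc d} c b b∈ = ⊕∈ (•∈ (c zero) (b∈ zero)) (lincomb∈ (c ∘ suc) (b ∘ suc) (b∈ ∘ suc))

    ⟨⟩⊆ : ∀ {d} {b : Vector 𝓛 d} → (∀ i → b i ∈ W) → ⟨ b ⟩ ⊆ W
    ⟨⟩⊆ {b = b} b∈ (c , _ , refl) = lincomb∈ c b b∈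

    ⊖∈ : ∀ {f g} → f ∈ W → g ∈ W → f ⊖ g ∈ W
    ⊖∈ {f} {g} f∈ g∈ = subst W (𝓛-ext λ k → trans (coef-⊕ f _ k)
        (trans (cong (coef f k +ᴷ_) (trans (coef-• _ g k) (-1*x≈-x _))) (sym (coef-⊖ f g k)))) (⊕∈ f∈ (•∈ (-ᴷ 1#) g∈))

  open IsSubspace

  ⟨⟩-subspace : ∀ {d} (b : Vector 𝓛 d) → IsSubspace ⟨ b ⟩
  ⟨⟩-subspace b .0∈ = (λ _ → 0#) , _ , 𝓛-ext λ k → trans (coef-0 k)
      (sym (trans (coef-lincomb _ b k) (sum-zero (λ i → 0# *ᴷ coef (b i) k) λ i → zeroˡ _)))
  ⟨⟩-subspace b .⊕∈ (c , _ , refl) (c′ , _ , refl) = (λ i → c i +ᴷ c′ i) , _ , 𝓛-ext λ k → begin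
      coef (lincomb c b ⊕ lincomb c′ b) k  ≡⟨ coef-⊕ _ _ k ⟩
      coef (lincomb c b) k +ᴷ coef (lincomb c′ b) k  ≡⟨ cong₂ _+ᴷ_ (coef-lincomb c b k) (coef-lincomb c′ b k) ⟩
      sum (λ i → c i *ᴷ coef (b i) k) +ᴷ sum (λ i → c′ i *ᴷ coef (b i) k) ≡⟨ ∑-distrib-+ (λ i → c i *ᴷ coef (b i) k)
          (λ i → c′ i *ᴷ coef (b i) k) ⟨
      sum (λ i → c i *ᴷ coef (b i) k +ᴷ c′ i *ᴷ coef (b i) k)  ≡⟨ sum-cong-≗ (λ i → distribʳ (coef (b i) k) (c i) (c′ i)) ⟨
      sum (λ i → (c i +ᴷ c′ i) *ᴷ coef (b i) k)  ≡⟨ coef-lincomb _ b k ⟨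
      coef (lincomb (λ i → c i +ᴷ c′ i) b) k                       ∎
    where open ≡-Reasoning
  ⟨⟩-subspace b .•∈ a (c , _ , refl) = (λ i → a *ᴷ c i) , _ , 𝓛-ext λ k → begin
      coef (a • lincomb c b) k  ≡⟨ trans (coef-• a _ k) (cong (a *ᴷ_) (coef-lincomb c b k)) ⟩
      a *ᴷ sum (λ i → c i *ᴷ coef (b i) k)  ≡⟨ *-distribˡ-sum a (λ i → c i *ᴷ coef (b i) k) ⟩
      sum (λ i → a *ᴷ (c i *ᴷ coef (b i) k))  ≡⟨ sum-cong-≗ (λ i → *-assoc a (c i) (coef (b i) k)) ⟨
      sum (λ i → a *ᴷ c i *ᴷ coef (b i) k)  ≡⟨ coef-lincomb _ b k ⟨
      coef (lincomb (λ i → a *ᴷ c i) b) k         ∎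
    where open ≡-Reasoning

  ∈⟨⟩ : ∀ {d} (b : Vector 𝓛 d) i → b i ∈ ⟨ b ⟩
  ∈⟨⟩ b i = δ , _ , 𝓛-ext λ k → sym (trans (coef-lincomb δ b k)
      (trans (sum-single _ i (others k)) (trans (cong (_*ᴷ coef (b i) k) δ-diag) (*-identityˡ _))))
    where
    δ : Vector 𝔽 _
    δ j with j ≟ᶠ i
    ... | yes _ = 1#
    ... | no _ = 0#
    δ-diag : δ i ≡ 1#
    δ-diag with i ≟ᶠ i
    ... | yes _ = refl
    ... | no i≢i = contradiction refl i≢i
    others : ∀ k j → j ≢ i → δ j *ᴷ coef (b j) k ≡ 0#
    others k j j≢i with j ≟ᶠ i
    ... | yes j≡i = contradiction j≡i j≢i
    ... | no _ = zeroˡ _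

  shiftCode-subspace : ∀ j {W} → IsSubspace W → IsSubspace (shiftCode j W)
  shiftCode-subspace j W-sub .0∈ = 0ᴸ , 0∈ W-sub , sym (shift-0ᴸ j)
  shiftCode-subspace j W-sub .⊕∈ (f , f∈ , refl) (g , g∈ , refl) = f ⊕ g , ⊕∈ W-sub f∈ g∈ , sym (shift-⊕ j f g)
  -- `shift j` is only semilinear: to scale the image by a, the preimage is scaled by the q^j-th
  -- root of a.
  shiftCode-subspace j W-sub .•∈ a (f , f∈ , refl) = (a ^[ neg j ]) • f , •∈ W-sub _ f∈ ,
    sym (trans (shift-• j _ f) (cong (_• shift j f) (^[]-undo′ a j)))

  ∩-subspace : ∀ {V W} → IsSubspace V → IsSubspace W → IsSubspace (V ∩ W)
  ∩-subspace V W .0∈ = 0∈ V , 0∈ W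
  ∩-subspace V W .⊕∈ (f∈V , f∈W) (g∈V , g∈W) = ⊕∈ V f∈V g∈V , ⊕∈ W f∈W g∈W
  ∩-subspace V W .•∈ a (f∈V , f∈W) = •∈ V a f∈V , •∈ W a f∈W

  ≐-subspace : ∀ {V W : Code} → V ≐ W → IsSubspace W → IsSubspace V
  ≐-subspace (to , from) W .0∈ = from (0∈ W)
  ≐-subspace (to , from) W .⊕∈ f∈ g∈ = from (⊕∈ W (to f∈) (to g∈))
  ≐-subspace (to , from) W .•∈ a f∈ = from (•∈ W a (to f∈))

  hasDim⇒subspace : ∀ {W : Code} {d} → HasDim W d → IsSubspace W
  hasDim⇒subspace (b , _ , W≐) = ≐-subspace W≐ (⟨⟩-subspace b)

  -- A bound dim W ≤ e in terms of coordinates. It asks neither for a basis of W nor for a decision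
  -- of membership.
  DeterminedBy : Code → ∀ {e} → (Fin e → ℕ) → Set
  DeterminedBy W p = ∀ f → f ∈ W → (∀ i → coef f (p i) ≡ 0#) → f ≡ 0ᴸ

  coef-difference : ∀ {d} c c′ (b : Vector 𝓛 d) k → coef (lincomb c b) k ≡ coef (lincomb c′ b) k → coef
      (lincomb (λ j → c j +ᴷ (-ᴷ c′ j)) b) k ≡ 0#
  coef-difference c c′ b k eq = +-cancelʳ (coef (lincomb c′ b) k) _ _ (begin
    coef (lincomb (λ j → c j +ᴷ (-ᴷ c′ j)) b) k +ᴷ coef (lincomb c′ b) k  ≡⟨ cong₂ _+ᴷ_ (coef-lincomb _ b k)
        (coef-lincomb c′ b k) ⟩
    sum (λ j → (c j +ᴷ (-ᴷ c′ j)) *ᴷ coef (b j) k) +ᴷ sum (λ j → c′ j *ᴷ coef (b j) k)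
      ≡⟨ ∑-distrib-+ (λ j → (c j +ᴷ (-ᴷ c′ j)) *ᴷ coef (b j) k) (λ j → c′ j *ᴷ coef (b j) k) ⟨
    sum (λ j → (c j +ᴷ (-ᴷ c′ j)) *ᴷ coef (b j) k +ᴷ c′ j *ᴷ coef (b j) k)
      ≡⟨ sum-cong-≗ (λ j → trans (sym (distribʳ (coef (b j) k) _ (c′ j))) (cong (_*ᴷ coef (b j) k)
           (trans (+-assoc (c j) _ _) (trans (cong (c j +ᴷ_) (-‿inverseˡ (c′ j))) (+-identityʳ (c j)))))) ⟩
    sum (λ j → c j *ᴷ coef (b j) k)  ≡⟨ coef-lincomb c b k ⟨
    coef (lincomb c b) k  ≡⟨ eq ⟩
    coef (lincomb c′ b) k  ≡⟨ +-identityˡ _ ⟨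
    0# +ᴷ coef (lincomb c′ b) k                                            ∎)
    where open ≡-Reasoning

  -- Two combinations of `b` with the same e coefficients differ by an element of W that vanishes at
  -- all of `p`, hence by 0; independence then identifies the scalars.
  independent⇒≤ : ∀ {W d e} (p : Fin e → ℕ) → IsSubspace W → DeterminedBy W p →
    (b : Vector 𝓛 d) → (∀ i → b i ∈ W) → LinearlyIndependent b → d ≤ e
  independent⇒≤ p W-sub det b b∈ b-indep = vectors-injective⇒≤ 2≤q^n (λ c i → coef (lincomb c b) (p i)) λ c c′ eq i →
      x-y≡0⇒x≡y _ _ (b-indep (λ j → c j +ᴷ (-ᴷ c′ j)) _ (det _ (lincomb∈ W-sub _ b b∈)
          (λ k → coef-difference c c′ b (p k) (eq k))) i)

  dimension≤ : ∀ {W V : Code} {d e} (p : Fin e → ℕ) → HasDim W d → W ⊆ V → DeterminedBy V p → d ≤ e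
  dimension≤ p W-dim@(b , b-indep , W≐) W⊆V det =
    independent⇒≤ p (hasDim⇒subspace W-dim) (λ f f∈ → det f (W⊆V f∈)) b (λ i → proj₂ W≐ (∈⟨⟩ b i)) b-indep

  dual⇒independent : ∀ {d} (b : Vector 𝓛 d) (p : Fin d → ℕ) →
    (∀ i → coef (b i) (p i) ≡ 1#) → (∀ {i k} → i ≢ k → coef (b i) (p k) ≡ 0#) →
    ∀ c k → coef (lincomb c b) (p k) ≡ c k
  dual⇒independent b p diag off c k = trans (coef-lincomb c b (p k)) (trans
    (sum-single _ k (λ i i≢k → trans (cong (c i *ᴷ_) (off i≢k)) (zeroʳ (c i))))
    (trans (cong (c k *ᴷ_) (diag k)) (*-identityʳ (c k))))

  -- Positions dual to `b` serve twice. They read off the coordinates of a combination, which gives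
  -- independence; and since they determine W, subtracting from f the combination with its own
  -- coordinates leaves 0.
  dual⇒hasDim : ∀ {W : Code} {d} → IsSubspace W → (b : Vector 𝓛 d) (p : Fin d → ℕ) → (∀ i → b i ∈ W) →
    (∀ i → coef (b i) (p i) ≡ 1#) → (∀ {i k} → i ≢ k → coef (b i) (p k) ≡ 0#) →
    DeterminedBy W p → HasDim W d
  dual⇒hasDim {W} W-sub b p b∈ diag off det = b ,
      (λ c _ eq i → trans (sym (dual⇒independent b p diag off c i)) (trans (cong (λ f → coef f (p i)) eq) (coef-0 (p i)))) ,
      (λ {f} f∈ → (λ i → coef f (p i)) , _ , f⊖g≡0⇒f≡g (det _ (⊖∈ W-sub f∈ (lincomb∈ W-sub _ b b∈)) λ i →
        trans (coef-⊖ f _ (p i)) (trans (cong (λ z → coef f (p i) +ᴷ (-ᴷ z)) (dual⇒independent b p diag off _ i))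
            (-‿inverseʳ _)))) ,
      ⟨⟩⊆ W-sub b∈

  -- Opaque so that f can be inferred from ev f x.
  opaque
    ev : 𝓛 → 𝔽 → 𝔽
    ev = eval

    ev≡eval : ∀ f x → ev f x ≡ eval f x
    ev≡eval f x = refl

    ev-⊕ : ∀ f g x → ev (f ⊕ g) x ≡ ev f x +ᴷ ev g x
    ev-⊕ f g x = trans (sum-cong-≗ {n} λ i → trans (cong (_*ᴷ x ^[ toℕ i ]) (lookup-zipWith _+ᴷ_ i f g))
        (distribʳ _ _ _)) (∑-distrib-+ {n} _ _)

    ev-• : ∀ a f x → ev (a • f) x ≡ a *ᴷ ev f x
    ev-• a f x = trans (sum-cong-≗ {n} λ i → trans (cong (_*ᴷ x ^[ toℕ i ]) (lookup-map i (a *ᴷ_) f))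
        (*-assoc a _ _)) (sym (*-distribˡ-sum {n} a _))

    ev-0ᴸ : ∀ x → ev 0ᴸ x ≡ 0#
    ev-0ᴸ x = sum-zero {n} _ λ i → trans (cong (_*ᴷ x ^[ toℕ i ]) (lookup-replicate i 0#)) (zeroˡ _)

    ev-sumᴸ : ∀ {d} (F : Vector 𝓛 d) x → ev (sumᴸ F) x ≡ sum (λ i → ev (F i) x)
    ev-sumᴸ {zero} F x = ev-0ᴸ x
    ev-sumᴸ {suc d} F x = trans (ev-⊕ (F zero) _ x) (cong (ev (F zero) x +ᴷ_) (ev-sumᴸ (F ∘ suc) x))

    ev-lincomb : ∀ {d} c (b : Vector 𝓛 d) x → ev (lincomb c b) x ≡ sum (λ i → c i *ᴷ ev (b i) x)
    ev-lincomb c b x = trans (ev-sumᴸ (λ i → c i • b i) x) (sum-cong-≗ λ i → ev-• (c i) (b i) x)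

    ev-monomial : ∀ a i x → ev (a ·x^[ i ]) x ≡ a *ᴷ x ^[ i ]
    ev-monomial a i x = trans (sum-single {n} _ (i mod n) λ j j≢i → trans
        (cong (_*ᴷ x ^[ toℕ j ]) (trans (lookup∘update′ j≢i 0ᴸ a) (lookup-replicate j 0#))) (zeroˡ _))
      (cong₂ _*ᴷ_ (lookup∘update (i mod n) 0ᴸ a) (^[]-cong x (mod-≋ i)))

    ev-x^[] : ∀ i x → ev x^[ i ] x ≡ x ^[ i ]
    ev-x^[] i x = trans (ev-monomial 1# i x) (*-identityˡ _)

    ev-id : ∀ x → ev x^[ 0 ] x ≡ x
    ev-id x = trans (ev-x^[] 0 x) (^[0] x)

    ev-shift : ∀ j f x → ev (shift j f) x ≡ ev f x ^[ j ]
    ev-shift j f x = trans (ev-sumᴸ {n} _ x) (trans (sum-cong-≗ {n} λ i → trans (ev-monomial _ (toℕ i + j) x)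
      (trans (cong (lookup f i ^[ j ] *ᴷ_) (sym (^[]-^[] x (toℕ i) j))) (sym (^[]-* _ _ j)))) (sym (^[]-sum {n} _ j)))

    ev-∘ : ∀ f g x → ev (f ∘ᴸ g) x ≡ ev f (ev g x)
    ev-∘ f g x = trans (ev-sumᴸ {n} _ x) (sum-cong-≗ {n} λ i → trans (ev-• _ (shift (toℕ i) g) x)
        (cong (lookup f i *ᴷ_) (ev-shift (toℕ i) g x)))

    -- The difference of coefficients is subject to `linearized-zero` with d = n. Identities between
    -- compositions can therefore be verified on values.
    ev-injective : ∀ {f g} → (∀ x → ev f x ≡ ev g x) → f ≡ g
    ev-injective {f} {g} eq = 𝓛-lookup-ext λ i → x-y≡0⇒x≡y _ _
        (linearized-zero n ℕ.≤-refl (λ i → lookup f i +ᴷ (-ᴷ lookup g i)) vanish i)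
      where
      vanish : ∀ x → sum {n} (λ i → (lookup f i +ᴷ (-ᴷ lookup g i)) *ᴷ x ^[ toℕ i ]) ≡ 0#
      vanish x = +-cancelʳ (ev g x) _ _ (trans (sym (∑-distrib-+ {n} _ _))
          (trans (sum-cong-≗ {n} λ i → trans (sym (distribʳ _ _ _))
        (cong (_*ᴷ x ^[ toℕ i ]) (trans (+-assoc _ _ _) (trans (cong (lookup f i +ᴷ_) (-‿inverseˡ _)) (+-identityʳ _)))))
        (trans (eq x) (sym (+-identityˡ _)))))

-- Equivalence with Gabidulin codes

module GabidulinCodes {q n : ℕ} .{{_ : NonZero n}} (q-primePower : IsPrimePower q) (K : FiniteField (q ^ n)) where
  open LinearizedPolynomials q n K
  open FieldProperties K hiding (_^ᴷ_; productᴷ)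
  open FrobeniusProperties q-primePower K
  open LinearizedAlgebra q-primePower K
  open Congruence n
  open RingMorphisms rawRing rawRing using (IsRingIsomorphism; module IsRingIsomorphism)
  open IsSubspace

  ev-∘∘ : ∀ f g h x → ev (f ∘ᴸ g ∘ᴸ h) x ≡ ev f (ev g (ev h x))
  ev-∘∘ f g h x = trans (ev-∘ f (g ∘ᴸ h) x) (cong (ev f) (ev-∘ g h x))

  ∘-assoc : ∀ f g h → (f ∘ᴸ g) ∘ᴸ h ≡ f ∘ᴸ g ∘ᴸ h
  ∘-assoc f g h = ev-injective λ x → trans (ev-∘ (f ∘ᴸ g) h x) (trans (ev-∘ f g _) (sym (ev-∘∘ f g h x)))

  ∘-identityˡ : ∀ f → x^[ 0 ] ∘ᴸ f ≡ f
  ∘-identityˡ f = ev-injective λ x → trans (ev-∘ _ f x) (ev-id _)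

  ∘-identityʳ : ∀ f → f ∘ᴸ x^[ 0 ] ≡ f
  ∘-identityʳ f = ev-injective λ x → trans (ev-∘ f _ x) (cong (ev f) (ev-id x))

  ev-inverse : ∀ {f g} → f ∘ᴸ g ≡ x^[ 0 ] → ∀ x → ev f (ev g x) ≡ x
  ev-inverse {f} {g} p x = trans (sym (ev-∘ f g x)) (trans (cong (λ h → ev h x) p) (ev-id x))

  id-invertible : Invertible x^[ 0 ]
  id-invertible = x^[ 0 ] , ∘-identityˡ x^[ 0 ] , ∘-identityˡ x^[ 0 ]

  ∘-invertible : ∀ {f g} → Invertible f → Invertible g → Invertible (f ∘ᴸ g)
  ∘-invertible {f} {g} (f′ , ff′ , f′f) (g′ , gg′ , g′g) = g′ ∘ᴸ f′ , cancel f g f′ g′ gg′ ff′ , cancel g′ f′ g f f′f g′g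
    where
    cancel : ∀ a b a′ b′ → b ∘ᴸ b′ ≡ x^[ 0 ] → a ∘ᴸ a′ ≡ x^[ 0 ] → (a ∘ᴸ b) ∘ᴸ b′ ∘ᴸ a′ ≡ x^[ 0 ]
    cancel a b a′ b′ p p′ = trans (∘-assoc a b (b′ ∘ᴸ a′)) (trans
        (cong (a ∘ᴸ_) (trans (sym (∘-assoc b b′ a′)) (trans (cong (_∘ᴸ a′) p) (∘-identityˡ a′)))) p′)

  x^[]-invertible : ∀ i → Invertible x^[ i ]
  x^[]-invertible i = x^[ neg i ] , ev-injective (λ x → trans (ev-∘ _ _ x) (trans (ev-x^[] i _)
      (trans (cong (_^[ i ]) (ev-x^[] (neg i) x)) (trans (^[]-undo′ x i) (sym (ev-id x)))))) ,
    ev-injective (λ x → trans (ev-∘ _ _ x) (trans (ev-x^[] (neg i) _)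
      (trans (cong (_^[ neg i ]) (ev-x^[] i x)) (trans (^[]-undo x i) (sym (ev-id x))))))

  -- Composing with a monomial on the right only moves and rescales coefficients. The move by t
  -- serves the idealizer, the factor a^{[k]} the normalizer.
  coef-∘-monomial : ∀ f a t k → coef (f ∘ᴸ (a ·x^[ t ])) (k + t) ≡ coef f k *ᴷ a ^[ k ]
  coef-∘-monomial f a t k = trans (coef-sumᴸ {n} _ (k + t)) (trans (sum-single {n} _ (k mod n) others)
      (trans (term (k mod n)) (cong₂ _*ᴷ_ (coef-mod f k) (trans (coef-monomial-≋ _ k+t≋) (^[]-cong a (mod-≋ k))))))
    where
    k+t≋ : k + t ≋ t + toℕ (k mod n)
    k+t≋ = trans (cong (_% n) (ℕ.+-comm k t)) (≋-+ {t} refl (sym (mod-≋ k)))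
    term : ∀ i → coef (lookup f i • shift (toℕ i) (a ·x^[ t ])) (k + t) ≡ lookup f i *ᴷ coef
        ((a ^[ toℕ i ]) ·x^[ t + toℕ i ]) (k + t)
    term i = trans (coef-• _ _ (k + t)) (cong (λ g → lookup f i *ᴷ coef g (k + t)) (shift-monomial (toℕ i) a t))
    others : ∀ i → i ≢ k mod n → coef (lookup f i • shift (toℕ i) (a ·x^[ t ])) (k + t) ≡ 0#
    others i i≢k = trans (term i) (trans (cong (lookup f i *ᴷ_) (coef-monomial-≋̸ _ λ p →
      i≢k (trans (sym (toℕ-mod i)) (mod-cong (sym (≋-cancelʳ t (trans p (cong (_% n) (ℕ.+-comm t (toℕ i)))))))))) (zeroʳ _))

  ⟨⟩-vanish : ∀ {d} (b : Vector 𝓛 d) k → (∀ i → coef (b i) k ≡ 0#) → ∀ {f} → f ∈ ⟨ b ⟩ → coef f k ≡ 0#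
  ⟨⟩-vanish b k b≡0 (c , _ , refl) = trans (coef-lincomb c b k)
      (sum-zero _ λ i → trans (cong (c i *ᴷ_) (b≡0 i)) (zeroʳ (c i)))

  monomials-dual : ∀ {d} (P : Fin d → ℕ) → (∀ {i k} → P i ≋ P k → i ≡ k) → ∀ c k → coef (lincomb c (λ i → x^[ P i ]))
      (P k) ≡ c k
  monomials-dual P inj = dual⇒independent _ P (λ i → coef-monomial-≋ 1# refl) λ i≢k → coef-monomial-≋̸ 1# λ p → i≢k
      (inj (sym p))

  -- Field automorphisms acting on coefficients

  module _ {σ : 𝔽 → 𝔽} (σ-iso : IsRingIsomorphism σ) where
    open IsRingIsomorphism σ-iso using (+-homo; *-homo; 1#-homo; 0#-homo) renaming
        (injective to σ-injective; surjective to σ-surjective)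

    σ-preimage : ∀ y → ∃[ x ] σ x ≡ y
    σ-preimage y = proj₁ (σ-surjective y) , proj₂ (σ-surjective y) refl

    σ-^ : ∀ x k → σ (x ^ᴷ k) ≡ σ x ^ᴷ k
    σ-^ x zero = 1#-homo
    σ-^ x (suc k) = trans (*-homo x _) (cong (σ x *ᴷ_) (σ-^ x k))

    σ-sum : ∀ {d} (g : Vector 𝔽 d) → σ (sum g) ≡ sum (σ ∘ g)
    σ-sum {zero} g = 0#-homo
    σ-sum {suc d} g = trans (+-homo _ _) (cong (σ (g zero) +ᴷ_) (σ-sum (g ∘ suc)))

    opaque
     unfolding ev
     -- As a map, f^σ is σ ∘ f ∘ σ⁻¹, because σ commutes with Frobenius powers. The compatibility of
     -- σ with composition, shifts and scalars is read off from this.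
     ev-map : ∀ f x → ev (Vec.map σ f) (σ x) ≡ σ (ev f x)
     ev-map f x = trans (sum-cong-≗ {n} λ i → trans (cong₂ _*ᴷ_ (lookup-map i σ f) (sym (σ-^ x (q ^ toℕ i))))
         (sym (*-homo _ _))) (sym (σ-sum {n} _))

    map-ext : ∀ {f g} → (∀ x → ev f (σ x) ≡ ev g (σ x)) → f ≡ g
    map-ext {f} {g} p = ev-injective λ y → subst (λ z → ev f z ≡ ev g z) (proj₂ (σ-preimage y)) (p (proj₁ (σ-preimage y)))

    map-injective : ∀ {f g} → Vec.map σ f ≡ Vec.map σ g → f ≡ g
    map-injective {f} {g} p = ev-injective λ x → σ-injective (trans (sym (ev-map f x))
        (trans (cong (λ h → ev h (σ x)) p) (ev-map g x)))

    map-∘ᴸ : ∀ f g → Vec.map σ (f ∘ᴸ g) ≡ Vec.map σ f ∘ᴸ Vec.map σ g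
    map-∘ᴸ f g = map-ext λ x → trans (ev-map _ x) (trans (cong σ (ev-∘ f g x)) (sym (trans (ev-∘ _ _ (σ x))
      (trans (cong (ev (Vec.map σ f)) (ev-map g x)) (ev-map f _)))))

    map-id-x : Vec.map σ x^[ 0 ] ≡ x^[ 0 ]
    map-id-x = map-ext λ x → trans (ev-map _ x) (trans (cong σ (ev-id x)) (sym (ev-id _)))

    map-• : ∀ a f → Vec.map σ (a • f) ≡ σ a • Vec.map σ f
    map-• a f = map-ext λ x → trans (ev-map _ x) (trans (cong σ (ev-• a f x)) (trans (*-homo _ _)
      (sym (trans (ev-• _ _ _) (cong (σ a *ᴷ_) (ev-map f x))))))

    map-shift : ∀ j f → Vec.map σ (shift j f) ≡ shift j (Vec.map σ f)
    map-shift j f = map-ext λ x → trans (ev-map _ x) (trans (cong σ (ev-shift j f x)) (trans (σ-^ _ (q ^ j))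
      (sym (trans (ev-shift j _ _) (cong (_^[ j ]) (ev-map f x))))))

    map-invertible : ∀ {f} → Invertible f → Invertible (Vec.map σ f)
    map-invertible {f} (g , fg , gf) = Vec.map σ g , trans (sym (map-∘ᴸ f g)) (trans (cong (Vec.map σ) fg) map-id-x) ,
      trans (sym (map-∘ᴸ g f)) (trans (cong (Vec.map σ) gf) map-id-x)

  Equivalent-refl : ∀ {C} → Equivalent C C
  Equivalent-refl {C} = x^[ 0 ] , x^[ 0 ] , id , id-invertible , id-invertible ,
      Algebra.Morphism.Construct.Identity.isRingIsomorphism rawRing refl ,
      (λ { (f , f∈ , refl) → subst C (sym (same f)) f∈ }) , (λ {f} f∈ → f , f∈ , sym (same f))
    where
    same : ∀ f → x^[ 0 ] ∘ᴸ Vec.map id f ∘ᴸ x^[ 0 ] ≡ f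
    same f = trans (∘-identityˡ (Vec.map id f ∘ᴸ x^[ 0 ])) (trans (∘-identityʳ (Vec.map id f)) (map-id f))

  -- Transitivity merges G ~ D and D ~ 𝒢 l s into a single equivalence. The second automorphism also
  -- acts on the maps of the first one, hence the factors `Vec.map σ₂ h₁` and `Vec.map σ₂ g₁`.
  Equivalent-trans : ∀ {C C′ C″} → Equivalent C C′ → Equivalent C′ C″ → Equivalent C C″
  Equivalent-trans {C} {C′} {C″} (h₁ , g₁ , σ₁ , h₁-inv , g₁-inv , σ₁-iso , to₁ , from₁)
      (h₂ , g₂ , σ₂ , h₂-inv , g₂-inv , σ₂-iso , to₂ , from₂) =
      h₂ ∘ᴸ Vec.map σ₂ h₁ , Vec.map σ₂ g₁ ∘ᴸ g₂ , σ₂ ∘ σ₁ ,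
      ∘-invertible {h₂} {Vec.map σ₂ h₁} h₂-inv (map-invertible σ₂-iso {h₁} h₁-inv) , ∘-invertible {Vec.map σ₂ g₁}
          {g₂} (map-invertible σ₂-iso {g₁} g₁-inv) g₂-inv ,
      Algebra.Morphism.Construct.Composition.isRingIsomorphism trans σ₁-iso σ₂-iso ,
      (λ { (f , f∈ , refl) → subst C″ (sym (composite f)) (to₂ (_ , to₁ (f , f∈ , refl) , refl)) }) , backward
    where
    composite : ∀ f → (h₂ ∘ᴸ Vec.map σ₂ h₁) ∘ᴸ Vec.map (σ₂ ∘ σ₁) f ∘ᴸ (Vec.map σ₂ g₁ ∘ᴸ g₂) ≡ h₂ ∘ᴸ Vec.map σ₂
        (h₁ ∘ᴸ Vec.map σ₁ f ∘ᴸ g₁) ∘ᴸ g₂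
    composite f = sym (begin
      h₂ ∘ᴸ Vec.map σ₂ (h₁ ∘ᴸ Vec.map σ₁ f ∘ᴸ g₁) ∘ᴸ g₂  ≡⟨ cong (λ z → h₂ ∘ᴸ z ∘ᴸ g₂)
          (trans (map-∘ᴸ σ₂-iso h₁ (Vec.map σ₁ f ∘ᴸ g₁)) (cong (Vec.map σ₂ h₁ ∘ᴸ_)
                                                               (trans (map-∘ᴸ σ₂-iso (Vec.map σ₁ f) g₁)
                                                                   (cong (_∘ᴸ Vec.map σ₂ g₁) (sym (map-∘ σ₂ σ₁ f)))))) ⟩
      h₂ ∘ᴸ (Vec.map σ₂ h₁ ∘ᴸ F ∘ᴸ Vec.map σ₂ g₁) ∘ᴸ g₂  ≡⟨ cong (h₂ ∘ᴸ_)
          (trans (∘-assoc (Vec.map σ₂ h₁) (F ∘ᴸ Vec.map σ₂ g₁) g₂)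
          (cong (Vec.map σ₂ h₁ ∘ᴸ_) (∘-assoc F (Vec.map σ₂ g₁) g₂))) ⟩
      h₂ ∘ᴸ Vec.map σ₂ h₁ ∘ᴸ F ∘ᴸ Vec.map σ₂ g₁ ∘ᴸ g₂  ≡⟨ ∘-assoc h₂ (Vec.map σ₂ h₁) (F ∘ᴸ (Vec.map σ₂ g₁ ∘ᴸ g₂)) ⟨
      (h₂ ∘ᴸ Vec.map σ₂ h₁) ∘ᴸ F ∘ᴸ (Vec.map σ₂ g₁ ∘ᴸ g₂)    ∎)
      where
      open ≡-Reasoning
      F : 𝓛
      F = Vec.map (σ₂ ∘ σ₁) f
    backward : ∀ {p} → p ∈ C″ → ∃[ f ] f ∈ C × p ≡ (h₂ ∘ᴸ Vec.map σ₂ h₁) ∘ᴸ Vec.map (σ₂ ∘ σ₁) f ∘ᴸ (Vec.map σ₂ g₁ ∘ᴸ g₂)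
    backward p∈ with from₂ p∈
    ... | f′ , f′∈ , refl with from₁ f′∈
    ... | f , f∈ , refl = f , f∈ , sym (composite f)

  𝒢-vanish : ∀ {l} s {f i} → gcd s n ≡ 1 → l ≤ i → i < n → f ∈ 𝒢 l s → coef f (s * i) ≡ 0#
  𝒢-vanish {l} s {f} {i} g l≤i i<n = ⟨⟩-vanish _ (s * i) λ j → coef-monomial-≋̸ 1# λ p →
    ℕ.<⇒≢ (ℕ.<-≤-trans (toℕ<n j) l≤i) (≋-small (ℕ.<-trans (ℕ.<-≤-trans (toℕ<n j) l≤i) i<n) i<n (sym (Unit.≋-cancel-* s g p)))

  coef-units-ext : ∀ s → gcd s n ≡ 1 → ∀ {f g} → (∀ i → i < n → coef f (s * i) ≡ coef g (s * i)) → f ≡ g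
  coef-units-ext s g p = 𝓛-ext λ k → let i , i<n , s*i≋k = Unit.index s g k in
    trans (coef-cong _ (sym s*i≋k)) (trans (p i i<n) (coef-cong _ s*i≋k))

  𝒢-determined : ∀ l s → gcd s n ≡ 1 → DeterminedBy (𝒢 l s) (λ (i : Fin l) → s * toℕ i)
  𝒢-determined l s g f f∈ f≡0 = coef-units-ext s g λ i i<n → trans (by-cases i i<n) (sym (coef-0 _))
    where
    by-cases : ∀ i → i < n → coef f (s * i) ≡ 0#
    by-cases i i<n with i ℕ.<? l
    ... | yes i<l = trans (cong (λ z → coef f (s * z)) (sym (toℕ-fromℕ< i<l))) (f≡0 (fromℕ< i<l))
    ... | no i≮l = 𝒢-vanish s g (ℕ.≮⇒≥ i≮l) i<n f∈

  Surjective : 𝓛 → Set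
  Surjective u = ∀ y → ∃[ x ] ev u x ≡ y

  -- The left idealizer of 𝒢 l s consists of the scalars.
  idealizer : ∀ {l} s {A} → gcd s n ≡ 1 → 1 ≤ l → l < n → (∀ j → j < l → A ∘ᴸ x^[ s * j ] ∈ 𝒢 l s) → ∀ x → ev A x ≡
      coef A 0 *ᴷ x
  idealizer {l} s {A} g 1≤l l<n A∈ x = trans (cong (λ f → ev f x) A≡) (trans (ev-• _ _ x) (cong (coef A 0 *ᴷ_) (ev-id x)))
    where
    coef-A : ∀ i j → coef (A ∘ᴸ x^[ s * j ]) (s * (i + j)) ≡ coef A (s * i)
    coef-A i j = trans (cong (coef (A ∘ᴸ x^[ s * j ])) (ℕ.*-distribˡ-+ s i j)) (trans (coef-∘-monomial A 1# (s * j) (s * i))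
      (trans (cong (coef A (s * i) *ᴷ_) (^[]-1 (s * i))) (*-identityʳ _)))
    off : ∀ i → 1 ≤ i → i < n → coef A (s * i) ≡ 0#
    off i 1≤i i<n with l ℕ.≤? i
    ... | yes l≤i = trans (sym (coef-A i 0)) (trans (cong (λ z → coef (A ∘ᴸ x^[ s * 0 ]) (s * z)) (ℕ.+-identityʳ i))
        (𝒢-vanish s g l≤i i<n (A∈ 0 1≤l)))
    -- For 1 ≤ i < l the coefficient of A at s i reappears in A ∘ x^{[s(l - i)]} at s l, the first
    -- position outside 𝒢 l s; here l - i < l because i ≥ 1.
    ... | no l≰i = trans (sym (coef-A i (l ∸ i))) (trans (cong (λ z → coef (A ∘ᴸ x^[ s * (l ∸ i) ]) (s * z))
        (ℕ.m+[n∸m]≡n (ℕ.≰⇒≥ l≰i)))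
        (𝒢-vanish s g ℕ.≤-refl l<n (A∈ (l ∸ i) (ℕ.∸-monoʳ-< {l} {i} {0} 1≤i (ℕ.≰⇒≥ l≰i)))))
    A≡ : A ≡ coef A 0 • x^[ 0 ]
    A≡ = coef-units-ext s g compare
      where
      compare : ∀ i → i < n → coef A (s * i) ≡ coef (coef A 0 • x^[ 0 ]) (s * i)
      compare zero _ = trans (cong (coef A) (ℕ.*-zeroʳ s)) (sym
          (trans (coef-• _ _ _) (trans (cong (coef A 0 *ᴷ_) (coef-monomial-≋ 1# (cong (_% n) (ℕ.*-zeroʳ s))))
          (*-identityʳ _))))
      compare (suc i) i<n = trans (off (suc i) z<s i<n) (sym (trans (coef-• _ _ _)
          (trans (cong (coef A 0 *ᴷ_) (coef-monomial-≋̸ 1# λ p →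
        ℕ.1+n≢0 (≋-small i<n (ℕ.≤-<-trans z≤n i<n) (Unit.≋-cancel-* s g
            (trans p (cong (_% n) (sym (ℕ.*-zeroʳ s)))))))) (zeroʳ _))))

  -- A bijective h normalizing the scalars is a monomial, by comparison of
  -- coefficients in h ∘ α = β ∘ h.
  normalizer : ∀ {h} → h ≢ 0ᴸ → (∀ α → ∃[ β ] (∀ x → ev h (α *ᴷ x) ≡ β *ᴷ ev h x)) → ∃[ a ] ∃[ k ] a ≢ 0# ×
      (∀ x → ev h x ≡ a *ᴷ x ^[ k ])
  normalizer {h} h≢0 normal = coef h k₀ , k₀ , h₀≢0 , λ x → trans (cong (λ f → ev f x) h≡) (ev-monomial _ k₀ x)
    where
    nonzero : ∃[ i ] coef h (toℕ i) ≢ 0#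
    nonzero = ¬∀⟶∃¬ n _ (λ i → coef h (toℕ i) ≟ 0#) λ all0 → h≢0 (𝓛-ext λ k →
      trans (coef-cong h (sym (mod-≋ k))) (trans (all0 (k mod n)) (sym (coef-0 k))))
    k₀ : ℕ
    k₀ = toℕ (proj₁ nonzero)
    h₀≢0 : coef h k₀ ≢ 0#
    h₀≢0 = proj₂ nonzero
    compare : ∀ α k → coef h k ≢ 0# → α ^[ k ] ≡ proj₁ (normal α)
    compare α k hk≢0 = *-cancelˡ (coef h k) hk≢0 (begin
      coef h k *ᴷ α ^[ k ]  ≡⟨ coef-∘-monomial h α 0 k ⟨
      coef (h ∘ᴸ (α ·x^[ 0 ])) (k + 0)  ≡⟨ cong (λ f → coef f (k + 0)) same ⟩
      coef (β • h) (k + 0)  ≡⟨ trans (coef-• β h (k + 0)) (cong (λ i → β *ᴷ coef h i) (ℕ.+-identityʳ k)) ⟩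
      β *ᴷ coef h k  ≡⟨ *-comm β _ ⟩
      coef h k *ᴷ β                      ∎)
      where
      open ≡-Reasoning
      β : 𝔽
      β = proj₁ (normal α)
      same : h ∘ᴸ (α ·x^[ 0 ]) ≡ β • h
      same = ev-injective λ x → trans (ev-∘ h _ x) (trans (cong (ev h) (trans (ev-monomial α 0 x) (cong (α *ᴷ_) (^[0] x))))
        (trans (proj₂ (normal α) x) (sym (ev-• β h x))))
    -- Nonzero coefficients at k and k₀ give α^{[k]} = β = α^{[k₀]} for every α, so the two
    -- monomials agree as maps and hence as polynomials.
    unique : ∀ k → coef h k ≢ 0# → k ≋ k₀
    unique k hk≢0 = decidable-stable (k % n ℕ.≟ k₀ % n) λ k≋̸k₀ → 1≢0 (trans (sym (coef-monomial-≋ {k} {k} 1# refl))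
      (trans (cong (λ f → coef f k) x^k≡x^k₀) (coef-monomial-≋̸ 1# k≋̸k₀)))
      where
      x^k≡x^k₀ : x^[ k ] ≡ x^[ k₀ ]
      x^k≡x^k₀ = ev-injective λ x → trans (ev-x^[] k x) (trans (compare x k hk≢0)
          (trans (sym (compare x k₀ h₀≢0)) (sym (ev-x^[] k₀ x))))
    h≡ : h ≡ coef h k₀ ·x^[ k₀ ]
    h≡ = 𝓛-ext coefs
      where
      coefs : ∀ k → coef h k ≡ coef (coef h k₀ ·x^[ k₀ ]) k
      coefs k with k % n ℕ.≟ k₀ % n
      ... | yes p = trans (coef-cong h p) (sym (coef-monomial-≋ _ p))
      ... | no ¬p = trans (decidable-stable (coef h k ≟ 0#) λ hk≢0 → ¬p (unique k hk≢0)) (sym (coef-monomial-≋̸ _ ¬p))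

  -- Extracting a generator from an equivalence

  module Generator {G l s} (G-sub : IsSubspace G) (equiv : Equivalent G (𝒢 l s)) where
    private
      h = proj₁ equiv
      g = proj₁ (proj₂ equiv)
      σ = proj₁ (proj₂ (proj₂ equiv))
      h-inv = proj₁ (proj₂ (proj₂ (proj₂ equiv)))
      g-inv = proj₁ (proj₂ (proj₂ (proj₂ (proj₂ equiv))))
      σ-iso = proj₁ (proj₂ (proj₂ (proj₂ (proj₂ (proj₂ equiv)))))
      image = proj₂ (proj₂ (proj₂ (proj₂ (proj₂ (proj₂ equiv)))))
      h′ = proj₁ h-inv
      g′ = proj₁ g-inv
      hh′ = ev-inverse {h} {h′} (proj₁ (proj₂ h-inv))
      h′h = ev-inverse {h′} {h} (proj₂ (proj₂ h-inv))
      gg′ = ev-inverse {g} {g′} (proj₁ (proj₂ g-inv))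
      g′g = ev-inverse {g′} {g} (proj₂ (proj₂ g-inv))

      φ : 𝓛 → 𝓛
      φ f = h ∘ᴸ Vec.map σ f ∘ᴸ g

      φ-injective : ∀ {f f′} → φ f ≡ φ f′ → f ≡ f′
      φ-injective {f} {f′} p = map-injective σ-iso (ev-injective λ y →
        trans (sym (strip f y)) (trans (cong (λ F → ev h′ (ev F (ev g′ y))) p) (strip f′ y)))
        where
        strip : ∀ f y → ev h′ (ev (φ f) (ev g′ y)) ≡ ev (Vec.map σ f) y
        strip f y = trans (cong (ev h′) (ev-∘∘ h _ g _)) (trans (h′h _) (cong (ev (Vec.map σ f)) (gg′ y)))

      preimage : ∀ {p} → p ∈ 𝒢 l s → ∃[ f ] f ∈ G × p ≡ φ f
      preimage = proj₂ image

      monomial∈ : ∀ j → j < l → x^[ s * j ] ∈ 𝒢 l s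
      monomial∈ j j<l = subst (λ i → x^[ s * i ] ∈ 𝒢 l s) (toℕ-fromℕ< j<l) (∈⟨⟩ (λ i → x^[ s * toℕ i ]) (fromℕ< j<l))

    module _ (s-coprime : gcd s n ≡ 1) where
      private
        small-injective : l ≤ n → ∀ {i k : Fin l} → s * toℕ i ≋ s * toℕ k → i ≡ k
        small-injective l≤n {i} {k} p = toℕ-injective (≋-small (ℕ.<-≤-trans (toℕ<n i) l≤n)
            (ℕ.<-≤-trans (toℕ<n k) l≤n) (Unit.≋-cancel-* s s-coprime p))

        ⊖-vanish : ∀ f g k → coef f k ≡ coef g k → coef (f ⊖ g) k ≡ 0#
        ⊖-vanish f g k p = trans (coef-⊖ f g k) (trans (cong (_+ᴷ (-ᴷ coef g k)) p) (-‿inverseʳ _))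

      -- φ is not known to respect scalars here, since h is only 𝔽_q-linear. Counting avoids the
      -- question: the l coefficients of φ f determine φ f, and φ is injective.
      dimension≤l : ∀ {d} → HasDim G d → d ≤ l
      dimension≤l (b , b-indep , G≐) = vectors-injective⇒≤ 2≤q^n (λ c i → coef (φ (lincomb c b)) (s * toℕ i)) λ c c′ eq i →
          x-y≡0⇒x≡y _ _ (b-indep (λ j → c j +ᴷ (-ᴷ c′ j)) _ (difference c c′
              (φ-injective (f⊖g≡0⇒f≡g (𝒢-determined l s s-coprime _ (⊖∈ (⟨⟩-subspace _) (φ∈ c) (φ∈ c′))
            λ j → ⊖-vanish _ _ _ (eq j))))) i)
        where
        φ∈ : ∀ c → φ (lincomb c b) ∈ 𝒢 l s
        φ∈ c = proj₁ image (_ , lincomb∈ G-sub c b (λ i → proj₂ G≐ (∈⟨⟩ b i)) , refl)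
        difference : ∀ c c′ → lincomb c b ≡ lincomb c′ b → lincomb (λ j → c j +ᴷ (-ᴷ c′ j)) b ≡ 0ᴸ
        difference c c′ eq = 𝓛-ext λ k → trans (coef-difference c c′ b k (cong (λ f → coef f k) eq)) (sym (coef-0 k))

      -- Distinct elements of 𝒢 l s have distinct preimages in G. Applied to a subspace of C, this
      -- keeps l below n, as the computation of the idealizer requires.
      l≤ : ∀ {e} (p : Fin e → ℕ) → l ≤ n → DeterminedBy G p → l ≤ e
      l≤ p l≤n det = vectors-injective⇒≤ 2≤q^n (λ c i → coef (ψ c) (p i)) λ c c′ eq k → begin
          c k  ≡⟨ monomials-dual _ (small-injective l≤n) c k ⟨
          coef (combination c) (s * toℕ k)  ≡⟨ cong (λ f → coef f (s * toℕ k)) (trans (φψ c) (trans (cong φ (f⊖g≡0⇒f≡g (det _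
                                                    (⊖∈ G-sub (ψ∈ c) (ψ∈ c′)) λ i → ⊖-vanish _ _ _ (eq i))))
                                                        (sym (φψ c′)))) ⟩
          coef (combination c′) (s * toℕ k)  ≡⟨ monomials-dual _ (small-injective l≤n) c′ k ⟩
          c′ k                                 ∎
        where
        open ≡-Reasoning
        combination : Vector 𝔽 l → 𝓛
        combination c = lincomb c (λ i → x^[ s * toℕ i ])
        lifted : ∀ c → ∃[ f ] f ∈ G × combination c ≡ φ f
        lifted c = preimage (c , _ , refl)
        ψ : Vector 𝔽 l → 𝓛
        ψ c = proj₁ (lifted c)
        ψ∈ : ∀ c → ψ c ∈ G
        ψ∈ c = proj₁ (proj₂ (lifted c))
        φψ : ∀ c → combination c ≡ φ (ψ c)
        φψ c = proj₂ (proj₂ (lifted c))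

      generator : 1 ≤ l → l < n → ∃[ u ] Surjective u × (∀ j → j < l → shift (s * j) u ∈ G)
      generator 1≤l l<n = u , surjective , shift∈
        where
        f : ∀ j → j < l → 𝓛
        f j j<l = proj₁ (preimage (monomial∈ j j<l))
        f∈ : ∀ j j<l → f j j<l ∈ G
        f∈ j j<l = proj₁ (proj₂ (preimage (monomial∈ j j<l)))
        F : ∀ j → j < l → 𝓛
        F j j<l = Vec.map σ (f j j<l)
        hFg : ∀ j j<l y → ev h (ev (F j j<l) (ev g y)) ≡ y ^[ s * j ]
        hFg j j<l y = trans (sym (ev-∘∘ h _ g y)) (trans (cong (λ z → ev z y)
            (sym (proj₂ (proj₂ (preimage (monomial∈ j j<l)))))) (ev-x^[] (s * j) y))
        u : 𝓛
        u = f 0 1≤l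
        y^[s*0] : ∀ y → y ^[ s * 0 ] ≡ y
        y^[s*0] y = trans (cong (y ^[_]) (ℕ.*-zeroʳ s)) (^[0] y)

        surjective : Surjective u
        surjective y = x , IsRingIsomorphism.injective σ-iso (trans (sym (ev-map σ-iso u x))
            (trans (cong (ev (F 0 1≤l)) σx≡) (trans (sym (h′h _))
            (trans (cong (ev h′) (trans (hFg 0 1≤l _) (y^[s*0] _))) (h′h (σ y))))))
          where
          x : 𝔽
          x = proj₁ (σ-preimage σ-iso (ev g (ev h (σ y))))
          σx≡ : σ x ≡ ev g (ev h (σ y))
          σx≡ = proj₂ (σ-preimage σ-iso (ev g (ev h (σ y))))

        -- h ∘ α ∘ h′ sends each monomial x^{[s j]} of 𝒢 l s, the image of f_j, to the image of a
        -- f_j, where σ a = α. So it lies in the left idealizer and is a scalar β, which means h α =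
        -- β h.
        normal : ∀ α → ∃[ β ] (∀ x → ev h (α *ᴷ x) ≡ β *ᴷ ev h x)
        normal α = coef A 0 , λ x → trans (cong (λ z → ev h (α *ᴷ z)) (sym (h′h x)))
            (trans (sym (ev-A (ev h x))) (idealizer s {A} s-coprime 1≤l l<n A∈ (ev h x)))
          where
          A : 𝓛
          A = h ∘ᴸ (α ·x^[ 0 ]) ∘ᴸ h′
          ev-A : ∀ x → ev A x ≡ ev h (α *ᴷ ev h′ x)
          ev-A x = trans (ev-∘∘ h _ h′ x) (cong (ev h) (trans (ev-monomial α 0 _) (cong (α *ᴷ_) (^[0] _))))
          a : 𝔽
          a = proj₁ (σ-preimage σ-iso α)
          A∈ : ∀ j → j < l → A ∘ᴸ x^[ s * j ] ∈ 𝒢 l s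
          A∈ j j<l = subst (𝒢 l s) (ev-injective λ x → trans (ev-∘∘ h _ g x)
              (sym (trans (ev-∘ A _ x) (trans (ev-A _) (cong (ev h)
              (trans (cong₂ _*ᴷ_ (sym (proj₂ (σ-preimage σ-iso α)))
                  (trans (cong (ev h′) (trans (ev-x^[] (s * j) x) (sym (hFg j j<l x)))) (h′h _)))
                (sym (trans (cong (λ z → ev z (ev g x)) (map-• σ-iso a (f j j<l))) (ev-• (σ a) _ _)))))))))
            (proj₁ image (a • f j j<l , •∈ G-sub a (f∈ j j<l) , refl))

        h≢0 : h ≢ 0ᴸ
        h≢0 h≡0 = 1≢0 (trans (sym (hh′ 1#)) (trans (cong (λ z → ev z (ev h′ 1#)) h≡0) (ev-0ᴸ _)))

        monomial-h : ∃[ a ] ∃[ k ] a ≢ 0# × (∀ x → ev h x ≡ a *ᴷ x ^[ k ])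
        monomial-h = normalizer h≢0 normal

        -- The relation a F_i^{[k]} = (g′)^{[s i]} for i = 0 and i = j gives (F₀^{[t]})^{[k]} = w a
        -- F_j^{[k]}, with w the reciprocal of a^{[t]}. Taking q^k-th roots produces the scalar
        -- `σκ`.
        shift∈ : ∀ j → j < l → shift (s * j) u ∈ G
        shift∈ j j<l = subst G (sym (map-injective σ-iso {shift t u} {κ • f j j<l} (begin
            Vec.map σ (shift t u)  ≡⟨ map-shift σ-iso t u ⟩
            shift t (Vec.map σ u)  ≡⟨ ev-injective same ⟩
            σκ • F j j<l  ≡⟨ cong (_• F j j<l) σκ≡ ⟨
            σ κ • F j j<l  ≡⟨ map-• σ-iso κ (f j j<l) ⟨
            Vec.map σ (κ • f j j<l)        ∎))) (•∈ G-sub κ (f∈ j j<l))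
          where
          open ≡-Reasoning
          a : 𝔽
          a = proj₁ monomial-h
          k : ℕ
          k = proj₁ (proj₂ monomial-h)
          a≢0 : a ≢ 0#
          a≢0 = proj₁ (proj₂ (proj₂ monomial-h))
          h≡ : ∀ x → ev h x ≡ a *ᴷ x ^[ k ]
          h≡ = proj₂ (proj₂ (proj₂ monomial-h))
          t : ℕ
          t = s * j
          aᵗ≢0 : a ^[ t ] ≢ 0#
          aᵗ≢0 p = a≢0 (^[]≡0⇒≡0 t p)
          w : 𝔽
          w = proj₁ (reciprocal _ aᵗ≢0)
          κ σκ : 𝔽
          σκ = (w *ᴷ a) ^[ neg k ]
          κ = proj₁ (σ-preimage σ-iso σκ)
          σκ≡ : σ κ ≡ σκ
          σκ≡ = proj₂ (σ-preimage σ-iso σκ)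
          relation : ∀ i i<l y → a *ᴷ ev (F i i<l) y ^[ k ] ≡ ev g′ y ^[ s * i ]
          relation i i<l y = trans (sym (h≡ _)) (trans (cong (λ z → ev h (ev (F i i<l) z)) (sym (gg′ y)))
              (hFg i i<l (ev g′ y)))
          relation₀ : ∀ y → ev g′ y ≡ a *ᴷ ev (F 0 1≤l) y ^[ k ]
          relation₀ y = sym (trans (relation 0 1≤l y) (y^[s*0] _))
          same : ∀ y → ev (shift t (Vec.map σ u)) y ≡ ev (σκ • F j j<l) y
          same y = ^[]-injective k (begin
            ev (shift t (Vec.map σ u)) y ^[ k ]  ≡⟨ cong (_^[ k ]) (ev-shift t _ y) ⟩
            (F₀ ^[ t ]) ^[ k ]  ≡⟨ trans (^[]-^[] F₀ t k) (trans (cong (F₀ ^[_]) (ℕ.+-comm t k)) (sym (^[]-^[] F₀ k t))) ⟩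
            (F₀ ^[ k ]) ^[ t ]  ≡⟨ *-identityˡ _ ⟨
            1# *ᴷ (F₀ ^[ k ]) ^[ t ]  ≡⟨ cong (_*ᴷ (F₀ ^[ k ]) ^[ t ]) (proj₂ (reciprocal _ aᵗ≢0)) ⟨
            w *ᴷ a ^[ t ] *ᴷ (F₀ ^[ k ]) ^[ t ]  ≡⟨ trans (*-assoc w _ _) (cong (w *ᴷ_) (sym (^[]-* a _ t))) ⟩
            w *ᴷ (a *ᴷ F₀ ^[ k ]) ^[ t ]  ≡⟨ cong (λ z → w *ᴷ z ^[ t ]) (sym (relation₀ y)) ⟩
            w *ᴷ ev g′ y ^[ t ]  ≡⟨ cong (w *ᴷ_) (relation j j<l y) ⟨
            w *ᴷ (a *ᴷ ev (F j j<l) y ^[ k ])  ≡⟨ *-assoc w a _ ⟨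
            w *ᴷ a *ᴷ ev (F j j<l) y ^[ k ]  ≡⟨ cong (_*ᴷ ev (F j j<l) y ^[ k ]) (^[]-undo′ (w *ᴷ a) k) ⟨
            σκ ^[ k ] *ᴷ ev (F j j<l) y ^[ k ]  ≡⟨ ^[]-* _ _ k ⟨
            (σκ *ᴷ ev (F j j<l) y) ^[ k ]  ≡⟨ cong (_^[ k ]) (ev-• σκ _ y) ⟨
            ev (σκ • F j j<l) y ^[ k ]                      ∎)
            where
            F₀ : 𝔽
            F₀ = ev (F 0 1≤l) y

-- Gabidulin index and h

module IndexCriteria {q n : ℕ} .{{_ : NonZero n}} (q-primePower : IsPrimePower q) (K : FiniteField (q ^ n)) where
  open LinearizedPolynomials q n K
  open FieldProperties K hiding (_^ᴷ_; productᴷ)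
  open FrobeniusProperties q-primePower K
  open LinearizedAlgebra q-primePower K
  open GabidulinCodes q-primePower K
  open Congruence n
  open IsSubspace

  GabidulinDimension : Code → ℕ → Set₁
  GabidulinDimension C d = Σ[ G ∈ Code ] G ⊆ C × HasDim G d × (Σ[ D ∈ Code ] IsGeneralizedGabidulin D × Equivalent G D)

  IntersectionDimension : Code → ℕ → Set
  IntersectionDimension C d = ∃[ j ] 1 ≤ j × j ≤ n ∸ 1 × gcd j n ≡ 1 × HasDim (C ∩ shiftCode j C) d

  -- Both the determining positions and their number may vary with j.
  IntersectionBound : Code → ℕ → Set
  IntersectionBound C m = ∀ j → 1 ≤ j → j ≤ n ∸ 1 → gcd j n ≡ 1 →
    ∃[ e ] e ≤ m × Σ[ p ∈ (Fin e → ℕ) ] DeterminedBy (C ∩ shiftCode j C) p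

  h-value : ∀ {C m} → IntersectionBound C m → IntersectionDimension C m → h[ C ]≡ m
  h-value bound attained = attained , λ { k (j , 1≤j , j<n , g , dim) → let e , e≤m , p , det = bound j 1≤j j<n g in
    ℕ.≤-trans (dimension≤ p dim (λ f∈ → f∈) det) e≤m }

  -- As u is onto, a relation between the u^{[P i]} evaluated at x is the same relation between the
  -- x^{[P i]} evaluated at an arbitrary y = u(x).
  shifts-independent : ∀ {d u} (P : Fin d → ℕ) → (∀ {i k} → P i ≋ P k → i ≡ k) → Surjective u → LinearlyIndependent
      (λ i → shift (P i) u)
  shifts-independent {u = u} P inj onto c _ eq k = trans (sym (monomials-dual P inj c k))
      (trans (cong (λ f → coef f (P k)) vanish) (coef-0 (P k)))
    where
    vanish : lincomb c (λ i → x^[ P i ]) ≡ 0ᴸ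
    vanish = ev-injective λ y → let x , ux≡y = onto y in begin
      ev (lincomb c (λ i → x^[ P i ])) y  ≡⟨ ev-lincomb c _ y ⟩
      sum (λ i → c i *ᴷ ev x^[ P i ] y)  ≡⟨ sum-cong-≗ (λ i → cong (c i *ᴷ_) (trans (ev-x^[] (P i) y)
                                                          (sym (trans (ev-shift (P i) u x) (cong (_^[ P i ]) ux≡y))))) ⟩
      sum (λ i → c i *ᴷ ev (shift (P i) u) x)  ≡⟨ ev-lincomb c _ x ⟨
      ev (lincomb c (λ i → shift (P i) u)) x  ≡⟨ cong (λ f → ev f x) eq ⟩
      ev 0ᴸ x  ≡⟨ trans (ev-0ᴸ x) (sym (ev-0ᴸ y)) ⟩
      ev 0ᴸ y                                        ∎
      where open ≡-Reasoning

  *-small-injective : ∀ {d s} → gcd s n ≡ 1 → d ≤ n → ∀ {i k : Fin d} → s * toℕ i ≋ s * toℕ k → i ≡ k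
  *-small-injective {s = s} g d≤n {i} {k} p = toℕ-injective
    (≋-small (ℕ.<-≤-trans (toℕ<n i) d≤n) (ℕ.<-≤-trans (toℕ<n k) d≤n) (Unit.≋-cancel-* s g p))

  gabidulin-generator : ∀ {C k d} (p : Fin k → ℕ) → DeterminedBy C p → k < n → GabidulinDimension C d →
    ∃[ l ] ∃[ s ] ∃[ u ] d ≤ l × l ≤ k × 1 ≤ l × gcd s n ≡ 1 × Surjective u × (∀ j → j < l → shift (s * j) u ∈ C)
  gabidulin-generator p det k<n (G , G⊆C , G-dim , D , (l , s , 1≤l , l≤n , g , D~𝒢) , G~D) =
      l , s , u , dimension≤l g G-dim , l≤k , 1≤l , g , onto , λ j j<l → G⊆C (shift∈ j j<l)
    where
    open Generator {G} {l} {s} (hasDim⇒subspace G-dim) (Equivalent-trans G~D D~𝒢)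
    l≤k = l≤ g p l≤n (λ f f∈ → det f (G⊆C f∈))
    generated = generator g 1≤l (ℕ.≤-<-trans l≤k k<n)
    u = proj₁ generated
    onto = proj₁ (proj₂ generated)
    shift∈ = proj₂ (proj₂ generated)

  coprime⇒1≤% : ∀ {s} → 2 ≤ n → gcd s n ≡ 1 → 1 ≤ s % n
  coprime⇒1≤% {s} 2≤n g = ℕ.n≢0⇒n>0 λ s%n≡0 → contradiction
    (≋-small (ℕ.<-≤-trans z<s 2≤n) 2≤n (trans (sym (cong (_% n) (ℕ.*-zeroʳ t)))
        (trans (≋-*ˡ t (trans (sym (cong (_% n) s%n≡0)) (%-≋ s))) (proj₂ (inverse s g))))) λ ()
    where
    t : ℕ
    t = proj₁ (inverse s g)

  %≤n∸1 : ∀ s → s % n ≤ n ∸ 1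
  %≤n∸1 s = ℕ.<⇒≤pred (m%n<n s n)

  generated-bound : ∀ {C m} → IsSubspace C → IntersectionBound C m → ∀ l s u → l < n → gcd s n ≡ 1 → Surjective u →
    (∀ j → j < l → shift (s * j) u ∈ C) → l ≤ suc m
  generated-bound C-sub bound zero s u l<n g onto shift∈ = z≤n
  generated-bound {C} {m} C-sub bound (suc l) s u l<n g onto shift∈ = s≤s (ℕ.≤-trans l≤e e≤m)
    where
    2≤n : 2 ≤ n
    2≤n = ℕ.≤-trans (s≤s (s≤s z≤n)) l<n
    -- The bound admits only 1 ≤ j ≤ n - 1, so s is replaced by its residue. The independent family
    -- starts at u^{[s]}, since u itself need not be the shift of a member of C.
    j : ℕ
    j = s % n
    bound-j : ∃[ e ] e ≤ m × Σ[ p ∈ (Fin e → ℕ) ] DeterminedBy (C ∩ shiftCode j C) p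
    bound-j = bound j (coprime⇒1≤% 2≤n g) (%≤n∸1 s) (coprime-≋ (sym (%-≋ s)) g)
    e≤m = proj₁ (proj₂ bound-j)
    l≤e : l ≤ proj₁ bound-j
    l≤e = independent⇒≤ (proj₁ (proj₂ (proj₂ bound-j))) (∩-subspace C-sub (shiftCode-subspace j C-sub))
        (proj₂ (proj₂ (proj₂ bound-j)))
      (λ (i : Fin l) → shift (s * suc (toℕ i)) u) member
      (shifts-independent (λ i → s * suc (toℕ i)) injective onto)
      where
      injective : ∀ {i k : Fin l} → s * suc (toℕ i) ≋ s * suc (toℕ k) → i ≡ k
      injective {i} {k} q = Data.Fin.Properties.suc-injective (*-small-injective {suc l} {s} g (ℕ.<⇒≤ l<n) {suc i} {suc k} q)
      member : ∀ i → shift (s * suc (toℕ i)) u ∈ C ∩ shiftCode j C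
      member i = shift∈ (suc (toℕ i)) (s≤s (toℕ<n i)) , shift (s * toℕ i) u , shift∈ (toℕ i) (ℕ.m<n⇒m<1+n (toℕ<n i)) ,
        trans (shift-cong u (trans (cong (_% n) (trans (ℕ.*-suc s (toℕ i)) (ℕ.+-comm s _)))
            (≋-+ {s * toℕ i} refl (sym (%-≋ s)))))
          (sym (shift-shift (s * toℕ i) j u))

  index-upper : ∀ {C k m d} → IsSubspace C → (p : Fin k → ℕ) → DeterminedBy C p → k < n → IntersectionBound C m →
      GabidulinDimension C d → d ≤ suc m
  index-upper {C} {m = m} C-sub p det k<n bound dim =
    let l , s , u , d≤l , l≤k , 1≤l , g , onto , shift∈ = gabidulin-generator p det k<n dim in
    ℕ.≤-trans d≤l (generated-bound C-sub bound l s u (ℕ.≤-<-trans l≤k k<n) g onto shift∈)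

  -- Composition with the inverse of g on the right turns each g^{[s i]} into x^{[s i]}.
  shifts-equivalent : ∀ {l s g} → Invertible g → Equivalent ⟨ (λ (i : Fin l) → shift (s * toℕ i) g) ⟩ (𝒢 l s)
  shifts-equivalent {l} {s} {g} (g′ , gg′ , g′g) = x^[ 0 ] , g′ , id , id-invertible , (g , g′g , gg′) ,
      Algebra.Morphism.Construct.Identity.isRingIsomorphism rawRing refl ,
      (λ { (_ , (c , _ , refl) , refl) → c , _ , same c }) ,
      (λ { (c , _ , refl) → _ , (c , _ , refl) , sym (same c) })
    where
    b b′ : Vector 𝓛 l
    b i = shift (s * toℕ i) g
    b′ i = x^[ s * toℕ i ]
    same : ∀ c → x^[ 0 ] ∘ᴸ Vec.map id (lincomb c b) ∘ᴸ g′ ≡ lincomb c b′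
    same c = ev-injective λ y → begin
      ev (x^[ 0 ] ∘ᴸ Vec.map id (lincomb c b) ∘ᴸ g′) y  ≡⟨ trans (ev-∘∘ x^[ 0 ] (Vec.map id (lincomb c b)) g′ y) (ev-id _) ⟩
      ev (Vec.map id (lincomb c b)) (ev g′ y)  ≡⟨ cong (λ f → ev f (ev g′ y)) (map-id (lincomb c b)) ⟩
      ev (lincomb c b) (ev g′ y)  ≡⟨ ev-lincomb c b _ ⟩
      sum (λ i → c i *ᴷ ev (b i) (ev g′ y))  ≡⟨ sum-cong-≗ (λ i → cong (c i *ᴷ_) (trans (ev-shift (s * toℕ i) g _)
                                                             (trans (cong (_^[ s * toℕ i ]) (ev-inverse {g} {g′} gg′
                                                                 y)) (sym (ev-x^[] _ y))))) ⟩
      sum (λ i → c i *ᴷ ev (b′ i) y)  ≡⟨ ev-lincomb c b′ y ⟨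
      ev (lincomb c b′) y                               ∎
      where open ≡-Reasoning

  invertible⇒surjective : ∀ {g} → Invertible g → Surjective g
  invertible⇒surjective {g} (g′ , gg′ , _) y = ev g′ y , ev-inverse {g} {g′} gg′ y

  index-lower : ∀ {C} → IsSubspace C → ∀ l s g → Invertible g → gcd s n ≡ 1 → 1 ≤ l → l ≤ n →
    (∀ (i : Fin l) → shift (s * toℕ i) g ∈ C) → GabidulinDimension C l
  index-lower C-sub l s g g-inv s-coprime 1≤l l≤n shift∈ = ⟨ b ⟩ , ⟨⟩⊆ C-sub shift∈ ,
      (b , shifts-independent _ (*-small-injective {l} {s} s-coprime l≤n) (invertible⇒surjective {g} g-inv) ,
          (λ f∈ → f∈) , (λ f∈ → f∈)) ,
      ⟨ b ⟩ , (l , s , 1≤l , l≤n , s-coprime , shifts-equivalent {l} {s} {g} g-inv) , Equivalent-refl {⟨ b ⟩}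
    where
    b : Vector 𝓛 l
    b i = shift (s * toℕ i) g

-- The codes 𝒢 and ℋ

module CodeFamilies {q n : ℕ} .{{_ : NonZero n}} (q-primePower : IsPrimePower q) (K : FiniteField (q ^ n)) where
  open LinearizedPolynomials q n K
  open FieldProperties K hiding (_^ᴷ_; productᴷ)
  open FrobeniusProperties q-primePower K
  open LinearizedAlgebra q-primePower K
  open GabidulinCodes q-primePower K
  open IndexCriteria q-primePower K
  open Congruence n
  open IsSubspace

  proportional-subspace : ∀ x β y → IsSubspace (λ f → coef f x ≡ β *ᴷ coef f y)
  proportional-subspace x β y .0∈ = trans (coef-0 x) (sym (trans (cong (β *ᴷ_) (coef-0 y)) (zeroʳ β)))
  proportional-subspace x β y .⊕∈ p q = trans (coef-⊕ _ _ x) (trans (cong₂ _+ᴷ_ p q)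
      (trans (sym (distribˡ β _ _)) (cong (β *ᴷ_) (sym (coef-⊕ _ _ y)))))
  proportional-subspace x β y .•∈ a {f} p = trans (coef-• a _ x) (trans (cong (a *ᴷ_) p) (trans (sym (*-assoc a β _))
    (trans (cong (_*ᴷ coef f y) (*-comm a β)) (trans (*-assoc β a _) (cong (β *ᴷ_) (sym (coef-• a _ y)))))))

  shift-vanish : ∀ {C : Code} {x y j f} → (∀ {g} → g ∈ C → coef g x ≡ 0#) → x + j ≋ y → f ∈ shiftCode j C → coef f y ≡ 0#
  shift-vanish {x = x} {y} {j} C-vanish p (g , g∈ , refl) = trans (coef-shift′ j g x y p)
      (trans (cong (_^[ j ]) (C-vanish g∈)) (^[]-0 j))

  shift-proportional : ∀ {C : Code} {x β y x′ y′ j f} → (∀ {g} → g ∈ C → coef g x ≡ β *ᴷ coef g y) → x + j ≋ x′ → y +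
      j ≋ y′ →
    f ∈ shiftCode j C → coef f x′ ≡ β ^[ j ] *ᴷ coef f y′
  shift-proportional {x = x} {β} {y} {x′} {y′} {j} C-prop p q (g , g∈ , refl) = trans (coef-shift′ j g x x′ p)
    (trans (cong (_^[ j ]) (C-prop g∈)) (trans (^[]-* β _ j) (cong (β ^[ j ] *ᴷ_) (sym (coef-shift′ j g y y′ q)))))

  proportional-0 : ∀ {a b β} → a ≡ β *ᴷ b → b ≡ 0# → a ≡ 0#
  proportional-0 {β = β} p b≡0 = trans p (trans (cong (β *ᴷ_) b≡0) (zeroʳ β))

  proportional-0′ : ∀ {a b β} → β ≢ 0# → a ≡ β *ᴷ b → a ≡ 0# → b ≡ 0#
  proportional-0′ β≢0 p a≡0 = x*y≡0⇒y≡0 β≢0 (trans (sym p) a≡0)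

  ^[]≢0 : ∀ {x} j → x ≢ 0# → x ^[ j ] ≢ 0#
  ^[]≢0 j x≢0 p = x≢0 (^[]≡0⇒≡0 j p)

  monomial-coef-≢ : ∀ s {i k} → gcd s n ≡ 1 → i < n → k < n → i ≢ k → ∀ a → coef (a ·x^[ s * i ]) (s * k) ≡ 0#
  monomial-coef-≢ s g i<n k<n i≢k a = coef-monomial-≋̸ a λ p → i≢k (sym (≋-small k<n i<n (Unit.≋-cancel-* s g p)))

  -- In renamed positions the shift by j ≡ s r moves i to i + r.
  shift-position : ∀ s r i {j k} f → s * r ≋ j → i + r ≋ k → coef (shift j f) (s * k) ≡ coef f (s * i) ^[ j ]
  shift-position s r i {j} {k} f sr≋j i+r≋k = coef-shift′ j f (s * i) (s * k)
    (trans (≋-+ {s * i} refl (sym sr≋j)) (trans (cong (_% n) (sym (ℕ.*-distribˡ-+ s i r))) (≋-*ˡ s i+r≋k)))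

  shift-position-0 : ∀ s r i {C j k f} → s * r ≋ j → f ∈ shiftCode j C → (∀ {g} → g ∈ C → coef g (s * i) ≡ 0#) → i +
      r ≋ k → coef f (s * k) ≡ 0#
  shift-position-0 s r i {j = j} sr≋j (g , g∈ , refl) C-vanish p = trans (shift-position s r i g sr≋j p)
      (trans (cong (_^[ j ]) (C-vanish g∈)) (^[]-0 j))

  index≥1 : ∀ {s r j} → s * r ≋ j → 1 ≤ j → j < n → 1 ≤ r
  index≥1 {s} {zero} sr≋j 1≤j j<n = contradiction (≋-small (ℕ.≤-<-trans z≤n j<n) j<n
      (trans (cong (_% n) (sym (ℕ.*-zeroʳ s))) sr≋j)) (ℕ.<⇒≢ 1≤j)
  index≥1 {r = suc r} _ _ _ = z<s

  ≤n∸1⇒< : ∀ {j} → j ≤ n ∸ 1 → j < n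
  ≤n∸1⇒< j≤ = ℕ.≤-<-trans j≤ (ℕ.∸-monoʳ-< {n} {1} {0} z<s (>-nonZero⁻¹ n))

  complement : ∀ {a b} → a ≤ b → ∃[ c ] c + a ≡ b
  complement {a} {b} a≤b = b ∸ a , ℕ.m∸n+n≡m a≤b

  n≋0 : n ≋ 0
  n≋0 = +n-≋ 0

  module Regular (s : ℕ) (g : gcd s n ≡ 1) where
    s*1≋s% : s * 1 ≋ s % n
    s*1≋s% = trans (cong (_% n) (ℕ.*-identityʳ s)) (sym (%-≋ s))

    shift-s : ∀ i → shift (s % n) x^[ s * i ] ≡ x^[ s * suc i ]
    shift-s i = trans (shift-x^[] (s % n) (s * i)) (x^[]-cong
        (trans (≋-+ {s * i} refl (%-≋ s)) (cong (_% n) (trans (ℕ.+-comm (s * i) s) (sym (ℕ.*-suc s i))))))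

    attained-at-s : ∀ {C d} → 2 ≤ n → HasDim (C ∩ shiftCode (s % n) C) d → IntersectionDimension C d
    attained-at-s 2≤n dim = s % n , coprime⇒1≤% 2≤n g , %≤n∸1 s , coprime-≋ (sym (%-≋ s)) g , dim

    monomials-hasDim : ∀ {W d} (P : Fin d → ℕ) → (∀ {i k} → s * P i ≋ s * P k → i ≡ k) → IsSubspace W →
        (∀ i → x^[ s * P i ] ∈ W) →
      DeterminedBy W (λ i → s * P i) → HasDim W d
    monomials-hasDim P inj W-sub x∈ det = dual⇒hasDim W-sub (λ i → x^[ s * P i ]) (λ i → s * P i) x∈
      (λ i → coef-monomial-≋ 1# refl) (λ i≢k → coef-monomial-≋̸ 1# λ p → i≢k (inj (sym p))) det

    wrap-0 : ∀ r m {C f j} → s * r ≋ j → f ∈ shiftCode j C → (∀ {g} → g ∈ C → coef g (s * m) ≡ 0#) → m + r ≡ n → coef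
        f (s * 0) ≡ 0#
    wrap-0 r m sr≋j f∈ vanish m+r≡n = shift-position-0 s r m sr≋j f∈ vanish (trans (cong (_% n) m+r≡n) n≋0)

    module _ (k : ℕ) (k<n : suc k < n) where
      private
        C : Code
        C = 𝒢 (suc k) s
        x : Vector 𝓛 (suc k)
        x i = x^[ s * toℕ i ]
        C-sub : IsSubspace C
        C-sub = ⟨⟩-subspace x
        det : DeterminedBy C (λ (i : Fin (suc k)) → s * toℕ i)
        det = 𝒢-determined (suc k) s g

        shift∈ : ∀ (i : Fin (suc k)) → shift (s * toℕ i) x^[ 0 ] ∈ C
        shift∈ i = subst C (sym (shift-x^[] (s * toℕ i) 0)) (∈⟨⟩ x i)

        -- The shift moves some vanishing position of the code onto one of 0, ..., k, which costs
        -- the intersection one coefficient. If k + 1 + r ≤ n, position n - r moves to 0; otherwise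
        -- k + 1 wraps around to k + 1 + r - n.
        missing : ∀ r → 1 ≤ r → r < n → ∃[ i ] ∃[ m ] suc k ≤ m × m < n × m + r ≋ toℕ {suc k} i
        missing r 1≤r r<n with suc k + r ℕ.≤? n | complement (ℕ.<⇒≤ r<n)
        ... | yes p | m , m+r≡n = zero , m , ℕ.+-cancelʳ-≤ r (suc k) m (subst (suc k + r ≤_) (sym m+r≡n) p) ,
            subst (m <_) m+r≡n (ℕ.m<m+n m 1≤r) , trans (cong (_% n) m+r≡n) n≋0
        ... | no p | _ with i , i+n≡ ← complement (ℕ.<⇒≤ (ℕ.≰⇒> p)) =
            fromℕ< (i<k i i+n≡) , suc k , ℕ.≤-refl , k<n ,
            trans (cong (_% n) (sym i+n≡)) (trans (+n-≋ i) (cong (_% n) (sym (toℕ-fromℕ< (i<k i i+n≡)))))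
          where
          i<k : ∀ i → i + n ≡ suc k + r → i < suc k
          i<k i p = ℕ.+-cancelʳ-< n i (suc k) (subst (_< suc k + n) (sym p) (ℕ.+-monoʳ-< (suc k) r<n))

        bound : IntersectionBound C k
        bound j 1≤j j≤ _ with r , r<n , sr≋j ← Unit.index s g j with missing r (index≥1 {s} sr≋j 1≤j (≤n∸1⇒< j≤)) r<n
        ... | i₀ , m , k<m , m<n , m+r≋i₀ = k , ℕ.≤-refl , (λ i → s * toℕ (punchIn i₀ i)) , λ { f (f∈ , f∈′) f≡0 →
              det f f∈ (λ i → by-cases f f≡0 (shift-position-0 s r m sr≋j f∈′ (𝒢-vanish s g k<m m<n) m+r≋i₀) i) }
          where
          by-cases : ∀ f → (∀ i → coef f (s * toℕ (punchIn i₀ i)) ≡ 0#) → coef f (s * toℕ i₀) ≡ 0# → ∀ i → coef f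
              (s * toℕ i) ≡ 0#
          by-cases f f≡0 f₀≡0 i with i₀ ≟ᶠ i
          ... | yes refl = f₀≡0
          ... | no i₀≢i = trans (cong (λ z → coef f (s * toℕ z)) (sym (punchIn-punchOut i₀≢i))) (f≡0 (punchOut i₀≢i))

        attained : IntersectionDimension C k
        attained = attained-at-s (ℕ.≤-trans (s≤s (s≤s z≤n)) k<n) (monomials-hasDim (λ (i : Fin k) → suc (toℕ i))
            (λ p → Data.Fin.Properties.suc-injective (*-small-injective {suc k} {s} g (ℕ.<⇒≤ k<n) {suc _} {suc _} p))
            (∩-subspace C-sub (shiftCode-subspace (s % n) C-sub))
            (λ i → ∈⟨⟩ x (suc i) , x^[ s * toℕ i ] , subst (λ z → x^[ s * z ] ∈ C) (toℕ-inject₁ i)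
                (∈⟨⟩ x (inject₁ i)) , sym (shift-s (toℕ i)))
            λ { f (f∈ , f∈′) f≡0 → det f f∈ λ { zero → first f f∈′ ; (suc i) → f≡0 i } })
          where
          first : ∀ f → f ∈ shiftCode (s % n) C → coef f (s * 0) ≡ 0#
          first f f∈′ with m , m+1≡n ← complement {1} {n} (ℕ.≤-trans (s≤s z≤n) k<n) =
            wrap-0 1 m s*1≋s% f∈′ (𝒢-vanish s g (ℕ.+-cancelʳ-≤ 1 (suc k) m (subst₂ _≤_ (ℕ.+-comm 1 (suc k)) (sym m+1≡n) k<n))
              (subst (m <_) m+1≡n (ℕ.m<m+n m z<s))) m+1≡n

      𝒢-values : ind[ C ]≡ suc k × h[ C ]≡ k
      𝒢-values = (index-lower C-sub (suc k) s x^[ 0 ] id-invertible g z<s (ℕ.<⇒≤ k<n) shift∈ ,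
          λ d dim → index-upper C-sub _ det k<n bound dim) , h-value bound attained

    -- The twisted codes ℋ, cut out by f_k = η f_0 and zeros at k + 1, ..., n - 1 in renamed
    -- positions

    module TwistedGabidulin (κ : ℕ) (k<n : suc (suc (suc κ)) < n) (η : 𝔽) (η≢0 : η ≢ 0#) where
      private
        k : ℕ
        k = suc (suc κ)
        C : Code
        C = ℋ k s η
        x : Vector 𝓛 k
        x = x^[ 0 ] ⊕ η ·x^[ s * k ] Data.Vec.Functional.∷ (λ (i : Fin (suc κ)) → x^[ s * suc (toℕ i) ])
        C-sub : IsSubspace C
        C-sub = ⟨⟩-subspace x
        1+k<n : suc k < n
        1+k<n = k<n
        k<n′ : k < n
        k<n′ = ℕ.<-trans (ℕ.n<1+n k) k<n

        F : 𝓛 → ℕ → 𝔽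
        F f i = coef f (s * i)

        F-x^[0] : ∀ {i} → 0 < i → i < n → coef x^[ 0 ] (s * i) ≡ 0#
        F-x^[0] {i} 0<i i<n = trans (cong (λ z → coef x^[ z ] (s * i)) (sym (ℕ.*-zeroʳ s)))
          (monomial-coef-≢ s g (ℕ.<-trans 0<i i<n) i<n (ℕ.<⇒≢ 0<i) 1#)

        high : ∀ {i} → k < i → i < n → ∀ {f} → f ∈ C → F f i ≡ 0#
        high {i} k<i i<n = ⟨⟩-vanish x (s * i) λ
          { zero → trans (coef-⊕ x^[ 0 ] (η ·x^[ s * k ]) (s * i)) (trans (cong₂ _+ᴷ_ (F-x^[0] (ℕ.≤-<-trans z≤n k<i) i<n)
                     (monomial-coef-≢ s g k<n′ i<n (ℕ.<⇒≢ k<i) η)) (+-identityˡ 0#))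
          ; (suc j) → monomial-coef-≢ s g (ℕ.<-trans (j<k j) k<n′) i<n (ℕ.<⇒≢ (ℕ.<-trans (j<k j) k<i)) 1# }
          where
          j<k : ∀ (j : Fin (suc κ)) → suc (toℕ j) < k
          j<k j = s≤s (toℕ<n j)

        twist : ∀ {f} → f ∈ C → F f k ≡ η *ᴷ F f 0
        twist = ⟨⟩⊆ (proportional-subspace (s * k) η (s * 0)) {b = x} λ
          { zero → trans (coef-⊕ x^[ 0 ] (η ·x^[ s * k ]) (s * k))
              (trans (cong₂ _+ᴷ_ (F-x^[0] z<s k<n′) (coef-monomial-≋ η refl)) (trans (+-identityˡ η)
              (sym (trans (cong (η *ᴷ_) (trans (coef-⊕ x^[ 0 ] (η ·x^[ s * k ]) (s * 0))
                  (trans (cong₂ _+ᴷ_ (coef-monomial-≋ 1# (cong (_% n) (ℕ.*-zeroʳ s)))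
                (monomial-coef-≢ s g k<n′ (ℕ.<-trans z<s k<n′) (λ ()) η)) (+-identityʳ 1#)))) (*-identityʳ η)))))
          ; (suc j) → trans (monomial-coef-≢ s g (ℕ.<-trans (j<k j) k<n′) k<n′ (ℕ.<⇒≢ (j<k j)) 1#)
              (sym (trans (cong (η *ᴷ_) (monomial-coef-≢ s g (ℕ.<-trans (j<k j) k<n′) (ℕ.<-trans z<s k<n′) (λ ())
                  1#)) (zeroʳ η))) }
          where
          j<k : ∀ (j : Fin (suc κ)) → suc (toℕ j) < k
          j<k j = s≤s (toℕ<n j)

        det : DeterminedBy C (λ (i : Fin k) → s * toℕ i)
        det f f∈ f≡0 = coef-units-ext s g λ i i<n → trans (by-cases i i<n) (sym (coef-0 _))
          where
          low : ∀ i → i < k → F f i ≡ 0#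
          low i i<k = trans (cong (F f) (sym (toℕ-fromℕ< i<k))) (f≡0 (fromℕ< i<k))
          by-cases : ∀ i → i < n → F f i ≡ 0#
          by-cases i i<n with ℕ.<-cmp i k
          ... | tri< i<k _ _ = low i i<k
          ... | tri≈ _ refl _ = proportional-0 (twist f∈) (low 0 z<s)
          ... | tri> _ _ k<i = high k<i i<n f∈

        -- The zeros at a and b may be deduced from zeros at the other positions below k. That
        -- freedom is used when n = k + 2, where the shifted twist only links b to another
        -- coefficient.
        drop-two : ∀ {W} a b → a < k → b < k → a ≢ b → W ⊆ C →
          (∀ {f} → f ∈ W → (∀ i → i < k → i ≢ a → i ≢ b → F f i ≡ 0#) → F f a ≡ 0# × F f b ≡ 0#) →
          Σ[ p ∈ (Fin κ → ℕ) ] DeterminedBy W p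
        drop-two {W} a b a<k b<k a≢b W⊆C two = (λ i → s * toℕ (position i)) , λ f f∈ f≡0 → det f (W⊆C f∈) λ i → all f
            f≡0 (two f∈ (rest f f≡0)) i
          where
          a′ b′ : Fin k
          a′ = fromℕ< a<k
          b′ = fromℕ< b<k
          a′≢b′ : a′ ≢ b′
          a′≢b′ p = a≢b (trans (sym (toℕ-fromℕ< a<k)) (trans (cong toℕ p) (toℕ-fromℕ< b<k)))
          position : Fin κ → Fin k
          position i = punchIn a′ (punchIn (punchOut a′≢b′) i)
          others : ∀ f → (∀ i → F f (toℕ (position i)) ≡ 0#) → ∀ i → a′ ≢ i → b′ ≢ i → F f (toℕ i) ≡ 0#
          others f f≡0 i a≢i b≢i = trans (cong (λ z → F f (toℕ z))
              (sym (trans (cong (punchIn a′) (punchIn-punchOut c≢)) (punchIn-punchOut a≢i)))) (f≡0 (punchOut c≢))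
            where
            c≢ : punchOut a′≢b′ ≢ punchOut a≢i
            c≢ p = b≢i (punchOut-injective a′≢b′ a≢i p)
          rest : ∀ f → (∀ i → F f (toℕ (position i)) ≡ 0#) → ∀ i → i < k → i ≢ a → i ≢ b → F f i ≡ 0#
          rest f f≡0 i i<k i≢a i≢b = trans (cong (F f) (sym (toℕ-fromℕ< i<k))) (others f f≡0 (fromℕ< i<k)
            (λ p → i≢a (trans (sym (toℕ-fromℕ< i<k)) (trans (cong toℕ (sym p)) (toℕ-fromℕ< a<k))))
            (λ p → i≢b (trans (sym (toℕ-fromℕ< i<k)) (trans (cong toℕ (sym p)) (toℕ-fromℕ< b<k)))))
          all : ∀ f → (∀ i → F f (toℕ (position i)) ≡ 0#) → F f a ≡ 0# × F f b ≡ 0# → ∀ i → F f (toℕ i) ≡ 0#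
          all f f≡0 (fa , fb) i with a′ ≟ᶠ i | b′ ≟ᶠ i
          ... | yes refl | _ = trans (cong (F f) (toℕ-fromℕ< a<k)) fa
          ... | no _ | yes refl = trans (cong (F f) (toℕ-fromℕ< b<k)) fb
          ... | no a≢i | no b≢i = others f f≡0 i a≢i b≢i

        -- When b + 1 = k, the twist converts the zero at k into a zero at 0, a position different
        -- from b because k ≥ 2.
        drop-adjacent : ∀ {W} b → b < k → W ⊆ C → (∀ {f} → f ∈ W → F f b ≡ 0# × F f (suc b) ≡ 0#) → Σ[ p ∈
            (Fin κ → ℕ) ] DeterminedBy W p
        drop-adjacent b b<k W⊆C zeros with suc b ℕ.≟ k
        ... | yes refl = drop-two b 0 b<k z<s (λ ()) W⊆C λ f∈ _ → proj₁ (zeros f∈) , proportional-0′ η≢0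
            (twist (W⊆C f∈)) (proj₂ (zeros f∈))
        ... | no 1+b≢k = drop-two b (suc b) b<k (ℕ.≤∧≢⇒< b<k 1+b≢k) (λ ()) W⊆C λ f∈ _ → zeros f∈

        module Intersection {r j : ℕ} (sr≋j : s * r ≋ j) where
          W : Code
          W = C ∩ shiftCode j C

          outer : ∀ i m → k < i → i < n → i + r ≋ m → ∀ {f} → f ∈ W → F f m ≡ 0#
          outer i m k<i i<n p (_ , f∈) = shift-position-0 s r i sr≋j f∈ (high k<i i<n) p

          shifted-twist : ∀ m → k + r ≋ m → ∀ {f} → f ∈ W → F f m ≡ η ^[ j ] *ᴷ F f r
          shifted-twist m p (_ , (f , f∈ , refl)) = trans (shift-position s r k f sr≋j p) (trans (cong (_^[ j ]) (twist f∈))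
            (trans (^[]-* η _ j) (cong (η ^[ j ] *ᴷ_) (sym (shift-position s r 0 f sr≋j refl)))))

          -- The vanishing position n - 1 moves to 0. The shifted twist links 1 to k + 1, where C
          -- vanishes because k + 1 < n.
          first-two : r ≡ 1 → ∀ {f} → f ∈ W → F f 0 ≡ 0# × F f 1 ≡ 0#
          first-two refl {f} f∈ with m , m+1≡n ← complement {1} {n} (>-nonZero⁻¹ n) =
            outer m 0 (k<m m m+1≡n) (subst (m <_) m+1≡n (ℕ.m<m+n m z<s)) (trans (cong (_% n) m+1≡n) n≋0) f∈ ,
            proportional-0′ (^[]≢0 j η≢0) (shifted-twist (k + 1) refl f∈)
                (high (ℕ.m<m+n k z<s) (subst (_< n) (ℕ.+-comm 1 k) 1+k<n) (proj₁ f∈))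
            where
            k<m : ∀ m → m + 1 ≡ n → k < m
            k<m m p = ℕ.+-cancelʳ-< 1 k m (subst₂ _<_ (ℕ.+-comm 1 k) (sym p) 1+k<n)

          W⊆C : W ⊆ C
          W⊆C = proj₁

          -- Only position k + 1 = n - 1 vanishes on C, and it moves to r - 1 = b + 1. The shifted
          -- twist makes the coefficient at b a multiple of that at r, which is either among the
          -- remaining ones or, for r = k, a multiple of the one at 0.
          penultimate : gcd r n ≡ 1 → ∀ b → r ≡ 2 + b → 2 + b ≤ k → 2 + k ≡ n → Σ[ p ∈ (Fin κ → ℕ) ] DeterminedBy W p
          penultimate r-coprime b refl 2+b≤k 2+k≡n = drop-two (suc b) b 2+b≤k (ℕ.<-trans (ℕ.n<1+n b) 2+b≤k) ℕ.1+n≢n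
              W⊆C λ f∈ rest →
              outer (suc k) (suc b) ℕ.≤-refl 1+k<n (trans (cong (_% n)
                  (trans (ℕ.+-suc (suc k) (suc b)) (ℕ.+-comm (suc (suc k)) (suc b))))
                  (trans (cong (λ z → (suc b + z) % n) 2+k≡n) (+n-≋ (suc b)))) f∈ ,
              proportional-0 (shifted-twist b (trans (cong (_% n)
                  (trans (ℕ.+-suc k (suc b)) (trans (cong suc (ℕ.+-suc k b)) (ℕ.+-comm (suc (suc k)) b))))
                  (trans (cong (λ z → (b + z) % n) 2+k≡n) (+n-≋ b))) f∈) (at-r f∈ rest)
            where
            at-r : ∀ {f} → f ∈ W → (∀ i → i < k → i ≢ suc b → i ≢ b → F f i ≡ 0#) → F f (2 + b) ≡ 0#
            at-r {f} f∈ rest with 2 + b ℕ.≟ k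
            ... | no 2+b≢k = rest (2 + b) (ℕ.≤∧≢⇒< 2+b≤k 2+b≢k) ℕ.1+n≢n
                (ℕ.<⇒≢ (ℕ.<-trans (ℕ.n<1+n b) (ℕ.n<1+n (suc b))) ∘ sym)
            ... | yes 2+b≡k = trans (cong (F f) 2+b≡k) (proportional-0 (twist (proj₁ f∈)) (rest 0 z<s (λ ()) (b≢0 b refl)))
              where
              -- b = 0 would mean r = k = 2 and n = 4, against gcd r n = 1.
              b≢0 : ∀ c → c ≡ b → 0 ≢ c
              b≢0 zero refl _ = contradiction (subst (λ z → gcd 2 z ≡ 1)
                  (trans (sym 2+k≡n) (cong (2 +_) (sym 2+b≡k))) r-coprime) λ ()

          -- The shift moves k + 1 to k, giving a zero there, and moves the twist to the positions k
          -- - 1 and r = n - 1, of which the latter already vanishes on C.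
          last-two : suc r ≡ n → ∀ {f} → f ∈ W → F f (suc κ) ≡ 0# × F f k ≡ 0#
          last-two 1+r≡n f∈ =
            proportional-0 (shifted-twist (suc κ) (wrap (suc κ)) f∈)
              (high (s<s⁻¹ (subst (suc k <_) (sym 1+r≡n) 1+k<n)) (subst (r <_) 1+r≡n (ℕ.n<1+n r)) (proj₁ f∈)) ,
            outer (suc k) k ℕ.≤-refl 1+k<n (wrap k) f∈
            where
            wrap : ∀ i → suc i + r ≋ i
            wrap i = trans (cong (_% n) (trans (sym (ℕ.+-suc i r)) (cong (i +_) 1+r≡n))) (+n-≋ i)

          -- Now at least two consecutive positions vanish on C, and a suitable pair lands on c, c +
          -- 1 with c < k. For r ≤ k + 1 these are n - 2 and n - 1, landing on r - 2 and r - 1.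
          -- Otherwise they are k + 1 and k + 2 if n ≤ k + 1 + r, and n - r and n - r + 1, landing
          -- on 0 and 1, if not.
          middle : ∀ b → r ≡ 2 + b → 2 + r ≤ n → 3 + k ≤ n → ∃[ c ] c < k × (∀ {f} → f ∈ W → F f c ≡ 0# × F f (suc c) ≡ 0#)
          middle b refl r+2≤n k+3≤n with r ℕ.≤? suc k | n ℕ.≤? suc k + r
          ... | yes r≤1+k | _ with m , m+2≡n ← complement {2} {n} (ℕ.≤-trans (s≤s (s≤s z≤n)) k+3≤n) =
            b , s≤s⁻¹ r≤1+k , λ f∈ → outer m b (k<m m m+2≡n) (subst (m <_) m+2≡n (ℕ.m<m+n m z<s)) (wrap m m+2≡n) f∈ ,
              outer (suc m) (suc b) (ℕ.<-trans (k<m m m+2≡n) (ℕ.n<1+n m))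
                  (subst (suc m <_) (trans (ℕ.+-comm 2 m) m+2≡n) ℕ.≤-refl)
                (trans (cong (_% n) (trans (ℕ.+-assoc 1 m (2 + b)) (ℕ.+-comm 1 (m + (2 + b)))))
                    (trans (≋-+ {m + (2 + b)} (wrap m m+2≡n) refl) (cong (_% n) (ℕ.+-comm b 1)))) f∈
            where
            k<m : ∀ m → m + 2 ≡ n → k < m
            k<m m p = ℕ.+-cancelʳ-≤ 2 (suc k) m (subst₂ _≤_ (ℕ.+-comm 2 (suc k)) (sym p) k+3≤n)
            wrap : ∀ m → m + 2 ≡ n → m + (2 + b) ≋ b
            wrap m p = trans (cong (_% n) (trans (sym (ℕ.+-assoc m 2 b)) (trans (cong (_+ b) p) (ℕ.+-comm n b)))) (+n-≋ b)
          ... | no r≰1+k | yes n≤ with c , c+n≡ ← complement n≤ =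
            c , c<k c c+n≡ , λ f∈ → outer (suc k) c ℕ.≤-refl 1+k<n (wrap c c+n≡) f∈ ,
              outer (2 + k) (suc c) (ℕ.<-trans (ℕ.n<1+n k) (ℕ.n<1+n (suc k))) k+3≤n
                (trans (cong (_% n) (ℕ.+-comm 1 (suc k + r)))
                    (trans (≋-+ {suc k + r} (wrap c c+n≡) refl) (cong (_% n) (ℕ.+-comm c 1)))) f∈
            where
            wrap : ∀ c → c + n ≡ suc k + r → suc k + r ≋ c
            wrap c p = trans (cong (_% n) (sym p)) (+n-≋ c)
            c<k : ∀ c → c + n ≡ suc k + r → c < k
            c<k c p = ℕ.+-cancelʳ-≤ n (suc c) k (subst₂ _≤_ (cong suc (sym p)) refl
              (subst (_≤ k + n) (trans (ℕ.+-suc k (suc r)) (cong suc (ℕ.+-suc k r))) (ℕ.+-monoʳ-≤ k r+2≤n)))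
          ... | no r≰1+k | no n≰ with m , m+r≡n ← complement {r} {n} (ℕ.≤-trans (ℕ.m≤n+m r 2) r+2≤n) =
            0 , z<s , λ f∈ → outer m 0 (k<m m m+r≡n) (subst (m <_) m+r≡n (ℕ.m<m+n m z<s))
                (trans (cong (_% n) m+r≡n) n≋0) f∈ ,
              outer (suc m) 1 (ℕ.<-trans (k<m m m+r≡n) (ℕ.n<1+n m))
                (subst₂ _<_ (ℕ.+-comm m 1) m+r≡n (ℕ.+-monoʳ-< m (s<s z<s)))
                (trans (cong (_% n) (cong suc m+r≡n)) (+n-≋ 1)) f∈
            where
            k<m : ∀ m → m + r ≡ n → k < m
            k<m m p = ℕ.+-cancelʳ-< r k m (subst (k + r <_) (sym p) (ℕ.<-trans (ℕ.n<1+n (k + r)) (ℕ.≰⇒> n≰)))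

          determined : 1 ≤ r → r < n → gcd r n ≡ 1 → Σ[ p ∈ (Fin κ → ℕ) ] DeterminedBy W p
          determined 1≤r r<n r-coprime = by-cases r refl (suc r ℕ.≟ n) (2 + k ℕ.≟ n)
            where
            by-cases : ∀ r′ → r ≡ r′ → Dec (suc r ≡ n) → Dec (2 + k ≡ n) → Σ[ p ∈ (Fin κ → ℕ) ] DeterminedBy W p
            by-cases zero r≡0 _ _ = contradiction (sym r≡0) (ℕ.<⇒≢ 1≤r)
            by-cases (suc zero) r≡1 _ _ = drop-adjacent 0 z<s W⊆C (first-two r≡1)
            by-cases (suc (suc b)) _ (yes 1+r≡n) _ = drop-adjacent (suc κ) ℕ.≤-refl W⊆C (last-two 1+r≡n)
            by-cases (suc (suc b)) r≡ (no 1+r≢n) (yes 2+k≡n) = penultimate r-coprime b r≡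
              (s≤s⁻¹ (s≤s⁻¹ (subst₂ _≤_ (cong (2 +_) r≡) (sym 2+k≡n) (ℕ.≤∧≢⇒< r<n 1+r≢n)))) 2+k≡n
            by-cases (suc (suc b)) r≡ (no 1+r≢n) (no 2+k≢n) with c , c<k , zeros ← middle b r≡ (ℕ.≤∧≢⇒< r<n 1+r≢n)
                (ℕ.≤∧≢⇒< 1+k<n 2+k≢n) =
              drop-adjacent c c<k W⊆C zeros

        bound : IntersectionBound C κ
        bound j 1≤j j≤ j-coprime with r , r<n , sr≋j ← Unit.index s g j =
          κ , ℕ.≤-refl , Intersection.determined {r} sr≋j (index≥1 {s} sr≋j 1≤j (≤n∸1⇒< j≤)) r<n
              (coprime-*ʳ s r (coprime-≋ (sym sr≋j) j-coprime))

        attained : IntersectionDimension C κ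
        attained = attained-at-s (ℕ.≤-trans (s≤s (s≤s z≤n)) 1+k<n) (monomials-hasDim (λ (i : Fin κ) → 2 + toℕ i)
            (λ p → Data.Fin.Properties.suc-injective (Data.Fin.Properties.suc-injective
                (*-small-injective {k} {s} g (ℕ.<⇒≤ k<n′) {suc (suc _)} {suc (suc _)} p)))
            (∩-subspace C-sub (shiftCode-subspace (s % n) C-sub))
            (λ i → ∈⟨⟩ x (suc (suc i)) , x^[ s * suc (toℕ i) ] , subst (λ z → x^[ s * suc z ] ∈ C) (toℕ-inject₁ i)
                (∈⟨⟩ x (suc (inject₁ i))) , sym (shift-s (suc (toℕ i))))
            λ { f f∈ f≡0 → let f₀ , f₁ = Intersection.first-two {1} {s % n} s*1≋s% refl f∈ in
                det f (proj₁ f∈) λ { zero → f₀ ; (suc zero) → f₁ ; (suc (suc i)) → f≡0 i } })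

        shift∈ : ∀ (i : Fin (suc κ)) → shift (s * toℕ i) x^[ s ] ∈ C
        shift∈ i = subst C (sym (trans (shift-x^[] (s * toℕ i) s) (cong x^[_] (sym (ℕ.*-suc s (toℕ i)))))) (∈⟨⟩ x (suc i))

      ℋ-values : ind[ C ]≡ suc κ × h[ C ]≡ κ
      ℋ-values = (index-lower C-sub (suc κ) s x^[ s ] (x^[]-invertible s) g z<s
          (ℕ.<⇒≤ (ℕ.<-trans (ℕ.n<1+n (suc κ)) k<n′)) shift∈ ,
          λ d dim → index-upper C-sub _ det k<n′ bound dim) , h-value bound attained

-- Codes spanned by monomials

module Positions (n : ℕ) .{{_ : NonZero n}} {m : ℕ} (P : Fin m → ℕ) where
  open Congruence n

  Occurs : ℕ → Set
  Occurs i = ∃[ t ] P t ≋ i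

  occurs? : ∀ i → Dec (Occurs i)
  occurs? i = any? λ t → P t % n ℕ.≟ i % n

  -- i lies in P ∩ (P + r) modulo n; since r ≤ n, i + (n ∸ r) represents i − r.
  Common : ℕ → Fin n → Set
  Common r i = Occurs (toℕ i) × Occurs (toℕ i + (n ∸ r))

  common? : ∀ r i → Dec (Common r i)
  common? r i = occurs? (toℕ i) ×-dec occurs? (toℕ i + (n ∸ r))

  common : ℕ → List (Fin n)
  common r = filter (common? r) (allFin n)

  AtMost : ℕ → Set
  AtMost h = ∀ (r : Fin n) → gcd (toℕ r) n ≡ 1 → length (common (toℕ r)) ≤ h

  atMost? : ∀ h → Dec (AtMost h)
  atMost? h = all? λ r → (gcd (toℕ r) n ℕ.≟ 1) →-dec (length (common (toℕ r)) ℕ.≤? h)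

  -- The monomials at a, ..., a + h span a Gabidulin subcode of dimension h + 1. The second
  -- component says that P ∩ (P + 1) contains nothing beyond a + 1, ..., a + h, so the shift r = 1
  -- attains h.
  Run : ℕ → ℕ → Set
  Run a h = (∀ (i : Fin (suc h)) → Occurs (a + toℕ i)) × (∀ i → Common 1 i → ∃[ t ] suc a + toℕ {h} t ≋ toℕ i) 

  run? : ∀ a h → Dec (Run a h)
  run? a h = all? (λ i → occurs? (a + toℕ i)) ×-dec
    all? λ i → common? 1 i →-dec any? λ t → (suc a + toℕ t) % n ℕ.≟ toℕ i % n

module _ {q n : ℕ} .{{_ : NonZero n}} (q-primePower : IsPrimePower q) (K : FiniteField (q ^ n)) where
  open LinearizedPolynomials q n K
  open FieldProperties K hiding (_^ᴷ_; productᴷ)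
  open FrobeniusProperties q-primePower K
  open LinearizedAlgebra q-primePower K
  open GabidulinCodes q-primePower K
  open IndexCriteria q-primePower K
  open CodeFamilies q-primePower K
  open Congruence n

  module MonomialCode {m : ℕ} (P : Fin m → ℕ) (s : ℕ) (g : gcd s n ≡ 1) (b : Vector 𝓛 m) (b≡ : ∀ i → b i ≡ x^[ s * P i ])
      (a h : ℕ) (m<n : m < n) (1+h≤n : suc h ≤ n) (few : Positions.AtMost n P h) (run : Positions.Run n P a h) where
    open Positions n P
    open Regular s g
    private
      C : Code
      C = ⟨ b ⟩
      C-sub : IsSubspace C
      C-sub = ⟨⟩-subspace b

      x∈ : ∀ i → Occurs i → x^[ s * i ] ∈ C
      x∈ i (t , p) = subst C (trans (b≡ t) (x^[]-cong (≋-*ˡ s p))) (∈⟨⟩ b t)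

      vanish : ∀ i → ¬ Occurs i → ∀ {f} → f ∈ C → coef f (s * i) ≡ 0#
      vanish i ¬occurs = ⟨⟩-vanish b (s * i) λ t → trans (cong (λ f → coef f (s * i)) (b≡ t))
        (coef-monomial-≋̸ 1# λ p → ¬occurs (t , sym (Unit.≋-cancel-* s g p)))

      zero-by-positions : ∀ {f} → (∀ (i : Fin n) → coef f (s * toℕ i) ≡ 0#) → f ≡ 0ᴸ
      zero-by-positions {f} f≡0 = coef-units-ext s g λ i i<n → trans
          (trans (cong (λ z → coef f (s * z)) (sym (toℕ-fromℕ< i<n))) (f≡0 (fromℕ< i<n))) (sym (coef-0 _))

      det : DeterminedBy C (λ i → s * P i)
      det f f∈ f≡0 = zero-by-positions λ i → by-cases i (occurs? (toℕ i))
        where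
        by-cases : ∀ i → Dec (Occurs (toℕ i)) → coef f (s * toℕ i) ≡ 0#
        by-cases i (yes (t , p)) = trans (coef-cong f (≋-*ˡ s (sym p))) (f≡0 t)
        by-cases i (no ¬p) = vanish (toℕ i) ¬p f∈

      -- Positions outside P vanish on C and positions outside P + r vanish on its shift, so only P
      -- ∩ (P + r) remains to be covered.
      common-determined : ∀ {r j e} (Q : Fin e → ℕ) → r ≤ n → s * r ≋ j → (∀ i → Common r i → ∃[ t ] Q t ≋ toℕ i) →
        DeterminedBy (C ∩ shiftCode j C) (λ t → s * Q t)
      common-determined {r} Q r≤n sr≋j cover f (f∈ , f∈′) f≡0 = zero-by-positions λ i →
          by-cases i (occurs? (toℕ i)) (occurs? (toℕ i + (n ∸ r)))
        where
        by-cases : ∀ i → Dec (Occurs (toℕ i)) → Dec (Occurs (toℕ i + (n ∸ r))) → coef f (s * toℕ i) ≡ 0#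
        by-cases i (no ¬p) _ = vanish (toℕ i) ¬p f∈
        by-cases i _ (no ¬p) = shift-position-0 s r (toℕ i + (n ∸ r)) sr≋j f∈′ (vanish _ ¬p)
          (trans (cong (_% n) (trans (ℕ.+-assoc (toℕ i) _ r) (cong (toℕ i +_) (ℕ.m∸n+n≡m r≤n)))) (+n-≋ (toℕ i)))
        by-cases i (yes p) (yes p′) = let t , Qt≋i = cover i (p , p′) in trans (coef-cong f (≋-*ˡ s (sym Qt≋i))) (f≡0 t)

      bound : IntersectionBound C h
      bound j _ _ j-coprime with r , r<n , sr≋j ← Unit.index s g j =
        length (common r) , subst (λ z → length (common z) ≤ h) (toℕ-fromℕ< r<n) (few (fromℕ< r<n)
          (subst (λ z → gcd z n ≡ 1) (sym (toℕ-fromℕ< r<n)) (coprime-*ʳ s r (coprime-≋ (sym sr≋j) j-coprime)))) ,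
        (λ t → s * toℕ (List.lookup (common r) t)) ,
        common-determined (λ t → toℕ (List.lookup (common r) t)) (ℕ.<⇒≤ r<n) sr≋j λ i c →
          let i∈ = ∈-filter⁺ (common? r) (∈-allFin i) c in Any.index i∈ , cong (λ z → toℕ z % n) (sym (lookup-index i∈))

      +-small-injective : ∀ {h} → h ≤ n → ∀ {i k : Fin h} c → s * (c + toℕ i) ≋ s * (c + toℕ k) → i ≡ k
      +-small-injective h≤n {i} {k} c p = toℕ-injective (≋-small (ℕ.<-≤-trans (toℕ<n i) h≤n) (ℕ.<-≤-trans (toℕ<n k) h≤n)
        (≋-cancelʳ c (subst₂ _≋_ (ℕ.+-comm c _) (ℕ.+-comm c _) (Unit.≋-cancel-* s g p))))

      attained : IntersectionDimension C h
      attained = attained-at-s (ℕ.≤-trans (s≤s (ℕ.≤-trans z<s (toℕ<n (proj₁ (proj₁ run zero))))) m<n)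
        (monomials-hasDim (λ (i : Fin h) → suc a + toℕ i) (+-small-injective (ℕ.<⇒≤ 1+h≤n) (suc a))
          (∩-subspace C-sub (shiftCode-subspace (s % n) C-sub))
          (λ i → subst (λ z → x^[ s * z ] ∈ C) (ℕ.+-suc a (toℕ i)) (x∈ _ (proj₁ run (suc i))) ,
                 x^[ s * (a + toℕ i) ] , subst (λ z → x^[ s * (a + z) ] ∈ C) (Data.Fin.Properties.toℕ-inject₁ i)
                     (x∈ _ (proj₁ run (Fin.inject₁ i))) ,
                 sym (shift-s (a + toℕ i)))
          (common-determined (λ i → suc a + toℕ i) (>-nonZero⁻¹ n) s*1≋s% (proj₂ run)))

      shift∈ : ∀ (i : Fin (suc h)) → shift (s * toℕ i) x^[ s * a ] ∈ C
      shift∈ i = subst C (sym (trans (shift-x^[] (s * toℕ i) (s * a))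
          (cong x^[_] (sym (ℕ.*-distribˡ-+ s a (toℕ i)))))) (x∈ _ (proj₁ run i))

    monomial-values : ind[ C ]≡ suc h × h[ C ]≡ h
    monomial-values = (index-lower C-sub (suc h) s x^[ s * a ] (x^[]-invertible (s * a)) g z<s 1+h≤n shift∈ ,
      λ d dim → index-upper C-sub _ det m<n bound dim) , h-value bound attained

-- The exponents of 𝒞₃ and 𝒞₅, of 𝒟₃, and of 𝒟₅, with the common factor s removed.
exponents-𝒞 : Vector ℕ 3
exponents-𝒞 = 0 ∷ 1 ∷ 3 ∷ []

exponents-𝒟₃ : Vector ℕ 4
exponents-𝒟₃ = 0 ∷ 2 ∷ 3 ∷ 4 ∷ []

exponents-𝒟₅ : Vector ℕ 5
exponents-𝒟₅ = 0 ∷ 2 ∷ 3 ∷ 4 ∷ 5 ∷ []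

-- {0, 1, 3} is a planar difference set modulo 7: every nonzero r is a difference exactly once.
𝒞₃-atMost : Positions.AtMost 7 exponents-𝒞 1
𝒞₃-atMost = toWitness {a? = Positions.atMost? 7 exponents-𝒞 1} _

𝒞₃-run : Positions.Run 7 exponents-𝒞 0 1
𝒞₃-run = toWitness {a? = Positions.run? 7 exponents-𝒞 0 1} _

-- {0, 2, 3, 4} is the complement of the planar difference set {1, 5, 6} modulo 7, so every nonzero
-- r is a difference exactly twice.
𝒟₃-atMost : Positions.AtMost 7 exponents-𝒟₃ 2
𝒟₃-atMost = toWitness {a? = Positions.atMost? 7 exponents-𝒟₃ 2} _

𝒟₃-run : Positions.Run 7 exponents-𝒟₃ 2 2
𝒟₃-run = toWitness {a? = Positions.run? 7 exponents-𝒟₃ 2 2} _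

-- Modulo 8 every odd r is exactly one difference of {0, 1, 3}, and only odd r are prime to 8.
𝒞₅-atMost : Positions.AtMost 8 exponents-𝒞 1
𝒞₅-atMost = toWitness {a? = Positions.atMost? 8 exponents-𝒞 1} _

𝒞₅-run : Positions.Run 8 exponents-𝒞 0 1
𝒞₅-run = toWitness {a? = Positions.run? 8 exponents-𝒞 0 1} _

-- The missing positions {1, 6, 7} have every odd r as a difference exactly once, so P ∩ (P + r) has
-- 8 - (3 + 3 - 1) = 3 elements.
𝒟₅-atMost : Positions.AtMost 8 exponents-𝒟₅ 3
𝒟₅-atMost = toWitness {a? = Positions.atMost? 8 exponents-𝒟₅ 3} _

𝒟₅-run : Positions.Run 8 exponents-𝒟₅ 2 3
𝒟₅-run = toWitness {a? = Positions.run? 8 exponents-𝒟₅ 2 3} _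

module MonomialCodeValues {q : ℕ} (q-primePower : IsPrimePower q) where

  module _ (K : FiniteField (q ^ 7)) (s : ℕ) (g : gcd s 7 ≡ 1) where
    open LinearizedPolynomials q 7 K

    private
      b : Vector 𝓛 3
      b = x^[ 0 ] ∷ x^[ s ] ∷ x^[ 3 * s ] ∷ []

      b≡ : ∀ i → b i ≡ x^[ s * exponents-𝒞 i ]
      b≡ 0F = cong x^[_] (sym (ℕ.*-zeroʳ s))
      b≡ 1F = cong x^[_] (sym (ℕ.*-identityʳ s))
      b≡ 2F = cong x^[_] (ℕ.*-comm 3 s)

      values : ind[ ⟨ b ⟩ ]≡ 2 × h[ ⟨ b ⟩ ]≡ 1
      values = MonomialCode.monomial-values q-primePower K exponents-𝒞 s g b b≡ 0 1 (ℕ.m≤m+n 4 3) (ℕ.m≤m+n 2 5)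
          𝒞₃-atMost 𝒞₃-run

    𝒞₃-values : ind[ 𝒞₃ s ]≡ 2 × h[ 𝒞₃ s ]≡ 1
    𝒞₃-values = values

  module _ (K : FiniteField (q ^ 7)) (s : ℕ) (g : gcd s 7 ≡ 1) where
    open LinearizedPolynomials q 7 K

    private
      b : Vector 𝓛 4
      b = x^[ 0 ] ∷ x^[ 2 * s ] ∷ x^[ 3 * s ] ∷ x^[ 4 * s ] ∷ []

      b≡ : ∀ i → b i ≡ x^[ s * exponents-𝒟₃ i ]
      b≡ 0F = cong x^[_] (sym (ℕ.*-zeroʳ s))
      b≡ 1F = cong x^[_] (ℕ.*-comm 2 s)
      b≡ 2F = cong x^[_] (ℕ.*-comm 3 s)
      b≡ 3F = cong x^[_] (ℕ.*-comm 4 s)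

      values : ind[ ⟨ b ⟩ ]≡ 3 × h[ ⟨ b ⟩ ]≡ 2
      values = MonomialCode.monomial-values q-primePower K exponents-𝒟₃ s g b b≡ 2 2 (ℕ.m≤m+n 5 2) (ℕ.m≤m+n 3 4)
          𝒟₃-atMost 𝒟₃-run

    𝒟₃-values : ind[ 𝒟₃ s ]≡ 3 × h[ 𝒟₃ s ]≡ 2
    𝒟₃-values = values

  module _ (K : FiniteField (q ^ 8)) (s : ℕ) (g : gcd s 8 ≡ 1) where
    open LinearizedPolynomials q 8 K

    private
      b : Vector 𝓛 3
      b = x^[ 0 ] ∷ x^[ s ] ∷ x^[ 3 * s ] ∷ []

      b≡ : ∀ i → b i ≡ x^[ s * exponents-𝒞 i ]
      b≡ 0F = cong x^[_] (sym (ℕ.*-zeroʳ s))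
      b≡ 1F = cong x^[_] (sym (ℕ.*-identityʳ s))
      b≡ 2F = cong x^[_] (ℕ.*-comm 3 s)

      values : ind[ ⟨ b ⟩ ]≡ 2 × h[ ⟨ b ⟩ ]≡ 1
      values = MonomialCode.monomial-values q-primePower K exponents-𝒞 s g b b≡ 0 1 (ℕ.m≤m+n 4 4) (ℕ.m≤m+n 2 6)
          𝒞₅-atMost 𝒞₅-run

    𝒞₅-values : ind[ 𝒞₅ s ]≡ 2 × h[ 𝒞₅ s ]≡ 1
    𝒞₅-values = values

  module _ (K : FiniteField (q ^ 8)) (s : ℕ) (g : gcd s 8 ≡ 1) where
    open LinearizedPolynomials q 8 K

    private
      b : Vector 𝓛 5
      b = x^[ 0 ] ∷ x^[ 2 * s ] ∷ x^[ 3 * s ] ∷ x^[ 4 * s ] ∷ x^[ 5 * s ] ∷ []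

      b≡ : ∀ i → b i ≡ x^[ s * exponents-𝒟₅ i ]
      b≡ 0F = cong x^[_] (sym (ℕ.*-zeroʳ s))
      b≡ 1F = cong x^[_] (ℕ.*-comm 2 s)
      b≡ 2F = cong x^[_] (ℕ.*-comm 3 s)
      b≡ 3F = cong x^[_] (ℕ.*-comm 4 s)
      b≡ 4F = cong x^[_] (ℕ.*-comm 5 s)

      values : ind[ ⟨ b ⟩ ]≡ 4 × h[ ⟨ b ⟩ ]≡ 3
      values = MonomialCode.monomial-values q-primePower K exponents-𝒟₅ s g b b≡ 2 3 (ℕ.m≤m+n 6 2) (ℕ.m≤m+n 4 4)
          𝒟₅-atMost 𝒟₅-run

    𝒟₅-values : ind[ 𝒟₅ s ]≡ 4 × h[ 𝒟₅ s ]≡ 3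
    𝒟₅-values = values

-- The codes 𝒞₁, 𝒞₂ and 𝒞₄

module SparseCodes {q n : ℕ} .{{_ : NonZero n}} (q-primePower : IsPrimePower q) (K : FiniteField (q ^ n)) where
  open LinearizedPolynomials q n K
  open FieldProperties K hiding (_^ᴷ_; productᴷ)
  open FrobeniusProperties q-primePower K
  open LinearizedAlgebra q-primePower K
  open GabidulinCodes q-primePower K
  open IndexCriteria q-primePower K
  open CodeFamilies q-primePower K
  open Congruence n
  open IsSubspace

  on : ∀ i k {a} → k ≋ i → coef (a ·x^[ i ]) k ≡ a
  on i k p = coef-monomial-≋ {i} {k} _ p

  off : ∀ i k {a} → ¬ k ≋ i → coef (a ·x^[ i ]) k ≡ 0#
  off i k p = coef-monomial-≋̸ {i} {k} _ p

  coef-⊕ˡ : ∀ {f g k a} → coef f k ≡ a → coef g k ≡ 0# → coef (f ⊕ g) k ≡ a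
  coef-⊕ˡ {f} {g} {k} p q = trans (coef-⊕ f g k) (trans (cong₂ _+ᴷ_ p q) (+-identityʳ _))

  coef-⊕ʳ : ∀ {f g k a} → coef f k ≡ 0# → coef g k ≡ a → coef (f ⊕ g) k ≡ a
  coef-⊕ʳ {f} {g} {k} p q = trans (coef-⊕ f g k) (trans (cong₂ _+ᴷ_ p q) (+-identityˡ _))

  coef-⊖ˡ : ∀ {f g k a} → coef f k ≡ a → coef g k ≡ 0# → coef (f ⊖ g) k ≡ a
  coef-⊖ˡ {f} {g} {k} p q = trans (coef-⊖ f g k) (trans (cong₂ (λ x y → x +ᴷ (-ᴷ y)) p q)
      (trans (cong (_ +ᴷ_) -0#≈0#) (+-identityʳ _)))

  coef-⊖ʳ : ∀ {f g k a} → coef f k ≡ 0# → coef g k ≡ a → coef (f ⊖ g) k ≡ -ᴷ a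
  coef-⊖ʳ {f} {g} {k} p q = trans (coef-⊖ f g k) (trans (cong₂ (λ x y → x +ᴷ (-ᴷ y)) p q) (+-identityˡ _))

  both-0 : ∀ {a b β} → a ≡ 0# → b ≡ 0# → a ≡ β *ᴷ b
  both-0 {β = β} a≡0 b≡0 = trans a≡0 (sym (trans (cong (β *ᴷ_) b≡0) (zeroʳ β)))

  ratio : ∀ {a b β} → a ≡ β → b ≡ 1# → a ≡ β *ᴷ b
  ratio {β = β} a≡β b≡1 = trans a≡β (sym (trans (cong (β *ᴷ_) b≡1) (*-identityʳ β)))

  telescope : ∀ δ x y z → (x +ᴷ (-ᴷ (δ *ᴷ y))) +ᴷ δ *ᴷ (y +ᴷ (-ᴷ z)) ≡ x +ᴷ (-ᴷ (δ *ᴷ z))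
  telescope δ x y z = begin
    (x +ᴷ (-ᴷ (δ *ᴷ y))) +ᴷ δ *ᴷ (y +ᴷ (-ᴷ z))  ≡⟨ cong ((x +ᴷ (-ᴷ (δ *ᴷ y))) +ᴷ_)
        (trans (distribˡ δ y _) (cong (δ *ᴷ y +ᴷ_) (sym (-‿distribʳ-* δ z)))) ⟩
    (x +ᴷ (-ᴷ (δ *ᴷ y))) +ᴷ (δ *ᴷ y +ᴷ (-ᴷ (δ *ᴷ z)))  ≡⟨ +-assoc _ (δ *ᴷ y) _ ⟨
    (x +ᴷ (-ᴷ (δ *ᴷ y))) +ᴷ δ *ᴷ y +ᴷ (-ᴷ (δ *ᴷ z))  ≡⟨ cong (_+ᴷ (-ᴷ (δ *ᴷ z)))
        (trans (+-assoc x _ _) (trans (cong (x +ᴷ_) (-‿inverseˡ _)) (+-identityʳ x))) ⟩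
    x +ᴷ (-ᴷ (δ *ᴷ z))                                          ∎
    where open ≡-Reasoning

  ev-⊖ : ∀ f g x → ev (f ⊖ g) x ≡ ev f x +ᴷ (-ᴷ ev g x)
  ev-⊖ f g x = trans (cong (λ h → ev h x) (𝓛-ext λ k → trans (coef-⊖ f g k) (sym (trans (coef-⊕ f ((-ᴷ 1#) • g) k)
    (cong (coef f k +ᴷ_) (trans (coef-• _ g k) (-1*x≈-x _)))))))
        (trans (ev-⊕ f _ x) (cong (ev f x +ᴷ_) (trans (ev-• _ g x) (-1*x≈-x _))))

  zero-ext : ∀ {f} → (∀ (i : Fin n) → coef f (toℕ i) ≡ 0#) → f ≡ 0ᴸ
  zero-ext f≡0 = 𝓛-ext λ k → trans (coef-cong _ (sym (mod-≋ k))) (trans (f≡0 (k mod n)) (sym (coef-0 k)))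

  zero-not-surjective : ∀ {u} → Surjective u → u ≢ 0ᴸ
  zero-not-surjective onto refl with x , 0≡1 ← onto 1# = 1≢0 (trans (sym 0≡1) (ev-0ᴸ x))

  monomial-• : ∀ a i → a ·x^[ i ] ≡ a • x^[ i ]
  monomial-• a i = ev-injective λ y → trans (ev-monomial a i y) (sym (trans (ev-• a _ y) (cong (a *ᴷ_) (ev-x^[] i y))))

  Vanishes : Code → ℕ → Set
  Vanishes C x = ∀ {f} → f ∈ C → coef f x ≡ 0#

  Proportional : Code → ℕ → 𝔽 → ℕ → Set
  Proportional C x β y = ∀ {f} → f ∈ C → coef f x ≡ β *ᴷ coef f y

  module Shifts (C : Code) where

    shifted-vanish : ∀ x j y → Vanishes C x → x + j ≋ y → ∀ {f} → f ∈ shiftCode j C → coef f y ≡ 0#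
    shifted-vanish x j y vanish p f∈ = shift-vanish {x = x} {y} {j} vanish p f∈

    shifted-proportional : ∀ x j y x′ y′ {β} → Proportional C x β y → x + j ≋ x′ → y + j ≋ y′ → ∀ {f} → f ∈ shiftCode
        j C → coef f x′ ≡ β ^[ j ] *ᴷ coef f y′
    shifted-proportional x j y x′ y′ {β} prop p q f∈ = shift-proportional {x = x} {β} {y} {x′} {y′} {j} prop p q f∈

    module _ {u : 𝓛} where

      unshift-vanish : ∀ x m y → Vanishes C x → y + m ≋ x → shift m u ∈ C → coef u y ≡ 0#
      unshift-vanish x m y vanish p u∈ = ^[]≡0⇒≡0 m (trans (sym (coef-shift′ m u y x p)) (vanish u∈))

      unshift-proportional : ∀ x m y x′ y′ {β} → Proportional C x β y → x′ + m ≋ x → y′ + m ≋ y → shift m u ∈ C →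
        coef u x′ ^[ m ] ≡ β *ᴷ coef u y′ ^[ m ]
      unshift-proportional x m y x′ y′ {β} prop p q u∈ = trans (sym (coef-shift′ m u x′ x p))
          (trans (prop u∈) (cong (β *ᴷ_) (coef-shift′ m u y′ y q)))

      propagate : ∀ x m y x′ y′ {β} → Proportional C x β y → x′ + m ≋ x → y′ + m ≋ y → shift m u ∈ C → coef u y′ ≡ 0#
          → coef u x′ ≡ 0#
      propagate x m y x′ y′ prop p q u∈ u≡0 = ^[]≡0⇒≡0 m (proportional-0
          (unshift-proportional x m y x′ y′ prop p q u∈) (trans (cong (_^[ m ]) u≡0) (^[]-0 m)))

      propagate⁻¹ : ∀ x m y x′ y′ {β} → β ≢ 0# → Proportional C x β y → x′ + m ≋ x → y′ + m ≋ y → shift m u ∈ C →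
          coef u x′ ≡ 0# → coef u y′ ≡ 0#
      propagate⁻¹ x m y x′ y′ β≢0 prop p q u∈ u≡0 = ^[]≡0⇒≡0 m
          (proportional-0′ β≢0 (unshift-proportional x m y x′ y′ prop p q u∈) (trans (cong (_^[ m ]) u≡0) (^[]-0 m)))

  module _ {C : Code} (C-sub : IsSubspace C) {k} (p : Fin k → ℕ) (det : DeterminedBy C p) (k<n : k < n) where

    -- A zero space is determined by the empty list of positions, so h = 0 and the index is at most
    -- 1; the multiples of x attain it.
    intersectionFree-values : 1 ≤ n ∸ 1 → x^[ 0 ] ∈ C →
      (∀ j → 1 ≤ j → j ≤ n ∸ 1 → gcd j n ≡ 1 → ∀ {f} → f ∈ C → f ∈ shiftCode j C → f ≡ 0ᴸ) → ind[ C ]≡ 1 × h[ C ]≡ 0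
    intersectionFree-values 1≤n-1 x∈ free = (index-lower C-sub 1 1 x^[ 0 ] id-invertible gcd-1 ℕ.≤-refl (>-nonZero⁻¹ n)
          (λ { zero → subst C (sym (shift-x^[] 0 0)) x∈ }) ,
        λ d dim → index-upper C-sub p det k<n bound dim) , h-value bound attained
      where
      gcd-1 : gcd 1 n ≡ 1
      gcd-1 = coprime⇒gcd≡1 (1-coprimeTo n)
      no-position : Fin 0 → ℕ
      no-position ()
      bound : IntersectionBound C 0
      bound j 1≤j j≤ j-coprime = 0 , z≤n , no-position , λ f (f∈ , f∈′) _ → free j 1≤j j≤ j-coprime f∈ f∈′
      attained : IntersectionDimension C 0
      attained = 1 , ℕ.≤-refl , 1≤n-1 , gcd-1 , dual⇒hasDim (∩-subspace C-sub (shiftCode-subspace 1 C-sub)) []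
          no-position (λ ()) (λ ()) (λ { {()} })
        λ f (f∈ , f∈′) _ → free 1 ℕ.≤-refl 1≤n-1 gcd-1 f∈ f∈′

module _ {q : ℕ} (q-primePower : IsPrimePower q) (K : FiniteField (q ^ 6)) where
  open LinearizedPolynomials q 6 K
  open FieldProperties K hiding (_^ᴷ_; productᴷ)
  open FrobeniusProperties {q} {6} q-primePower K
  open LinearizedAlgebra {q} {6} q-primePower K
  open GabidulinCodes {q} {6} q-primePower K
  open CodeFamilies {q} {6} q-primePower K
  open SparseCodes {q} {6} q-primePower K
  open IsSubspace

  module _ (δ : 𝔽) where
    private
      b : Vector 𝓛 2
      b = x^[ 0 ] ∷ δ ·x^[ 1 ] ⊕ x^[ 4 ] ∷ []
      C : Code
      C = ⟨ b ⟩
      open Shifts C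
      vanish : ∀ k → ¬ k % 6 ≡ 0 → ¬ k % 6 ≡ 1 → ¬ k % 6 ≡ 4 → Vanishes C k
      vanish k k≢0 k≢1 k≢4 = ⟨⟩-vanish b k λ { 0F → off 0 k k≢0 ; 1F → coef-⊕ˡ (off 1 k k≢1) (off 4 k k≢4) }
      v2 : Vanishes C 2
      v2 = vanish 2 (λ ()) (λ ()) (λ ())
      v3 : Vanishes C 3
      v3 = vanish 3 (λ ()) (λ ()) (λ ())
      v5 : Vanishes C 5
      v5 = vanish 5 (λ ()) (λ ()) (λ ())
      r14 : Proportional C 1 δ 4
      r14 = ⟨⟩⊆ (proportional-subspace 1 δ 4) {b = b} λ
        { 0F → both-0 (off 0 1 λ ()) (off 0 4 λ ())
        ; 1F → ratio (coef-⊕ˡ (on 1 1 refl) (off 4 1 λ ())) (coef-⊕ʳ (off 1 4 λ ()) (on 4 4 refl)) }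
      det : DeterminedBy C (0 ∷ 4 ∷ [])
      det f f∈ z = zero-ext λ { 0F → z 0F ; 1F → proportional-0 (r14 f∈) (z 1F) ; 2F → v2 f∈ ; 3F → v3 f∈ ; 4F → z 1F
          ; 5F → v5 f∈ }
      -- The support {0, 1, 4} meets its shift {1, 2, 5} only in 1, where the coefficient is δ times
      -- the vanishing one at 4. It meets the shift {5, 0, 3} only in 0, where the shifted relation
      -- refers to the vanishing coefficient at 3.
      free : ∀ j → 1 ≤ j → j ≤ 5 → gcd j 6 ≡ 1 → ∀ {f} → f ∈ C → f ∈ shiftCode j C → f ≡ 0ᴸ
      free 1 _ _ _ f∈ f∈′ = zero-ext λ
        { 0F → shifted-vanish 5 1 0 v5 refl f∈′ ; 1F → proportional-0 (r14 f∈) (shifted-vanish 3 1 4 v3 refl f∈′) ;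
            2F → v2 f∈
        ; 3F → v3 f∈ ; 4F → shifted-vanish 3 1 4 v3 refl f∈′ ; 5F → v5 f∈ }
      free 5 _ _ _ f∈ f∈′ = zero-ext λ
        { 0F → proportional-0 (shifted-proportional 1 5 4 0 3 r14 refl refl f∈′) (v3 f∈) ; 1F → shifted-vanish 2 5 1
            v2 refl f∈′ ; 2F → v2 f∈
        ; 3F → v3 f∈ ; 4F → shifted-vanish 5 5 4 v5 refl f∈′ ; 5F → v5 f∈ }
      free 0 ()
      free 2 _ _ ()
      free 3 _ _ ()
      free 4 _ _ ()
      free (suc (suc (suc (suc (suc (suc _)))))) _ (s≤s (s≤s (s≤s (s≤s (s≤s ()))))) _

      values : ind[ C ]≡ 1 × h[ C ]≡ 0
      values = intersectionFree-values (⟨⟩-subspace b) (0 ∷ 4 ∷ []) det (ℕ.m≤m+n 3 3) (ℕ.m≤m+n 1 4) (∈⟨⟩ b 0F) free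

    𝒞₁-values : ind[ 𝒞₁ δ ]≡ 1 × h[ 𝒞₁ δ ]≡ 0
    𝒞₁-values = values
  module _ (δ : 𝔽) where
    private
      b : Vector 𝓛 2
      b = x^[ 0 ] ∷ x^[ 1 ] ⊕ x^[ 3 ] ⊕ δ ·x^[ 5 ] ∷ []
      C : Code
      C = ⟨ b ⟩
      open Shifts C
      vanish : ∀ k → ¬ k % 6 ≡ 0 → ¬ k % 6 ≡ 1 → ¬ k % 6 ≡ 3 → ¬ k % 6 ≡ 5 → Vanishes C k
      vanish k k≢0 k≢1 k≢3 k≢5 = ⟨⟩-vanish b k λ { 0F → off 0 k k≢0 ; 1F → coef-⊕ˡ
          (coef-⊕ˡ (off 1 k k≢1) (off 3 k k≢3)) (off 5 k k≢5) }
      v2 : Vanishes C 2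
      v2 = vanish 2 (λ ()) (λ ()) (λ ()) (λ ())
      v4 : Vanishes C 4
      v4 = vanish 4 (λ ()) (λ ()) (λ ()) (λ ())
      r31 : Proportional C 3 1# 1
      r31 = ⟨⟩⊆ (proportional-subspace 3 1# 1) {b = b} λ
        { 0F → both-0 (off 0 3 λ ()) (off 0 1 λ ())
        ; 1F → ratio (coef-⊕ˡ (coef-⊕ʳ (off 1 3 λ ()) (on 3 3 refl)) (off 5 3 λ ()))
            (coef-⊕ˡ (coef-⊕ˡ (on 1 1 refl) (off 3 1 λ ())) (off 5 1 λ ())) }
      r51 : Proportional C 5 δ 1
      r51 = ⟨⟩⊆ (proportional-subspace 5 δ 1) {b = b} λ
        { 0F → both-0 (off 0 5 λ ()) (off 0 1 λ ())
        ; 1F → ratio (coef-⊕ʳ (coef-⊕ˡ (off 1 5 λ ()) (off 3 5 λ ())) (on 5 5 refl))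
            (coef-⊕ˡ (coef-⊕ˡ (on 1 1 refl) (off 3 1 λ ())) (off 5 1 λ ())) }
      det : DeterminedBy C (0 ∷ 1 ∷ [])
      det f f∈ z = zero-ext λ { 0F → z 0F ; 1F → z 1F ; 2F → v2 f∈ ; 3F → proportional-0 (r31 f∈) (z 1F) ; 4F → v4 f∈
          ; 5F → proportional-0 (r51 f∈) (z 1F) }
      -- C vanishes at 2 and 4 and its shift at j + 2 and j + 4, so for odd j only 0 and j remain.
      -- The coefficients of C at odd positions are tied together, as are those of the shift at even
      -- ones, and each group contains a zero that kills the remaining coefficient.
      free : ∀ j → 1 ≤ j → j ≤ 5 → gcd j 6 ≡ 1 → ∀ {f} → f ∈ C → f ∈ shiftCode j C → f ≡ 0ᴸ
      free 1 _ _ _ f∈ f∈′ = zero-ext λ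
        { 0F → proportional-0 (shifted-proportional 5 1 1 0 2 r51 refl refl f∈′) (v2 f∈)
        ; 1F → proportional-0′ 1≢0 (r31 f∈) (shifted-vanish 2 1 3 v2 refl f∈′) ; 2F → v2 f∈
        ; 3F → shifted-vanish 2 1 3 v2 refl f∈′ ; 4F → v4 f∈ ; 5F → shifted-vanish 4 1 5 v4 refl f∈′ }
      free 5 _ _ _ f∈ f∈′ = zero-ext λ
        { 0F → proportional-0′ (^[]≢0 5 1≢0) (shifted-proportional 3 5 1 2 0 r31 refl refl f∈′) (v2 f∈)
        ; 1F → shifted-vanish 2 5 1 v2 refl f∈′ ; 2F → v2 f∈ ; 3F → shifted-vanish 4 5 3 v4 refl f∈′ ; 4F → v4 f∈
        ; 5F → proportional-0 (r51 f∈) (shifted-vanish 2 5 1 v2 refl f∈′) }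
      free 0 ()
      free 2 _ _ ()
      free 3 _ _ ()
      free 4 _ _ ()
      free (suc (suc (suc (suc (suc (suc _)))))) _ (s≤s (s≤s (s≤s (s≤s (s≤s ()))))) _

      values : ind[ C ]≡ 1 × h[ C ]≡ 0
      values = intersectionFree-values (⟨⟩-subspace b) (0 ∷ 1 ∷ []) det (ℕ.m≤m+n 3 3) (ℕ.m≤m+n 1 4) (∈⟨⟩ b 0F) free

    𝒞₂-values : ind[ 𝒞₂ δ ]≡ 1 × h[ 𝒞₂ δ ]≡ 0
    𝒞₂-values = values

module _ {q : ℕ} (q-primePower : IsPrimePower q) (K : FiniteField (q ^ 8)) where
  open LinearizedPolynomials q 8 K
  open FieldProperties K hiding (_^ᴷ_; productᴷ)
  open FrobeniusProperties {q} {8} q-primePower K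
  open LinearizedAlgebra {q} {8} q-primePower K
  open GabidulinCodes {q} {8} q-primePower K
  open CodeFamilies {q} {8} q-primePower K
  open SparseCodes {q} {8} q-primePower K
  open IsSubspace

  module _ (δ : 𝔽) (δ≢0 : δ ≢ 0#) where
    private
      b : Vector 𝓛 2
      b = x^[ 0 ] ∷ δ ·x^[ 1 ] ⊕ x^[ 5 ] ∷ []
      C : Code
      C = ⟨ b ⟩
      open Shifts C
      vanish : ∀ k → ¬ k % 8 ≡ 0 → ¬ k % 8 ≡ 1 → ¬ k % 8 ≡ 5 → Vanishes C k
      vanish k k≢0 k≢1 k≢5 = ⟨⟩-vanish b k λ { 0F → off 0 k k≢0 ; 1F → coef-⊕ˡ (off 1 k k≢1) (off 5 k k≢5) }
      v2 : Vanishes C 2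
      v2 = vanish 2 (λ ()) (λ ()) (λ ())
      v3 : Vanishes C 3
      v3 = vanish 3 (λ ()) (λ ()) (λ ())
      v4 : Vanishes C 4
      v4 = vanish 4 (λ ()) (λ ()) (λ ())
      v6 : Vanishes C 6
      v6 = vanish 6 (λ ()) (λ ()) (λ ())
      v7 : Vanishes C 7
      v7 = vanish 7 (λ ()) (λ ()) (λ ())
      r15 : Proportional C 1 δ 5
      r15 = ⟨⟩⊆ (proportional-subspace 1 δ 5) {b = b} λ
        { 0F → both-0 (off 0 1 λ ()) (off 0 5 λ ())
        ; 1F → ratio (coef-⊕ˡ (on 1 1 refl) (off 5 1 λ ())) (coef-⊕ʳ (off 1 5 λ ()) (on 5 5 refl)) }
      det : DeterminedBy C (0 ∷ 5 ∷ [])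
      det f f∈ z = zero-ext λ
        { 0F → z 0F ; 1F → proportional-0 (r15 f∈) (z 1F) ; 2F → v2 f∈ ; 3F → v3 f∈ ; 4F → v4 f∈ ; 5F → z 1F
        ; 6F → v6 f∈ ; 7F → v7 f∈ }
      -- The support {0, 1, 5} meets its shift in a single position, namely 1, 0, 5, 0 for j = 1, 3,
      -- 5, 7. There the relation between 1 and 5, or its shift, ties the coefficient to a vanishing
      -- one; j = 3 and j = 5 divide by a power of δ.
      free : ∀ j → 1 ≤ j → j ≤ 7 → gcd j 8 ≡ 1 → ∀ {f} → f ∈ C → f ∈ shiftCode j C → f ≡ 0ᴸ
      free 1 _ _ _ f∈ f∈′ = zero-ext λ
        { 0F → shifted-vanish 7 1 0 v7 refl f∈′ ; 1F → proportional-0 (r15 f∈) (shifted-vanish 4 1 5 v4 refl f∈′)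
        ; 2F → v2 f∈ ; 3F → v3 f∈ ; 4F → v4 f∈ ; 5F → shifted-vanish 4 1 5 v4 refl f∈′ ; 6F → v6 f∈ ; 7F → v7 f∈ }
      free 3 _ _ _ f∈ f∈′ = zero-ext λ
        { 0F → proportional-0′ (^[]≢0 3 δ≢0) (shifted-proportional 1 3 5 4 0 r15 refl refl f∈′) (v4 f∈)
        ; 1F → shifted-vanish 6 3 1 v6 refl f∈′ ; 2F → v2 f∈ ; 3F → v3 f∈ ; 4F → v4 f∈
        ; 5F → shifted-vanish 2 3 5 v2 refl f∈′ ; 6F → v6 f∈ ; 7F → v7 f∈ }
      free 5 _ _ _ f∈ f∈′ = zero-ext λ
        { 0F → shifted-vanish 3 5 0 v3 refl f∈′ ; 1F → shifted-vanish 4 5 1 v4 refl f∈′ ; 2F → v2 f∈ ; 3F → v3 f∈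
        ; 4F → v4 f∈ ; 5F → proportional-0′ δ≢0 (r15 f∈) (shifted-vanish 4 5 1 v4 refl f∈′) ; 6F → v6 f∈
        ; 7F → v7 f∈ }
      free 7 _ _ _ f∈ f∈′ = zero-ext λ
        { 0F → proportional-0 (shifted-proportional 1 7 5 0 4 r15 refl refl f∈′) (v4 f∈)
        ; 1F → shifted-vanish 2 7 1 v2 refl f∈′ ; 2F → v2 f∈ ; 3F → v3 f∈ ; 4F → v4 f∈
        ; 5F → shifted-vanish 6 7 5 v6 refl f∈′ ; 6F → v6 f∈ ; 7F → v7 f∈ }
      free 0 ()
      free 2 _ _ ()
      free 4 _ _ ()
      free 6 _ _ ()
      free (suc (suc (suc (suc (suc (suc (suc (suc _)))))))) _ (s≤s (s≤s (s≤s (s≤s (s≤s (s≤s (s≤s ()))))))) _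

      values : ind[ C ]≡ 1 × h[ C ]≡ 0
      values = intersectionFree-values (⟨⟩-subspace b) (0 ∷ 5 ∷ []) det (ℕ.m≤m+n 3 5) (ℕ.m≤m+n 1 6) (∈⟨⟩ b 0F) free

    𝒞₄-values : ind[ 𝒞₄ δ ]≡ 1 × h[ 𝒞₄ δ ]≡ 0
    𝒞₄-values = values

-- The codes 𝒟₁, 𝒟₂ and 𝒟₄

module Exclusion {q n : ℕ} .{{_ : NonZero n}} (q-primePower : IsPrimePower q) (K : FiniteField (q ^ n)) where
  open LinearizedPolynomials q n K
  open LinearizedAlgebra q-primePower K
  open GabidulinCodes q-primePower K
  open IndexCriteria q-primePower K
  open Congruence n

  -- The forbidden chain u, u^{[s]}, ..., u^{[sm]} has m + 1 members. Restricting s to residues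
  -- leaves finitely many cases.
  NoChain : Code → ℕ → Set
  NoChain C m = ∀ s → s < n → gcd s n ≡ 1 → ∀ {u} → Surjective u → ¬ (∀ j → j ≤ m → shift (s * j) u ∈ C)

  -- For 𝒟₁, 𝒟₂ and 𝒟₄ the bound h + 1 exceeds the index, so the generator is confronted with all
  -- shifts in its chain at once instead of with pairs of neighbours.
  index-upper-by-chains : ∀ {C k m d} (p : Fin k → ℕ) → DeterminedBy C p → k < n → NoChain C m → GabidulinDimension C
      d → d ≤ m
  index-upper-by-chains {C} {m = m} p det k<n no-chain dim =
    let l , s , u , d≤l , _ , _ , g , onto , shift∈ = gabidulin-generator p det k<n dim in
    ℕ.≮⇒≥ λ m<d → no-chain (s % n) (m%n<n s n) (coprime-≋ (sym (%-≋ s)) g) onto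
      λ j j≤m → subst C (shift-cong u (≋-*ʳ j (sym (%-≋ s)))) (shift∈ j (ℕ.≤-trans (s≤s j≤m) (ℕ.≤-trans m<d d≤l)))

module _ {q : ℕ} (q-primePower : IsPrimePower q) (K : FiniteField (q ^ 6)) where
  open LinearizedPolynomials q 6 K
  open FieldProperties K hiding (_^ᴷ_; productᴷ)
  open FrobeniusProperties {q} {6} q-primePower K
  open LinearizedAlgebra {q} {6} q-primePower K
  open GabidulinCodes {q} {6} q-primePower K
  open IndexCriteria {q} {6} q-primePower K
  open CodeFamilies {q} {6} q-primePower K
  open SparseCodes {q} {6} q-primePower K
  open IsSubspace

  open Exclusion {q} {6} q-primePower K

  module _ (δ : 𝔽) (δ≢0 : δ ≢ 0#) where
    private
      ε : 𝔽
      ε = δ ^[ 5 ]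
      b : Vector 𝓛 4
      b = x^[ 1 ] ∷ x^[ 2 ] ∷ x^[ 4 ] ∷ x^[ 0 ] ⊖ ε ·x^[ 3 ] ∷ []
      C : Code
      C = ⟨ b ⟩
      C-sub : IsSubspace C
      C-sub = ⟨⟩-subspace b
      open Shifts C
      -ε≢0 : -ᴷ ε ≢ 0#
      -ε≢0 p = ^[]≢0 5 δ≢0 (trans (sym (-‿involutive ε)) (trans (cong -ᴷ_ p) -0#≈0#))
      v5 : Vanishes C 5
      v5 = ⟨⟩-vanish b 5 λ { 0F → off 1 5 λ () ; 1F → off 2 5 λ () ; 2F → off 4 5 λ () ; 3F → trans
          (coef-⊖ʳ (off 0 5 λ ()) (off 3 5 λ ())) -0#≈0# }
      r30 : Proportional C 3 (-ᴷ ε) 0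
      r30 = ⟨⟩⊆ (proportional-subspace 3 (-ᴷ ε) 0) {b = b} λ
        { 0F → both-0 (off 1 3 λ ()) (off 1 0 λ ()) ; 1F → both-0 (off 2 3 λ ()) (off 2 0 λ ()) ; 2F → both-0
            (off 4 3 λ ()) (off 4 0 λ ())
        ; 3F → ratio (coef-⊖ʳ (off 0 3 λ ()) (on 3 3 refl)) (coef-⊖ˡ (on 0 0 refl) (off 3 0 λ ())) }
      det : DeterminedBy C (0 ∷ 1 ∷ 2 ∷ 4 ∷ [])
      det f f∈ z = zero-ext λ { 0F → z 0F ; 1F → z 1F ; 2F → z 2F ; 3F → proportional-0 (r30 f∈) (z 0F) ; 4F → z 3F ;
          5F → v5 f∈ }
      det₁ : DeterminedBy (C ∩ shiftCode 1 C) (1 ∷ 2 ∷ [])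
      det₁ f (f∈ , f∈′) z = zero-ext λ
        { 0F → shifted-vanish 5 1 0 v5 refl f∈′ ; 1F → z 0F ; 2F → z 1F
        ; 3F → proportional-0 (r30 f∈) (shifted-vanish 5 1 0 v5 refl f∈′)
        ; 4F → proportional-0 (shifted-proportional 3 1 0 4 1 r30 refl refl f∈′) (z 0F) ; 5F → v5 f∈ }
      det₅ : DeterminedBy (C ∩ shiftCode 5 C) (0 ∷ 1 ∷ [])
      det₅ f (f∈ , f∈′) z = zero-ext λ
        { 0F → z 0F ; 1F → z 1F ; 2F → proportional-0 (shifted-proportional 3 5 0 2 5 r30 refl refl f∈′) (v5 f∈)
        ; 3F → proportional-0 (r30 f∈) (z 0F) ; 4F → shifted-vanish 5 5 4 v5 refl f∈′ ; 5F → v5 f∈ }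
      bound : IntersectionBound C 2
      bound 1 _ _ _ = 2 , ℕ.≤-refl , 1 ∷ 2 ∷ [] , det₁
      bound 5 _ _ _ = 2 , ℕ.≤-refl , 0 ∷ 1 ∷ [] , det₅
      bound 0 ()
      bound 2 _ _ ()
      bound 3 _ _ ()
      bound 4 _ _ ()
      bound (suc (suc (suc (suc (suc (suc _)))))) _ (s≤s (s≤s (s≤s (s≤s (s≤s ()))))) _

      -- The shift by 5 matches the exponent in ε = δ^{[5]}: it carries x^{[1]} - δ x^{[4]}, an
      -- element of C, to x - ε x^{[3]}.
      b′ : Vector 𝓛 2
      b′ = x^[ 0 ] ⊖ ε ·x^[ 3 ] ∷ x^[ 1 ] ∷ []
      b′∈ : ∀ i → b′ i ∈ C ∩ shiftCode 5 C
      b′∈ 0F = ∈⟨⟩ b 3F , x^[ 1 ] ⊖ δ ·x^[ 4 ] , ⊖∈ C-sub (∈⟨⟩ b 0F)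
          (subst C (sym (monomial-• δ 4)) (•∈ C-sub δ (∈⟨⟩ b 2F))) ,
        sym (trans (shift-⊖ 5 x^[ 1 ] (δ ·x^[ 4 ])) (cong₂ _⊖_ (shift-x^[] 5 1) (shift-monomial 5 δ 4)))
      b′∈ 1F = ∈⟨⟩ b 0F , x^[ 2 ] , ∈⟨⟩ b 1F , sym (shift-x^[] 5 2)
      attained : IntersectionDimension C 2
      attained = 5 , ℕ.m≤m+n 1 4 , ℕ.≤-refl , refl , dual⇒hasDim (∩-subspace C-sub (shiftCode-subspace 5 C-sub)) b′
          (0 ∷ 1 ∷ []) b′∈
        (λ { 0F → coef-⊖ˡ (on 0 0 refl) (off 3 0 λ ()) ; 1F → on 1 1 refl })
        (λ { {0F} {0F} i≢i → contradiction refl i≢i ; {0F} {1F} _ → trans (coef-⊖ʳ (off 0 1 λ ()) (off 3 1 λ ())) -0#≈0#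
           ; {1F} {0F} _ → off 1 0 λ () ; {1F} {1F} i≢i → contradiction refl i≢i })
        det₅

      -- Each of the three members gives one zero of u and one proportionality between two opposite
      -- positions i and i + 3. The three zeros lie in the three different opposite pairs, so all
      -- six coefficients vanish.
      chain : NoChain C 2
      chain 1 _ _ onto u∈ =
        let u₅ = unshift-vanish 5 0 5 v5 refl (u∈ 0 z≤n)
            u₄ = unshift-vanish 5 1 4 v5 refl (u∈ 1 (s≤s z≤n))
            u₃ = unshift-vanish 5 2 3 v5 refl (u∈ 2 (s≤s (s≤s z≤n)))
            u₀ = propagate⁻¹ 3 0 0 3 0 -ε≢0 r30 refl refl (u∈ 0 z≤n) u₃
            u₂ = propagate 3 1 0 2 5 r30 refl refl (u∈ 1 (s≤s z≤n)) u₅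
            u₁ = propagate 3 2 0 1 4 r30 refl refl (u∈ 2 (s≤s (s≤s z≤n))) u₄
        in zero-not-surjective onto (zero-ext λ { 0F → u₀ ; 1F → u₁ ; 2F → u₂ ; 3F → u₃ ; 4F → u₄ ; 5F → u₅ })
      chain 5 _ _ onto u∈ =
        let u₅ = unshift-vanish 5 0 5 v5 refl (u∈ 0 z≤n)
            u₀ = unshift-vanish 5 5 0 v5 refl (u∈ 1 (s≤s z≤n))
            u₁ = unshift-vanish 5 10 1 v5 refl (u∈ 2 (s≤s (s≤s z≤n)))
            u₃ = propagate 3 0 0 3 0 r30 refl refl (u∈ 0 z≤n) u₀
            u₄ = propagate 3 5 0 4 1 r30 refl refl (u∈ 1 (s≤s z≤n)) u₁
            u₂ = propagate⁻¹ 3 10 0 5 2 -ε≢0 r30 refl refl (u∈ 2 (s≤s (s≤s z≤n))) u₅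
        in zero-not-surjective onto (zero-ext λ { 0F → u₀ ; 1F → u₁ ; 2F → u₂ ; 3F → u₃ ; 4F → u₄ ; 5F → u₅ })
      chain 0 _ ()
      chain 2 _ ()
      chain 3 _ ()
      chain 4 _ ()
      chain (suc (suc (suc (suc (suc (suc _)))))) (s≤s (s≤s (s≤s (s≤s (s≤s (s≤s ())))))) _

      shift∈ : ∀ (i : Fin 2) → shift (1 * toℕ i) x^[ 1 ] ∈ C
      shift∈ 0F = subst C (sym (shift-x^[] 0 1)) (∈⟨⟩ b 0F)
      shift∈ 1F = subst C (sym (shift-x^[] 1 1)) (∈⟨⟩ b 1F)

      values : ind[ C ]≡ 2 × h[ C ]≡ 2
      values = (index-lower C-sub 2 1 x^[ 1 ] (x^[]-invertible 1) refl (ℕ.m≤m+n 1 1) (ℕ.m≤m+n 2 4) shift∈ ,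
        λ d dim → index-upper-by-chains (0 ∷ 1 ∷ 2 ∷ 4 ∷ []) det (ℕ.m≤m+n 5 1) chain dim) , h-value bound attained

    𝒟₁-values : ind[ 𝒟₁ δ ]≡ 2 × h[ 𝒟₁ δ ]≡ 2
    𝒟₁-values = values

  module _ (q-odd : q % 2 ≡ 1) (δ : 𝔽) (δ∈𝔽q : δ ∈ 𝔽q) (δ²+δ≡1 : δ ^ᴷ 2 +ᴷ δ ≡ 1#) where
    private
      -- If 1 + 1 = 0, every odd multiple of 1 is 1, in particular q^6 · 1, which is 0.
      1+1≢0 : 1# +ᴷ 1# ≢ 0#
      1+1≢0 1+1≡0 = 1≢0 (trans (sym (odd×1 (q ^ 6) (odd-^ 6))) m×1≡0)
        where
        odd-^ : ∀ k → (q ^ k) % 2 ≡ 1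
        odd-^ zero = refl
        odd-^ (suc k) = trans (%-distribˡ-* q (q ^ k) 2) (cong₂ (λ a b → (a * b) % 2) q-odd (odd-^ k))
        odd×1 : ∀ N → N % 2 ≡ 1 → N ×ᴷ 1# ≡ 1#
        odd×1 1 _ = +-identityʳ 1#
        odd×1 (suc (suc N)) p = trans (sym (+-assoc 1# 1# _))
            (trans (cong (_+ᴷ N ×ᴷ 1#) 1+1≡0) (trans (+-identityˡ _) (odd×1 N p)))

      δδ+δ≡1 : δ *ᴷ δ +ᴷ δ ≡ 1#
      δδ+δ≡1 = trans (cong (λ z → δ *ᴷ z +ᴷ δ) (sym (*-identityʳ δ))) δ²+δ≡1

      1≢δ : 1# ≢ δ
      1≢δ 1≡δ = 1≢0 (+-cancelˡ 1# _ _ (trans (cong₂ _+ᴷ_ (sym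
          (trans (cong₂ _*ᴷ_ (sym 1≡δ) (sym 1≡δ)) (*-identityˡ 1#))) 1≡δ) (trans δδ+δ≡1 (sym (+-identityʳ 1#)))))

      δ^[] : ∀ j → δ ^[ j ] ≡ δ
      δ^[] = ∈𝔽q⇒^[] δ∈𝔽q

      -- If δ³ = 1, then 2 = 1 + δ² + δ = δ³ + δ² + δ = δ(δ² + δ) + δ = 2δ, so δ = 1 in odd
      -- characteristic.
      δ³≢1 : δ *ᴷ (δ *ᴷ δ) ≢ 1#
      δ³≢1 δ³≡1 = 1≢δ (*-cancelˡ (1# +ᴷ 1#) 1+1≢0 (begin
        (1# +ᴷ 1#) *ᴷ 1#  ≡⟨ *-identityʳ _ ⟩
        1# +ᴷ 1#  ≡⟨ cong (1# +ᴷ_) δδ+δ≡1 ⟨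
        1# +ᴷ (δ *ᴷ δ +ᴷ δ)  ≡⟨ +-assoc 1# _ δ ⟨
        1# +ᴷ δ *ᴷ δ +ᴷ δ  ≡⟨ cong (λ z → z +ᴷ δ *ᴷ δ +ᴷ δ) δ³≡1 ⟨
        δ *ᴷ (δ *ᴷ δ) +ᴷ δ *ᴷ δ +ᴷ δ  ≡⟨ cong (_+ᴷ δ) (distribˡ δ _ δ) ⟨
        δ *ᴷ (δ *ᴷ δ +ᴷ δ) +ᴷ δ  ≡⟨ cong (_+ᴷ δ) (trans (cong (δ *ᴷ_) δδ+δ≡1) (*-identityʳ δ)) ⟩
        δ +ᴷ δ  ≡⟨ cong₂ _+ᴷ_ (*-identityˡ δ) (*-identityˡ δ) ⟨
        1# *ᴷ δ +ᴷ 1# *ᴷ δ  ≡⟨ distribʳ δ 1# 1# ⟨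
        (1# +ᴷ 1#) *ᴷ δ                  ∎))
        where open ≡-Reasoning

      eliminate : ∀ {a b} → a +ᴷ b ≡ 0# → a +ᴷ δ *ᴷ b ≡ 0# → b ≡ 0#
      eliminate {a} {b} p q with b ≟ 0#
      ... | yes b≡0 = b≡0
      ... | no b≢0 = contradiction (*-cancelˡ b b≢0 (trans (*-identityʳ b)
          (trans (+-cancelˡ a _ _ (trans p (sym q))) (*-comm δ b)))) 1≢δ

      open Congruence 6 using (_≋_)
      -- The code is cut out by a zero at 5 and by `balance f 0 2 4` = 0. Since δ ∈ 𝔽_q, the second
      -- relation keeps its shape under shifts.
      balance : 𝓛 → ℕ → ℕ → ℕ → 𝔽
      balance f x y z = coef f x +ᴷ coef f y +ᴷ δ *ᴷ coef f z

      balance-cong : ∀ {a b c a′ b′ c′} → a ≡ a′ → b ≡ b′ → c ≡ c′ → a +ᴷ b +ᴷ δ *ᴷ c ≡ a′ +ᴷ b′ +ᴷ δ *ᴷ c′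
      balance-cong refl refl refl = refl

      first-0 : ∀ {a b c} → a +ᴷ b +ᴷ δ *ᴷ c ≡ 0# → b ≡ 0# → c ≡ 0# → a ≡ 0#
      first-0 p refl refl = trans (sym (trans (cong₂ _+ᴷ_ (+-identityʳ _) (zeroʳ δ)) (+-identityʳ _))) p

      second-0 : ∀ {a b c} → a +ᴷ b +ᴷ δ *ᴷ c ≡ 0# → a ≡ 0# → c ≡ 0# → b ≡ 0#
      second-0 p refl refl = trans (sym (trans (cong₂ _+ᴷ_ (+-identityˡ _) (zeroʳ δ)) (+-identityʳ _))) p

      drop-first : ∀ {a b c} → a +ᴷ b +ᴷ δ *ᴷ c ≡ 0# → a ≡ 0# → b +ᴷ δ *ᴷ c ≡ 0#
      drop-first p refl = trans (cong (_+ᴷ δ *ᴷ _) (sym (+-identityˡ _))) p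

      drop-third : ∀ {a b c} → a +ᴷ b +ᴷ δ *ᴷ c ≡ 0# → c ≡ 0# → a +ᴷ b ≡ 0#
      drop-third p refl = trans (sym (trans (cong (_ +ᴷ_) (zeroʳ δ)) (+-identityʳ _))) p

      balance-^[] : ∀ f g j {x y z x′ y′ z′} → coef f x ≡ coef g x′ ^[ j ] → coef f y ≡ coef g y′ ^[ j ] → coef f z ≡
          coef g z′ ^[ j ] →
        balance f x y z ≡ balance g x′ y′ z′ ^[ j ]
      balance-^[] f g j {x′ = x′} {y′} {z′} p p′ p″ = trans (balance-cong p p′ p″)
          (sym (trans (^[]-+ _ _ j) (cong₂ _+ᴷ_ (^[]-+ _ _ j)
        (trans (^[]-* _ _ j) (cong (_*ᴷ coef g z′ ^[ j ]) (δ^[] j))))))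

      b : Vector 𝓛 4
      b = x^[ 1 ] ∷ x^[ 3 ] ∷ x^[ 0 ] ⊖ x^[ 2 ] ∷ x^[ 4 ] ⊖ δ ·x^[ 0 ] ∷ []
      C : Code
      C = ⟨ b ⟩
      C-sub : IsSubspace C
      C-sub = ⟨⟩-subspace b
      open Shifts C

      balance-0 : ∀ {f x y z} → coef f x ≡ 0# → coef f y ≡ 0# → coef f z ≡ 0# → balance f x y z ≡ 0#
      balance-0 p p′ p″ = trans (balance-cong p p′ p″) (trans (cong₂ _+ᴷ_ (+-identityˡ 0#) (zeroʳ δ)) (+-identityˡ 0#))

      balance-subspace : ∀ x y z → IsSubspace (λ f → balance f x y z ≡ 0#)
      balance-subspace x y z .0∈ = balance-0 (coef-0 x) (coef-0 y) (coef-0 z)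
      balance-subspace x y z .⊕∈ {f} {g} p p′ = begin
        balance (f ⊕ g) x y z  ≡⟨ balance-cong (coef-⊕ f g x) (coef-⊕ f g y) (coef-⊕ f g z) ⟩
        (coef f x +ᴷ coef g x) +ᴷ (coef f y +ᴷ coef g y) +ᴷ δ *ᴷ (coef f z +ᴷ coef g z) ≡⟨ cong₂ _+ᴷ_
            (+-interchange _ _ _ _) (distribˡ δ _ _) ⟩
        (coef f x +ᴷ coef f y) +ᴷ (coef g x +ᴷ coef g y) +ᴷ (δ *ᴷ coef f z +ᴷ δ *ᴷ coef g z) ≡⟨ +-interchange _ _ _ _ ⟩
        balance f x y z +ᴷ balance g x y z  ≡⟨ trans (cong₂ _+ᴷ_ p p′) (+-identityˡ 0#) ⟩
        0#                                                                              ∎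
        where open ≡-Reasoning
      balance-subspace x y z .•∈ a {f} p = begin
        balance (a • f) x y z  ≡⟨ balance-cong (coef-• a f x) (coef-• a f y) (coef-• a f z) ⟩
        a *ᴷ coef f x +ᴷ a *ᴷ coef f y +ᴷ δ *ᴷ (a *ᴷ coef f z)  ≡⟨ cong₂ _+ᴷ_ (sym (distribˡ a _ _))
            (trans (sym (*-assoc δ a _)) (trans (cong (_*ᴷ coef f z) (*-comm δ a)) (*-assoc a δ _))) ⟩
        a *ᴷ (coef f x +ᴷ coef f y) +ᴷ a *ᴷ (δ *ᴷ coef f z)  ≡⟨ distribˡ a _ _ ⟨
        a *ᴷ balance f x y z  ≡⟨ trans (cong (a *ᴷ_) p) (zeroʳ a) ⟩
        0#                                                                ∎
        where open ≡-Reasoning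

      v5 : Vanishes C 5
      v5 = ⟨⟩-vanish b 5 λ { 0F → off 1 5 λ () ; 1F → off 3 5 λ () ; 2F → trans
          (coef-⊖ʳ (off 0 5 λ ()) (off 2 5 λ ())) -0#≈0#
        ; 3F → trans (coef-⊖ʳ (off 4 5 λ ()) (off 0 5 λ ())) -0#≈0# }

      balanced : ∀ {f} → f ∈ C → balance f 0 2 4 ≡ 0#
      balanced = ⟨⟩⊆ (balance-subspace 0 2 4) {b = b} λ
        { 0F → balance-0 (off 1 0 λ ()) (off 1 2 λ ()) (off 1 4 λ ())
        ; 1F → balance-0 (off 3 0 λ ()) (off 3 2 λ ()) (off 3 4 λ ())
        ; 2F → trans (balance-cong (coef-⊖ˡ (on 0 0 refl) (off 2 0 λ ())) (coef-⊖ʳ (off 0 2 λ ()) (on 2 2 refl))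
            (trans (coef-⊖ʳ (off 0 4 λ ()) (off 2 4 λ ())) -0#≈0#))
            (trans (cong₂ _+ᴷ_ (-‿inverseʳ 1#) (zeroʳ δ)) (+-identityˡ 0#))
        ; 3F → trans (balance-cong (coef-⊖ʳ (off 4 0 λ ()) (on 0 0 refl))
            (trans (coef-⊖ʳ (off 4 2 λ ()) (off 0 2 λ ())) -0#≈0#) (coef-⊖ˡ (on 4 4 refl) (off 0 4 λ ())))
            (trans (cong₂ _+ᴷ_ (+-identityʳ _) (*-identityʳ δ)) (-‿inverseˡ δ)) }

      shifted-balanced : ∀ j x y z → 0 + j ≋ x → 2 + j ≋ y → 4 + j ≋ z → ∀ {f} → f ∈ shiftCode j C → balance f x y z ≡ 0#
      shifted-balanced j x y z p p′ p″ {f} (g , g∈ , f≡) = trans (balance-^[] f g j (at p) (at p′) (at p″))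
          (trans (cong (_^[ j ]) (balanced g∈)) (^[]-0 j))
        where
        at : ∀ {i k} → i + j ≋ k → coef f k ≡ coef g i ^[ j ]
        at {i} {k} i+j≋k = trans (cong (λ h → coef h k) f≡) (coef-shift′ j g i k i+j≋k)

      unshift-balanced : ∀ m x y z → x + m ≋ 0 → y + m ≋ 2 → z + m ≋ 4 → ∀ {u} → shift m u ∈ C → balance u x y z ≡ 0#
      unshift-balanced m x y z p p′ p″ {u} u∈ = ^[]≡0⇒≡0 m (trans (sym (balance-^[] (shift m u) u m {0} {2} {4} {x} {y} {z}
        (coef-shift′ m u x 0 p) (coef-shift′ m u y 2 p′) (coef-shift′ m u z 4 p″))) (balanced u∈))

      det : DeterminedBy C (1 ∷ 2 ∷ 3 ∷ 4 ∷ [])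
      det f f∈ z = zero-ext λ { 0F → first-0 (balanced f∈) (z 1F) (z 3F) ; 1F → z 0F ; 2F → z 1F ; 3F → z 2F ; 4F → z
          3F ; 5F → v5 f∈ }
      det₁ : DeterminedBy (C ∩ shiftCode 1 C) (1 ∷ 4 ∷ [])
      det₁ f (f∈ , f∈′) z = zero-ext λ { 0F → shifted-vanish 5 1 0 v5 refl f∈′ ; 1F → z 0F ; 2F → second-0
          (balanced f∈) (shifted-vanish 5 1 0 v5 refl f∈′) (z 1F) ; 3F → second-0
          (shifted-balanced 1 1 3 5 refl refl refl f∈′) (z 0F) (v5 f∈) ; 4F → z 1F ; 5F → v5 f∈ }
      det₅ : DeterminedBy (C ∩ shiftCode 5 C) (0 ∷ 3 ∷ [])
      det₅ f (f∈ , f∈′) z = zero-ext λ { 0F → z 0F ; 1F → second-0 (shifted-balanced 5 5 1 3 refl refl refl f∈′)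
          (v5 f∈) (z 1F) ; 2F → second-0 (balanced f∈) (z 0F) (shifted-vanish 5 5 4 v5 refl f∈′) ; 3F → z 1F ; 4F →
          shifted-vanish 5 5 4 v5 refl f∈′ ; 5F → v5 f∈ }
      bound : IntersectionBound C 2
      bound 1 _ _ _ = 2 , ℕ.≤-refl , 1 ∷ 4 ∷ [] , det₁
      bound 5 _ _ _ = 2 , ℕ.≤-refl , 0 ∷ 3 ∷ [] , det₅
      bound 0 ()
      bound 2 _ _ ()
      bound 3 _ _ ()
      bound 4 _ _ ()
      bound (suc (suc (suc (suc (suc (suc _)))))) _ (s≤s (s≤s (s≤s (s≤s (s≤s ()))))) _

      -- Up to scalars the only monomials in C are x^{[1]} and x^{[3]}, whose distance 2 is not
      -- prime to 6; so a chain of two members cannot start at a monomial.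
      g : 𝓛
      g = x^[ 3 ] ⊖ δ ·x^[ 1 ]
      g∈ : g ∈ C
      g∈ = ⊖∈ C-sub (∈⟨⟩ b 1F) (subst C (sym (monomial-• δ 1)) (•∈ C-sub δ (∈⟨⟩ b 0F)))
      shift-g : ∀ j → shift j g ≡ x^[ 3 + j ] ⊖ δ ·x^[ 1 + j ]
      shift-g j = trans (shift-⊖ j x^[ 3 ] (δ ·x^[ 1 ])) (cong₂ _⊖_ (shift-x^[] j 3)
          (trans (shift-monomial j δ 1) (cong (_·x^[ 1 + j ]) (δ^[] j))))
      -- x^{[4]} - δ x^{[2]} = (x^{[4]} - δ x) + δ (x - x^{[2]}).
      shift-g∈ : x^[ 4 ] ⊖ δ ·x^[ 2 ] ∈ C
      shift-g∈ = subst C (𝓛-ext same) (⊕∈ C-sub (∈⟨⟩ b 3F) (•∈ C-sub δ (∈⟨⟩ b 2F)))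
        where
        open ≡-Reasoning
        coef-δ : ∀ i k → coef (δ ·x^[ i ]) k ≡ δ *ᴷ coef x^[ i ] k
        coef-δ i k = trans (cong (λ f → coef f k) (monomial-• δ i)) (coef-• δ _ k)
        same : ∀ k → coef (x^[ 4 ] ⊖ δ ·x^[ 0 ] ⊕ δ • (x^[ 0 ] ⊖ x^[ 2 ])) k ≡ coef (x^[ 4 ] ⊖ δ ·x^[ 2 ]) k
        same k = begin
          coef (x^[ 4 ] ⊖ δ ·x^[ 0 ] ⊕ δ • (x^[ 0 ] ⊖ x^[ 2 ])) k
            ≡⟨ trans (coef-⊕ (x^[ 4 ] ⊖ δ ·x^[ 0 ]) (δ • (x^[ 0 ] ⊖ x^[ 2 ])) k) (cong₂ _+ᴷ_
                 (trans (coef-⊖ x^[ 4 ] (δ ·x^[ 0 ]) k) (cong (λ z → coef x^[ 4 ] k +ᴷ (-ᴷ z)) (coef-δ 0 k)))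
                 (trans (coef-• δ (x^[ 0 ] ⊖ x^[ 2 ]) k) (cong (δ *ᴷ_) (coef-⊖ x^[ 0 ] x^[ 2 ] k)))) ⟩
          (coef x^[ 4 ] k +ᴷ (-ᴷ (δ *ᴷ coef x^[ 0 ] k))) +ᴷ δ *ᴷ (coef x^[ 0 ] k +ᴷ (-ᴷ coef x^[ 2 ] k))
            ≡⟨ telescope δ _ _ _ ⟩
          coef x^[ 4 ] k +ᴷ (-ᴷ (δ *ᴷ coef x^[ 2 ] k))
            ≡⟨ trans (coef-⊖ x^[ 4 ] (δ ·x^[ 2 ]) k) (cong (λ z → coef x^[ 4 ] k +ᴷ (-ᴷ z)) (coef-δ 2 k)) ⟨
          coef (x^[ 4 ] ⊖ δ ·x^[ 2 ]) k
            ∎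

      b′ : Vector 𝓛 2
      b′ = x^[ 1 ] ⊖ x^[ 3 ] ∷ x^[ 4 ] ⊖ δ ·x^[ 2 ] ∷ []
      b′∈ : ∀ i → b′ i ∈ C ∩ shiftCode 1 C
      b′∈ 0F = ⊖∈ C-sub (∈⟨⟩ b 0F) (∈⟨⟩ b 1F) , x^[ 0 ] ⊖ x^[ 2 ] , ∈⟨⟩ b 2F , sym
          (trans (shift-⊖ 1 x^[ 0 ] x^[ 2 ]) (cong₂ _⊖_ (shift-x^[] 1 0) (shift-x^[] 1 2)))
      b′∈ 1F = shift-g∈ , g , g∈ , sym (shift-g 1)
      attained : IntersectionDimension C 2
      attained = 1 , ℕ.≤-refl , ℕ.m≤m+n 1 4 , refl , dual⇒hasDim (∩-subspace C-sub (shiftCode-subspace 1 C-sub)) b′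
          (1 ∷ 4 ∷ []) b′∈
        (λ { 0F → coef-⊖ˡ (on 1 1 refl) (off 3 1 λ ()) ; 1F → coef-⊖ˡ (on 4 4 refl) (off 2 4 λ ()) })
        (λ { {0F} {0F} i≢i → contradiction refl i≢i ; {0F} {1F} _ → trans (coef-⊖ʳ (off 1 4 λ ()) (off 3 4 λ ())) -0#≈0#
           ; {1F} {0F} _ → trans (coef-⊖ʳ (off 4 1 λ ()) (off 2 1 λ ())) -0#≈0# ; {1F} {1F} i≢i → contradiction refl i≢i })
        det₁

      -- (x^{[2]} − δ) ∘ (x^{[4]} + δ x^{[2]} + δ²) = 1 − δ³ in both orders.
      A W : 𝓛
      A = x^[ 2 ] ⊖ δ • x^[ 0 ]
      e c : 𝔽
      e = 1# +ᴷ (-ᴷ (δ *ᴷ (δ *ᴷ δ)))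
      e≢0 : e ≢ 0#
      e≢0 e≡0 = δ³≢1 (sym (x-y≡0⇒x≡y _ _ e≡0))
      c = proj₁ (reciprocal e e≢0)
      c*e≡1 : c *ᴷ e ≡ 1#
      c*e≡1 = proj₂ (reciprocal e e≢0)
      W = c • (x^[ 4 ] ⊕ δ • (x^[ 2 ] ⊕ δ • x^[ 0 ]))
      H : 𝔽 → 𝔽
      H y = y ^[ 4 ] +ᴷ δ *ᴷ (y ^[ 2 ] +ᴷ δ *ᴷ y)
      ev-A : ∀ y → ev A y ≡ y ^[ 2 ] +ᴷ (-ᴷ (δ *ᴷ y))
      ev-A y = trans (ev-⊖ x^[ 2 ] (δ • x^[ 0 ]) y) (cong₂ (λ a b → a +ᴷ (-ᴷ b)) (ev-x^[] 2 y)
          (trans (ev-• δ x^[ 0 ] y) (cong (δ *ᴷ_) (ev-id y))))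
      ev-W : ∀ y → ev W y ≡ c *ᴷ H y
      ev-W y = trans (ev-• c _ y) (cong (c *ᴷ_) (trans (ev-⊕ x^[ 4 ] _ y)
          (cong₂ _+ᴷ_ (ev-x^[] 4 y) (trans (ev-• δ _ y) (cong (δ *ᴷ_)
        (trans (ev-⊕ x^[ 2 ] _ y) (cong₂ _+ᴷ_ (ev-x^[] 2 y) (trans (ev-• δ x^[ 0 ] y) (cong (δ *ᴷ_) (ev-id y))))))))))
      c^[2] : c ^[ 2 ] ≡ c
      c^[2] = *-cancelˡ e e≢0 (trans (*-comm e _) (trans (trans
          (trans (cong (c ^[ 2 ] *ᴷ_) (sym e^[2])) (sym (^[]-* c e 2))) (trans (cong (_^[ 2 ]) c*e≡1) (^[]-1 2)))
          (trans (sym c*e≡1) (*-comm c e))))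
        where
        e^[2] : e ^[ 2 ] ≡ e
        e^[2] = trans (^[]-+ _ _ 2) (cong₂ _+ᴷ_ (^[]-1 2) (trans (^[]-neg _ 2)
            (cong -ᴷ_ (trans (^[]-* _ _ 2) (cong₂ _*ᴷ_ (δ^[] 2) (trans (^[]-* δ δ 2) (cong₂ _*ᴷ_ (δ^[] 2) (δ^[] 2))))))))
      scale-e : ∀ y → c *ᴷ (y +ᴷ (-ᴷ (δ *ᴷ (δ *ᴷ (δ *ᴷ y))))) ≡ y
      scale-e y = trans (cong (c *ᴷ_) (sym e*y)) (trans (sym (*-assoc c e y)) (trans (cong (_*ᴷ y) c*e≡1) (*-identityˡ y)))
        where
        e*y : e *ᴷ y ≡ y +ᴷ (-ᴷ (δ *ᴷ (δ *ᴷ (δ *ᴷ y))))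
        e*y = trans (distribʳ y 1# _) (cong₂ _+ᴷ_ (*-identityˡ y)
            (trans (sym (-‿distribˡ-* _ y)) (cong -ᴷ_ (trans (*-assoc δ _ y) (cong (δ *ᴷ_) (*-assoc δ δ y))))))
      A^[] : ∀ y j → (y ^[ 2 ] +ᴷ (-ᴷ (δ *ᴷ y))) ^[ j ] ≡ y ^[ 2 + j ] +ᴷ (-ᴷ (δ *ᴷ y ^[ j ]))
      A^[] y j = trans (^[]-+ _ _ j) (cong₂ _+ᴷ_ (^[]-^[] y 2 j)
          (trans (^[]-neg _ j) (cong -ᴷ_ (trans (^[]-* δ y j) (cong (_*ᴷ y ^[ j ]) (δ^[] j))))))
      W∘A : W ∘ᴸ A ≡ x^[ 0 ]
      W∘A = ev-injective λ y → begin
        ev (W ∘ᴸ A) y  ≡⟨ trans (ev-∘ W A y) (trans (ev-W _) (cong (λ z → c *ᴷ H z) (ev-A y))) ⟩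
        c *ᴷ H (y ^[ 2 ] +ᴷ (-ᴷ (δ *ᴷ y)))  ≡⟨ cong (c *ᴷ_) (cong₂ _+ᴷ_
            (trans (A^[] y 4) (cong (_+ᴷ (-ᴷ (δ *ᴷ y ^[ 4 ]))) (y^[6] y)))
                                                                      (cong (δ *ᴷ_) (trans (cong (_+ᴷ δ *ᴷ
                                                                          (y ^[ 2 ] +ᴷ (-ᴷ (δ *ᴷ y)))) (A^[] y 2))
                                                                          (telescope δ _ _ _)))) ⟩
        c *ᴷ ((y +ᴷ (-ᴷ (δ *ᴷ y ^[ 4 ]))) +ᴷ δ *ᴷ (y ^[ 4 ] +ᴷ (-ᴷ (δ *ᴷ (δ *ᴷ y))))) ≡⟨ cong (c *ᴷ_) (telescope δ _ _ _) ⟩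
        c *ᴷ (y +ᴷ (-ᴷ (δ *ᴷ (δ *ᴷ (δ *ᴷ y)))))  ≡⟨ scale-e y ⟩
        y  ≡⟨ ev-id y ⟨
        ev x^[ 0 ] y                                             ∎
        where
        open ≡-Reasoning
        y^[6] : ∀ y → y ^[ 6 ] ≡ y
        y^[6] y = trans (^[]-cong {6} {0} y refl) (^[0] y)
      A∘W : A ∘ᴸ W ≡ x^[ 0 ]
      A∘W = ev-injective λ y → begin
        ev (A ∘ᴸ W) y  ≡⟨ trans (ev-∘ A W y) (trans (ev-A _) (cong (λ z → z ^[ 2 ] +ᴷ (-ᴷ (δ *ᴷ z))) (ev-W y))) ⟩
        (c *ᴷ H y) ^[ 2 ] +ᴷ (-ᴷ (δ *ᴷ (c *ᴷ H y)))  ≡⟨ cong₂ (λ a b → a +ᴷ (-ᴷ b))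
            (trans (^[]-* c _ 2) (cong₂ _*ᴷ_ c^[2] (H^[2] y)))
                                                                      (trans (sym (*-assoc δ c _)) (trans
                                                                          (cong (_*ᴷ H y) (*-comm δ c)) (*-assoc c δ _))) ⟩
        c *ᴷ (y +ᴷ δ *ᴷ Q y) +ᴷ (-ᴷ (c *ᴷ (δ *ᴷ H y)))  ≡⟨ trans (cong (c *ᴷ (y +ᴷ δ *ᴷ Q y) +ᴷ_) (-‿distribʳ-* c _))
            (sym (distribˡ c _ _)) ⟩
        c *ᴷ ((y +ᴷ δ *ᴷ Q y) +ᴷ (-ᴷ (δ *ᴷ H y)))  ≡⟨ cong (c *ᴷ_)
            (trans (cong (λ z → (y +ᴷ δ *ᴷ Q y) +ᴷ (-ᴷ (δ *ᴷ z))) (H≡ y)) (cancel-middle y (Q y) _)) ⟩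
        c *ᴷ (y +ᴷ (-ᴷ (δ *ᴷ (δ *ᴷ (δ *ᴷ y)))))  ≡⟨ scale-e y ⟩
        y  ≡⟨ ev-id y ⟨
        ev x^[ 0 ] y                                             ∎
        where
        open ≡-Reasoning
        Q : 𝔽 → 𝔽
        Q y = y ^[ 4 ] +ᴷ δ *ᴷ y ^[ 2 ]
        H≡ : ∀ y → H y ≡ Q y +ᴷ δ *ᴷ (δ *ᴷ y)
        H≡ y = trans (cong (y ^[ 4 ] +ᴷ_) (distribˡ δ _ _)) (sym (+-assoc _ _ _))
        δ*^[2] : ∀ z → (δ *ᴷ z) ^[ 2 ] ≡ δ *ᴷ z ^[ 2 ]
        δ*^[2] z = trans (^[]-* δ z 2) (cong (_*ᴷ z ^[ 2 ]) (δ^[] 2))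
        H^[2] : ∀ y → H y ^[ 2 ] ≡ y +ᴷ δ *ᴷ Q y
        H^[2] y = trans (^[]-+ _ _ 2) (cong₂ _+ᴷ_ (trans (^[]-^[] y 4 2) (trans (^[]-cong {6} {0} y refl) (^[0] y)))
            (trans (δ*^[2] _) (cong (δ *ᴷ_)
          (trans (^[]-+ _ _ 2) (cong₂ _+ᴷ_ (^[]-^[] y 2 2) (δ*^[2] y))))))
        cancel-middle : ∀ a b d → (a +ᴷ δ *ᴷ b) +ᴷ (-ᴷ (δ *ᴷ (b +ᴷ d))) ≡ a +ᴷ (-ᴷ (δ *ᴷ d))
        cancel-middle a b d = begin
          (a +ᴷ δ *ᴷ b) +ᴷ (-ᴷ (δ *ᴷ (b +ᴷ d)))  ≡⟨ cong ((a +ᴷ δ *ᴷ b) +ᴷ_)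
              (trans (cong -ᴷ_ (distribˡ δ b d)) (sym (-‿+-comm _ _))) ⟩
          (a +ᴷ δ *ᴷ b) +ᴷ ((-ᴷ (δ *ᴷ b)) +ᴷ (-ᴷ (δ *ᴷ d)))  ≡⟨ +-assoc _ _ _ ⟨
          (a +ᴷ δ *ᴷ b) +ᴷ (-ᴷ (δ *ᴷ b)) +ᴷ (-ᴷ (δ *ᴷ d))  ≡⟨ cong (_+ᴷ (-ᴷ (δ *ᴷ d)))
              (trans (+-assoc a _ _) (trans (cong (a +ᴷ_) (-‿inverseʳ _)) (+-identityʳ a))) ⟩
          a +ᴷ (-ᴷ (δ *ᴷ d))                                    ∎
      g≡A∘x : A ∘ᴸ x^[ 1 ] ≡ g
      g≡A∘x = ev-injective λ y → trans (ev-∘ A _ y) (trans (ev-A _)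
          (trans (cong (λ z → z ^[ 2 ] +ᴷ (-ᴷ (δ *ᴷ z))) (ev-x^[] 1 y))
        (trans (cong (_+ᴷ (-ᴷ (δ *ᴷ y ^[ 1 ]))) (^[]-^[] y 1 2))
            (sym (trans (ev-⊖ x^[ 3 ] (δ ·x^[ 1 ]) y) (cong₂ (λ a b → a +ᴷ (-ᴷ b)) (ev-x^[] 3 y) (ev-monomial δ 1 y)))))))
      g-invertible : Invertible g
      g-invertible = subst Invertible g≡A∘x (∘-invertible {A} {x^[ 1 ]} (W , A∘W , W∘A) (x^[]-invertible 1))

      -- Besides three zeros of u, one balance relation kills a fourth coefficient. The other two
      -- relations leave a pair with a + b = 0 and a + δ b = 0, which vanishes because δ ≠ 1.
      chain : NoChain C 2
      chain 1 _ _ {u} onto u∈ = zero-not-surjective onto (zero-ext λ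
          { 0F → u₀ ; 1F → u₁ ; 2F → u₂ ; 3F → u₃ ; 4F → u₄ ; 5F → u₅ })
        where
        u₅ : coef u 5 ≡ 0#
        u₅ = unshift-vanish 5 0 5 v5 refl (u∈ 0 z≤n)
        u₄ : coef u 4 ≡ 0#
        u₄ = unshift-vanish 5 1 4 v5 refl (u∈ 1 (s≤s z≤n))
        u₃ : coef u 3 ≡ 0#
        u₃ = unshift-vanish 5 2 3 v5 refl (u∈ 2 (s≤s (s≤s z≤n)))
        u₁ : coef u 1 ≡ 0#
        u₁ = second-0 (unshift-balanced 1 5 1 3 refl refl refl (u∈ 1 (s≤s z≤n))) u₅ u₃
        u₀+u₂ : coef u 0 +ᴷ coef u 2 ≡ 0#
        u₀+u₂ = drop-third (unshift-balanced 0 0 2 4 refl refl refl (u∈ 0 z≤n)) u₄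
        u₂ : coef u 2 ≡ 0#
        u₂ = eliminate u₀+u₂ (drop-first (unshift-balanced 2 4 0 2 refl refl refl (u∈ 2 (s≤s (s≤s z≤n)))) u₄)
        u₀ : coef u 0 ≡ 0#
        u₀ = trans (sym (trans (cong (coef u 0 +ᴷ_) u₂) (+-identityʳ _))) u₀+u₂
      chain 5 _ _ {u} onto u∈ = zero-not-surjective onto (zero-ext λ
          { 0F → u₀ ; 1F → u₁ ; 2F → u₂ ; 3F → u₃ ; 4F → u₄ ; 5F → u₅ })
        where
        u₅ : coef u 5 ≡ 0#
        u₅ = unshift-vanish 5 0 5 v5 refl (u∈ 0 z≤n)
        u₀ : coef u 0 ≡ 0#
        u₀ = unshift-vanish 5 5 0 v5 refl (u∈ 1 (s≤s z≤n))
        u₁ : coef u 1 ≡ 0#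
        u₁ = unshift-vanish 5 10 1 v5 refl (u∈ 2 (s≤s (s≤s z≤n)))
        u₃ : coef u 3 ≡ 0#
        u₃ = second-0 (unshift-balanced 5 1 3 5 refl refl refl (u∈ 1 (s≤s z≤n))) u₁ u₅
        u₂+u₄ : coef u 2 +ᴷ coef u 4 ≡ 0#
        u₂+u₄ = drop-third (unshift-balanced 10 2 4 0 refl refl refl (u∈ 2 (s≤s (s≤s z≤n)))) u₀
        u₄ : coef u 4 ≡ 0#
        u₄ = eliminate u₂+u₄ (drop-first (unshift-balanced 0 0 2 4 refl refl refl (u∈ 0 z≤n)) u₀)
        u₂ : coef u 2 ≡ 0#
        u₂ = trans (sym (trans (cong (coef u 2 +ᴷ_) u₄) (+-identityʳ _))) u₂+u₄
      chain 0 _ ()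
      chain 2 _ ()
      chain 3 _ ()
      chain 4 _ ()
      chain (suc (suc (suc (suc (suc (suc _)))))) (s≤s (s≤s (s≤s (s≤s (s≤s (s≤s ())))))) _

      shift∈ : ∀ (i : Fin 2) → shift (1 * toℕ i) g ∈ C
      shift∈ 0F = subst C (sym (shift-g 0)) g∈
      shift∈ 1F = subst C (sym (shift-g 1)) shift-g∈

      values : ind[ C ]≡ 2 × h[ C ]≡ 2
      values = (index-lower C-sub 2 1 g g-invertible refl (ℕ.m≤m+n 1 1) (ℕ.m≤m+n 2 4) shift∈ ,
        λ d dim → index-upper-by-chains (1 ∷ 2 ∷ 3 ∷ 4 ∷ []) det (ℕ.m≤m+n 5 1) chain dim) , h-value bound attained

    𝒟₂-values : ind[ 𝒟₂ δ ]≡ 2 × h[ 𝒟₂ δ ]≡ 2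
    𝒟₂-values = values

module _ {q : ℕ} (q-primePower : IsPrimePower q) (K : FiniteField (q ^ 8)) where
  open LinearizedPolynomials q 8 K
  open FieldProperties K hiding (_^ᴷ_; productᴷ)
  open FrobeniusProperties {q} {8} q-primePower K
  open LinearizedAlgebra {q} {8} q-primePower K
  open GabidulinCodes {q} {8} q-primePower K
  open IndexCriteria {q} {8} q-primePower K
  open CodeFamilies {q} {8} q-primePower K
  open SparseCodes {q} {8} q-primePower K
  open IsSubspace

  open Exclusion {q} {8} q-primePower K

  module _ (δ : 𝔽) (δ≢0 : δ ≢ 0#) where
    private
      b : Vector 𝓛 6
      b = x^[ 1 ] ∷ x^[ 2 ] ∷ x^[ 3 ] ∷ x^[ 5 ] ∷ x^[ 6 ] ∷ x^[ 0 ] ⊖ δ ·x^[ 4 ] ∷ []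
      C : Code
      C = ⟨ b ⟩
      C-sub : IsSubspace C
      C-sub = ⟨⟩-subspace b
      open Shifts C
      -δ≢0 : -ᴷ δ ≢ 0#
      -δ≢0 p = δ≢0 (trans (sym (-‿involutive δ)) (trans (cong -ᴷ_ p) -0#≈0#))
      v7 : Vanishes C 7
      v7 = ⟨⟩-vanish b 7 λ { 0F → off 1 7 λ () ; 1F → off 2 7 λ () ; 2F → off 3 7 λ () ; 3F → off 5 7 λ () ; 4F → off
          6 7 λ ()
        ; 5F → trans (coef-⊖ʳ (off 0 7 λ ()) (off 4 7 λ ())) -0#≈0# }
      r40 : Proportional C 4 (-ᴷ δ) 0
      r40 = ⟨⟩⊆ (proportional-subspace 4 (-ᴷ δ) 0) {b = b} λ
        { 0F → both-0 (off 1 4 λ ()) (off 1 0 λ ()) ; 1F → both-0 (off 2 4 λ ()) (off 2 0 λ ()) ; 2F → both-0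
            (off 3 4 λ ()) (off 3 0 λ ())
        ; 3F → both-0 (off 5 4 λ ()) (off 5 0 λ ()) ; 4F → both-0 (off 6 4 λ ()) (off 6 0 λ ())
        ; 5F → ratio (coef-⊖ʳ (off 0 4 λ ()) (on 4 4 refl)) (coef-⊖ˡ (on 0 0 refl) (off 4 0 λ ())) }
      det : DeterminedBy C (0 ∷ 1 ∷ 2 ∷ 3 ∷ 5 ∷ 6 ∷ [])
      det f f∈ z = zero-ext λ { 0F → z 0F ; 1F → z 1F ; 2F → z 2F ; 3F → z 3F ; 4F → proportional-0 (r40 f∈) (z 0F) ;
          5F → z 4F ; 6F → z 5F ; 7F → v7 f∈ }
      -- For every odd j, the two relations of C and the two of its shift together express four of
      -- the eight coefficients through the other four.
      det-1 : DeterminedBy (C ∩ shiftCode 1 C) (1 ∷ 2 ∷ 3 ∷ 6 ∷ [])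
      det-1 f (f∈ , f∈′) z = zero-ext λ
        { 0F → shifted-vanish 7 1 0 v7 refl f∈′ ; 1F → z 0F ; 2F → z 1F ; 3F → z 2F
        ; 4F → proportional-0 (r40 f∈) (shifted-vanish 7 1 0 v7 refl f∈′)
        ; 5F → proportional-0 (shifted-proportional 4 1 0 5 1 r40 refl refl f∈′) (z 0F) ; 6F → z 3F ; 7F → v7 f∈ }
      det-3 : DeterminedBy (C ∩ shiftCode 3 C) (0 ∷ 1 ∷ 5 ∷ 6 ∷ [])
      det-3 f (f∈ , f∈′) z = zero-ext λ
        { 0F → z 0F ; 1F → z 1F ; 2F → shifted-vanish 7 3 2 v7 refl f∈′
        ; 3F → proportional-0′ (^[]≢0 3 -δ≢0) (shifted-proportional 4 3 0 7 3 r40 refl refl f∈′) (v7 f∈)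
        ; 4F → proportional-0 (r40 f∈) (z 0F) ; 5F → z 2F ; 6F → z 3F ; 7F → v7 f∈ }
      det-5 : DeterminedBy (C ∩ shiftCode 5 C) (2 ∷ 3 ∷ 5 ∷ 6 ∷ [])
      det-5 f (f∈ , f∈′) z = zero-ext λ
        { 0F → proportional-0′ -δ≢0 (r40 f∈) (shifted-vanish 7 5 4 v7 refl f∈′)
        ; 1F → proportional-0 (shifted-proportional 4 5 0 1 5 r40 refl refl f∈′) (z 2F) ; 2F → z 0F ; 3F → z 1F
        ; 4F → shifted-vanish 7 5 4 v7 refl f∈′ ; 5F → z 2F ; 6F → z 3F ; 7F → v7 f∈ }
      det-7 : DeterminedBy (C ∩ shiftCode 7 C) (0 ∷ 1 ∷ 2 ∷ 5 ∷ [])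
      det-7 f (f∈ , f∈′) z = zero-ext λ
        { 0F → z 0F ; 1F → z 1F ; 2F → z 2F
        ; 3F → proportional-0 (shifted-proportional 4 7 0 3 7 r40 refl refl f∈′) (v7 f∈)
        ; 4F → proportional-0 (r40 f∈) (z 0F) ; 5F → z 3F ; 6F → shifted-vanish 7 7 6 v7 refl f∈′ ; 7F → v7 f∈ }
      bound : IntersectionBound C 4
      bound 1 _ _ _ = 4 , ℕ.≤-refl , 1 ∷ 2 ∷ 3 ∷ 6 ∷ [] , det-1
      bound 3 _ _ _ = 4 , ℕ.≤-refl , 0 ∷ 1 ∷ 5 ∷ 6 ∷ [] , det-3
      bound 5 _ _ _ = 4 , ℕ.≤-refl , 2 ∷ 3 ∷ 5 ∷ 6 ∷ [] , det-5
      bound 7 _ _ _ = 4 , ℕ.≤-refl , 0 ∷ 1 ∷ 2 ∷ 5 ∷ [] , det-7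
      bound 0 ()
      bound 2 _ _ ()
      bound 4 _ _ ()
      bound 6 _ _ ()
      bound (suc (suc (suc (suc (suc (suc (suc (suc _)))))))) _ (s≤s (s≤s (s≤s (s≤s (s≤s (s≤s (s≤s ()))))))) _

      b′ : Vector 𝓛 4
      b′ = x^[ 1 ] ⊖ (δ ^[ 1 ]) ·x^[ 5 ] ∷ x^[ 2 ] ∷ x^[ 3 ] ∷ x^[ 6 ] ∷ []
      b′∈ : ∀ i → b′ i ∈ C ∩ shiftCode 1 C
      b′∈ 0F = ⊖∈ C-sub (∈⟨⟩ b 0F) (subst C (sym (monomial-• (δ ^[ 1 ]) 5)) (•∈ C-sub (δ ^[ 1 ]) (∈⟨⟩ b 3F))) , x^[ 0
          ] ⊖ δ ·x^[ 4 ] , ∈⟨⟩ b 5F ,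
        sym (trans (shift-⊖ 1 x^[ 0 ] (δ ·x^[ 4 ])) (cong₂ _⊖_ (shift-x^[] 1 0) (shift-monomial 1 δ 4)))
      b′∈ 1F = ∈⟨⟩ b 1F , x^[ 1 ] , ∈⟨⟩ b 0F , sym (shift-x^[] 1 1)
      b′∈ 2F = ∈⟨⟩ b 2F , x^[ 2 ] , ∈⟨⟩ b 1F , sym (shift-x^[] 1 2)
      b′∈ 3F = ∈⟨⟩ b 4F , x^[ 5 ] , ∈⟨⟩ b 3F , sym (shift-x^[] 1 5)
      attained : IntersectionDimension C 4
      attained = 1 , ℕ.≤-refl , ℕ.m≤m+n 1 6 , refl , dual⇒hasDim (∩-subspace C-sub (shiftCode-subspace 1 C-sub)) b′
          (1 ∷ 2 ∷ 3 ∷ 6 ∷ []) b′∈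
        (λ { 0F → coef-⊖ˡ (on 1 1 refl) (off 5 1 λ ()) ; 1F → on 2 2 refl ; 2F → on 3 3 refl ; 3F → on 6 6 refl })
        (λ { {0F} {0F} i≢i → contradiction refl i≢i
           ; {0F} {1F} _ → trans (coef-⊖ʳ (off 1 2 λ ()) (off 5 2 λ ())) -0#≈0#
           ; {0F} {2F} _ → trans (coef-⊖ʳ (off 1 3 λ ()) (off 5 3 λ ())) -0#≈0#
           ; {0F} {3F} _ → trans (coef-⊖ʳ (off 1 6 λ ()) (off 5 6 λ ())) -0#≈0#
           ; {1F} {0F} _ → off 2 1 λ ()
           ; {1F} {1F} i≢i → contradiction refl i≢i
           ; {1F} {2F} _ → off 2 3 λ ()
           ; {1F} {3F} _ → off 2 6 λ ()
           ; {2F} {0F} _ → off 3 1 λ ()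
           ; {2F} {1F} _ → off 3 2 λ ()
           ; {2F} {2F} i≢i → contradiction refl i≢i
           ; {2F} {3F} _ → off 3 6 λ ()
           ; {3F} {0F} _ → off 6 1 λ ()
           ; {3F} {1F} _ → off 6 2 λ ()
           ; {3F} {2F} _ → off 6 3 λ ()
           ; {3F} {3F} i≢i → contradiction refl i≢i })
        det-1

      -- The member u^{[si]} gives a zero of u at 7 - s i and ties together the positions -s i and 4
      -- - s i. As s is odd, the zeros for i = 0, ..., 3 are distinct modulo 4, so each pair of
      -- positions four apart contains one of them.
      chain : NoChain C 3
      chain 1 _ _ onto u∈ =
        let u₇ = unshift-vanish 7 0 7 v7 refl (u∈ 0 z≤n)
            u₆ = unshift-vanish 7 1 6 v7 refl (u∈ 1 (s≤s z≤n))
            u₅ = unshift-vanish 7 2 5 v7 refl (u∈ 2 (s≤s (s≤s z≤n)))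
            u₄ = unshift-vanish 7 3 4 v7 refl (u∈ 3 (s≤s (s≤s (s≤s z≤n))))
            u₀ = propagate⁻¹ 4 0 0 4 0 -δ≢0 r40 refl refl (u∈ 0 z≤n) u₄
            u₃ = propagate 4 1 0 3 7 r40 refl refl (u∈ 1 (s≤s z≤n)) u₇
            u₂ = propagate 4 2 0 2 6 r40 refl refl (u∈ 2 (s≤s (s≤s z≤n))) u₆
            u₁ = propagate 4 3 0 1 5 r40 refl refl (u∈ 3 (s≤s (s≤s (s≤s z≤n)))) u₅
        in zero-not-surjective onto (zero-ext λ { 0F → u₀ ; 1F → u₁ ; 2F → u₂ ; 3F → u₃ ; 4F → u₄ ; 5F → u₅ ; 6F → u₆
            ; 7F → u₇ })
      chain 3 _ _ onto u∈ =
        let u₇ = unshift-vanish 7 0 7 v7 refl (u∈ 0 z≤n)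
            u₄ = unshift-vanish 7 3 4 v7 refl (u∈ 1 (s≤s z≤n))
            u₁ = unshift-vanish 7 6 1 v7 refl (u∈ 2 (s≤s (s≤s z≤n)))
            u₆ = unshift-vanish 7 9 6 v7 refl (u∈ 3 (s≤s (s≤s (s≤s z≤n))))
            u₀ = propagate⁻¹ 4 0 0 4 0 -δ≢0 r40 refl refl (u∈ 0 z≤n) u₄
            u₅ = propagate⁻¹ 4 3 0 1 5 -δ≢0 r40 refl refl (u∈ 1 (s≤s z≤n)) u₁
            u₂ = propagate⁻¹ 4 6 0 6 2 -δ≢0 r40 refl refl (u∈ 2 (s≤s (s≤s z≤n))) u₆
            u₃ = propagate 4 9 0 3 7 r40 refl refl (u∈ 3 (s≤s (s≤s (s≤s z≤n)))) u₇
        in zero-not-surjective onto (zero-ext λ { 0F → u₀ ; 1F → u₁ ; 2F → u₂ ; 3F → u₃ ; 4F → u₄ ; 5F → u₅ ; 6F → u₆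
            ; 7F → u₇ })
      chain 5 _ _ onto u∈ =
        let u₇ = unshift-vanish 7 0 7 v7 refl (u∈ 0 z≤n)
            u₂ = unshift-vanish 7 5 2 v7 refl (u∈ 1 (s≤s z≤n))
            u₅ = unshift-vanish 7 10 5 v7 refl (u∈ 2 (s≤s (s≤s z≤n)))
            u₀ = unshift-vanish 7 15 0 v7 refl (u∈ 3 (s≤s (s≤s (s≤s z≤n))))
            u₄ = propagate 4 0 0 4 0 r40 refl refl (u∈ 0 z≤n) u₀
            u₃ = propagate⁻¹ 4 5 0 7 3 -δ≢0 r40 refl refl (u∈ 1 (s≤s z≤n)) u₇
            u₆ = propagate⁻¹ 4 10 0 2 6 -δ≢0 r40 refl refl (u∈ 2 (s≤s (s≤s z≤n))) u₂
            u₁ = propagate⁻¹ 4 15 0 5 1 -δ≢0 r40 refl refl (u∈ 3 (s≤s (s≤s (s≤s z≤n)))) u₅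
        in zero-not-surjective onto (zero-ext λ { 0F → u₀ ; 1F → u₁ ; 2F → u₂ ; 3F → u₃ ; 4F → u₄ ; 5F → u₅ ; 6F → u₆
            ; 7F → u₇ })
      chain 7 _ _ onto u∈ =
        let u₇ = unshift-vanish 7 0 7 v7 refl (u∈ 0 z≤n)
            u₀ = unshift-vanish 7 7 0 v7 refl (u∈ 1 (s≤s z≤n))
            u₁ = unshift-vanish 7 14 1 v7 refl (u∈ 2 (s≤s (s≤s z≤n)))
            u₂ = unshift-vanish 7 21 2 v7 refl (u∈ 3 (s≤s (s≤s (s≤s z≤n))))
            u₄ = propagate 4 0 0 4 0 r40 refl refl (u∈ 0 z≤n) u₀
            u₅ = propagate 4 7 0 5 1 r40 refl refl (u∈ 1 (s≤s z≤n)) u₁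
            u₆ = propagate 4 14 0 6 2 r40 refl refl (u∈ 2 (s≤s (s≤s z≤n))) u₂
            u₃ = propagate⁻¹ 4 21 0 7 3 -δ≢0 r40 refl refl (u∈ 3 (s≤s (s≤s (s≤s z≤n)))) u₇
        in zero-not-surjective onto (zero-ext λ { 0F → u₀ ; 1F → u₁ ; 2F → u₂ ; 3F → u₃ ; 4F → u₄ ; 5F → u₅ ; 6F → u₆
            ; 7F → u₇ })
      chain 0 _ ()
      chain 2 _ ()
      chain 4 _ ()
      chain 6 _ ()
      chain (suc (suc (suc (suc (suc (suc (suc (suc _)))))))) (s≤s (s≤s (s≤s (s≤s (s≤s (s≤s (s≤s (s≤s ())))))))) _

      shift∈ : ∀ (i : Fin 3) → shift (1 * toℕ i) x^[ 1 ] ∈ C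
      shift∈ 0F = subst C (sym (shift-x^[] 0 1)) (∈⟨⟩ b 0F)
      shift∈ 1F = subst C (sym (shift-x^[] 1 1)) (∈⟨⟩ b 1F)
      shift∈ 2F = subst C (sym (shift-x^[] 2 1)) (∈⟨⟩ b 2F)

      values : ind[ C ]≡ 3 × h[ C ]≡ 4
      values = (index-lower C-sub 3 1 x^[ 1 ] (x^[]-invertible 1) refl (ℕ.m≤m+n 1 2) (ℕ.m≤m+n 3 5) shift∈ ,
        λ d dim → index-upper-by-chains (0 ∷ 1 ∷ 2 ∷ 3 ∷ 5 ∷ 6 ∷ []) det (ℕ.m≤m+n 7 1) chain dim) , h-value bound attained

    𝒟₄-values : ind[ 𝒟₄ δ ]≡ 3 × h[ 𝒟₄ δ ]≡ 4
    𝒟₄-values = values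

-- The MRD condition on 𝒞₁

record Enumeration {N} (P : Fin N → Set) : Set where
  field
    size      : ℕ
    at        : Fin size → Fin N
    injective : ∀ {i k} → at i ≡ at k → i ≡ k
    satisfies : ∀ i → P (at i)

module _ {N} {P : Fin (suc N) → Set} (E : Enumeration (P ∘ suc)) where
  open Enumeration E

  without-zero : Enumeration P
  without-zero = record { size = size ; at = suc ∘ at ; injective = injective ∘ sucᶠ-injective ; satisfies = satisfies }

  with-zero : P zero → Enumeration P
  with-zero p = record
    { size = suc size
    ; at = λ { zero → zero ; (suc i) → suc (at i) }
    ; injective = λ { {zero} {zero} _ → refl ; {suc i} {suc k} q → cong suc (injective (sucᶠ-injective q)) }
    ; satisfies = λ { zero → p ; (suc i) → satisfies i } }

-- The two sizes add up to N, so an upper bound for the complement of 𝔽_q becomes a lower bound for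
-- 𝔽_q itself.
enumerate : ∀ {N} {P : Fin N → Set} → (∀ i → Dec (P i)) →
  Σ[ E ∈ Enumeration P ] Σ[ E′ ∈ Enumeration (λ i → ¬ P i) ] Enumeration.size E + Enumeration.size E′ ≡ N
enumerate {zero} P? = none , none , refl
  where
  none : ∀ {P : Fin 0 → Set} → Enumeration P
  none = record { size = 0 ; at = λ () ; injective = λ { {()} } ; satisfies = λ () }
enumerate {suc N} P? with P? zero | enumerate (P? ∘ suc)
... | yes p | E , E′ , eq = with-zero E p , without-zero E′ , cong suc eq
... | no ¬p | E , E′ , eq = without-zero E , with-zero E′ ¬p , trans (ℕ.+-suc _ _) (cong suc eq)

lookup-injective : ∀ {A : Set} {xs : List A} → Unique xs → ∀ {i k} → List.lookup xs i ≡ List.lookup xs k → i ≡ k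
lookup-injective (x∉ AllPairs.∷ _) {zero} {zero} _ = refl
lookup-injective {xs = x List.∷ xs} (x∉ AllPairs.∷ _) {zero} {suc k} p = contradiction p
    (All.lookup x∉ (∈-lookup {xs = xs} k))
lookup-injective {xs = x List.∷ xs} (x∉ AllPairs.∷ _) {suc i} {zero} p = contradiction (sym p)
    (All.lookup x∉ (∈-lookup {xs = xs} i))
lookup-injective (_ AllPairs.∷ u) {suc i} {suc k} p = cong suc (lookup-injective u p)

-- Double-negation shift for a finite index set. It collects statements on span membership for all
-- field elements without deciding any of them.
¬¬-∀ : ∀ {N} {P : Fin N → Set} → (∀ i → ¬ ¬ P i) → ¬ ¬ (∀ i → P i)
¬¬-∀ {zero} h k = k λ ()
¬¬-∀ {suc N} h k = h zero λ p → ¬¬-∀ (h ∘ suc) λ ps → k λ { zero → p ; (suc i) → ps i }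

-- The subfield 𝔽_q and independence over it

module Subfield {q n : ℕ} .{{_ : NonZero n}} (q-primePower : IsPrimePower q) (K : FiniteField (q ^ n)) where
  open LinearizedPolynomials q n K
  open FieldProperties K hiding (_^ᴷ_; productᴷ)
  open FrobeniusProperties q-primePower K

  ^[1]⇒∈𝔽q : ∀ {x} → x ^[ 1 ] ≡ x → x ∈ 𝔽q
  ^[1]⇒∈𝔽q {x} p = trans (sym (^[1] x)) p

  private
    q′ : ℕ
    q′ = q ∸ 1

    1+q′≡q : suc q′ ≡ q
    1+q′≡q = ℕ.m+[n∸m]≡n (ℕ.≤-trans (s≤s z≤n) 2≤q)

    -- M is 1 + q + ... + q^{k - 1}.
    repunit : ∀ k → ∃[ M ] q ^ k ≡ 1 + q′ * M
    repunit zero = 0 , cong suc (sym (ℕ.*-zeroʳ q′))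
    repunit (suc k) with M , eq ← repunit k = 1 + q * M , (begin
      q * q ^ k  ≡⟨ cong (q *_) eq ⟩
      q * (1 + q′ * M)  ≡⟨ ℕ.*-suc q (q′ * M) ⟩
      q + q * (q′ * M)  ≡⟨ cong₂ _+_ (sym 1+q′≡q) (trans (sym (ℕ.*-assoc q q′ M))
          (trans (cong (_* M) (ℕ.*-comm q q′)) (ℕ.*-assoc q′ q M))) ⟩
      1 + q′ + q′ * (q * M)  ≡⟨ cong suc (ℕ.*-suc q′ (q * M)) ⟨
      1 + q′ * (1 + q * M)    ∎)
      where open ≡-Reasoning

    geometric : ℕ → 𝔽 → 𝔽
    geometric zero z = 1#
    geometric (suc t) z = z *ᴷ geometric t z +ᴷ 1#

    geometric-suc : ∀ t z → geometric (suc t) z ≡ geometric t z +ᴷ z ^ᴷ suc t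
    geometric-suc zero z = +-comm _ _
    geometric-suc (suc t) z = begin
      z *ᴷ geometric (suc t) z +ᴷ 1#  ≡⟨ cong (λ w → z *ᴷ w +ᴷ 1#) (geometric-suc t z) ⟩
      z *ᴷ (geometric t z +ᴷ z ^ᴷ suc t) +ᴷ 1#  ≡⟨ cong (_+ᴷ 1#) (distribˡ z _ _) ⟩
      (z *ᴷ geometric t z +ᴷ z ^ᴷ suc (suc t)) +ᴷ 1#  ≡⟨ trans (+-assoc _ _ _)
          (trans (cong (z *ᴷ geometric t z +ᴷ_) (+-comm _ 1#)) (sym (+-assoc _ _ _))) ⟩
      geometric (suc t) z +ᴷ z ^ᴷ suc (suc t)                 ∎
      where open ≡-Reasoning

    monic-*-^ : ∀ {d φ} k → Monic d φ → Monic (k + d) (λ x → x ^ᴷ k *ᴷ φ x)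
    monic-*-^ zero M = monic-ext (λ x → *-identityˡ _) M
    monic-*-^ (suc k) M = step 0# (monic-*-^ k M) λ x → trans (*-assoc x _ _) (sym (+-identityʳ _))

    geometric-monic : ∀ t → Monic (t * q′) (λ x → geometric t (x ^ᴷ q′))
    geometric-monic zero = one λ _ → refl
    geometric-monic (suc t) = monic-+ (monic-*-^ q′ (geometric-monic t))
        (poly-≤ (ℕ.≤-trans 1≤q′ (ℕ.m≤m+n q′ (t * q′))) (poly-^ 0))
      where
      1≤q′ : 1 ≤ q′
      1≤q′ = s≤s⁻¹ (subst (2 ≤_) (sym 1+q′≡q) 2≤q)

    -- For z = x^{q - 1} Fermat gives z^{t + 1} = 1, while z ≠ 1 outside 𝔽_q; hence the sum 1 + z +
    -- ... + z^t vanishes.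
    geometric-root : ∀ t x → q ^ n ≡ 1 + q′ * suc t → x ^[ 1 ] ≢ x → geometric t (x ^ᴷ q′) ≡ 0#
    geometric-root t x eq x∉ with geometric t (x ^ᴷ q′) ≟ 0#
    ... | yes p = p
    ... | no G≢0 = contradiction (begin
        x ^[ 1 ]  ≡⟨ trans (^[1] x) (cong (x ^ᴷ_) (sym 1+q′≡q)) ⟩
        x *ᴷ z  ≡⟨ cong (x *ᴷ_) z≡1 ⟩
        x *ᴷ 1#  ≡⟨ *-identityʳ x ⟩
        x               ∎) x∉
      where
      open ≡-Reasoning
      z : 𝔽
      z = x ^ᴷ q′
      x≢0 : x ≢ 0#
      x≢0 refl = x∉ (^[]-0 1)
      z^≡1 : z ^ᴷ suc t ≡ 1#
      z^≡1 = *-cancelˡ x x≢0 (trans (cong (x *ᴷ_) (^-assocʳ x q′ (suc t)))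
          (trans (cong (x ^ᴷ_) (sym eq)) (trans (fermat x) (sym (*-identityʳ x)))))
      z≡1 : z ≡ 1#
      z≡1 = *-cancelˡ (geometric t z) G≢0 (trans (*-comm _ z)
          (trans (+-cancelʳ 1# _ _ (trans (geometric-suc t z) (cong (geometric t z +ᴷ_) z^≡1))) (sym (*-identityʳ _))))

  -- The q^n − q elements outside 𝔽q are roots of (x^{q^n} − x)/(x^q − x).
  𝔽q-elements : Σ[ ι ∈ (Fin q → 𝔽) ] (∀ {i k} → ι i ≡ ι k → i ≡ k) × (∀ i → ι i ∈ 𝔽q)
  𝔽q-elements with repunit n | enumerate (λ i → element i ^[ 1 ] ≟ element i)
  ... | zero , eq | _ = contradiction (trans eq (cong suc (ℕ.*-zeroʳ q′))) (ℕ.>⇒≢ 2≤q^n)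
  ... | suc t , eq | E , E′ , sizes = (λ i → element (E.at (inject≤ i q≤size))) ,
      (λ p → inject≤-injective q≤size q≤size _ _ (E.injective (element-injective p))) , λ i → ^[1]⇒∈𝔽q (E.satisfies _)
    where
    module E = Enumeration E
    module E′ = Enumeration E′
    few : E′.size ≤ t * q′
    few = monic-roots (geometric-monic t) (element ∘ E′.at) (E′.injective ∘ element-injective) λ i → geometric-root t
        _ eq (E′.satisfies i)
    q≤size : q ≤ E.size
    q≤size = ℕ.+-cancelʳ-≤ (t * q′) q E.size (begin
      q + t * q′  ≡⟨ cong (_+ t * q′) 1+q′≡q ⟨
      1 + (q′ + t * q′)  ≡⟨ cong suc (ℕ.*-comm (suc t) q′) ⟩
      1 + q′ * suc t  ≡⟨ eq ⟨
      q ^ n  ≡⟨ sizes ⟨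
      E.size + E′.size  ≤⟨ ℕ.+-monoʳ-≤ E.size few ⟩
      E.size + t * q′         ∎)
      where open ℕ.≤-Reasoning

  open LinearAlgebra K 𝔽q 𝔽-module using () renaming (lincomb to lincombᴷ; Span to Spanᴷ; LinearlyIndependent to
      Independentᴷ)

  -‿∈𝔽q : ∀ {x} → x ∈ 𝔽q → -ᴷ x ∈ 𝔽q
  -‿∈𝔽q x∈ = ^[1]⇒∈𝔽q (trans (^[]-neg _ 1) (cong -ᴷ_ (∈𝔽q⇒^[] x∈ 1)))

  +-∈𝔽q : ∀ {x y} → x ∈ 𝔽q → y ∈ 𝔽q → x +ᴷ y ∈ 𝔽q
  +-∈𝔽q x∈ y∈ = ^[1]⇒∈𝔽q (trans (^[]-+ _ _ 1) (cong₂ _+ᴷ_ (∈𝔽q⇒^[] x∈ 1) (∈𝔽q⇒^[] y∈ 1)))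

  *-∈𝔽q : ∀ {x y} → x ∈ 𝔽q → y ∈ 𝔽q → x *ᴷ y ∈ 𝔽q
  *-∈𝔽q x∈ y∈ = ^[1]⇒∈𝔽q (trans (^[]-* _ _ 1) (cong₂ _*ᴷ_ (∈𝔽q⇒^[] x∈ 1) (∈𝔽q⇒^[] y∈ 1)))

  reciprocal-∈𝔽q : ∀ {x w} → x ∈ 𝔽q → x ≢ 0# → w *ᴷ x ≡ 1# → w ∈ 𝔽q
  reciprocal-∈𝔽q {x} {w} x∈ x≢0 wx≡1 = ^[1]⇒∈𝔽q (*-cancelˡ x x≢0 (begin
    x *ᴷ w ^[ 1 ]  ≡⟨ cong (_*ᴷ w ^[ 1 ]) (∈𝔽q⇒^[] x∈ 1) ⟨
    x ^[ 1 ] *ᴷ w ^[ 1 ]  ≡⟨ ^[]-* x w 1 ⟨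
    (x *ᴷ w) ^[ 1 ]  ≡⟨ cong (_^[ 1 ]) (trans (*-comm x w) wx≡1) ⟩
    1# ^[ 1 ]  ≡⟨ ^[]-1 1 ⟩
    1#  ≡⟨ trans (*-comm x w) wx≡1 ⟨
    x *ᴷ w                 ∎))
    where open ≡-Reasoning

  independent-∷ : ∀ {r y} {b : Vector 𝔽 r} → Independentᴷ b → ¬ Spanᴷ b y → Independentᴷ (y ∷ b)
  independent-∷ {r} {y} {b} indep y∉ c c∈ eq with c zero ≟ 0#
  ... | yes c₀≡0 = λ { zero → c₀≡0 ; (suc i) → indep (c ∘ suc) (c∈ ∘ suc) (trans (sym (trans (cong (_+ᴷ lincombᴷ (c ∘ suc) b)
          (trans (cong (_*ᴷ y) c₀≡0) (zeroˡ y))) (+-identityˡ _))) eq) i }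
  ... | no c₀≢0 = contradiction ((λ i → -ᴷ (w *ᴷ c (suc i))) ,
      (λ i → -‿∈𝔽q (*-∈𝔽q (reciprocal-∈𝔽q (c∈ zero) c₀≢0 wc≡1) (c∈ (suc i)))) , y≡) y∉
    where
    open ≡-Reasoning
    w : 𝔽
    w = proj₁ (reciprocal _ c₀≢0)
    wc≡1 : w *ᴷ c zero ≡ 1#
    wc≡1 = proj₂ (reciprocal _ c₀≢0)
    rest : 𝔽
    rest = lincombᴷ (c ∘ suc) b
    y≡ : y ≡ lincombᴷ (λ i → -ᴷ (w *ᴷ c (suc i))) b
    y≡ = begin
      y  ≡⟨ trans (sym (*-identityˡ y)) (cong (_*ᴷ y) (sym wc≡1)) ⟩
      w *ᴷ c zero *ᴷ y  ≡⟨ *-assoc w _ y ⟩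
      w *ᴷ (c zero *ᴷ y)  ≡⟨ cong (w *ᴷ_) (-‿uniqueˡ _ _ eq) ⟩
      w *ᴷ (-ᴷ rest)  ≡⟨ trans (sym (-‿distribʳ-* w rest)) (-‿distribˡ-* w rest) ⟩
      (-ᴷ w) *ᴷ rest  ≡⟨ *-distribˡ-sum (-ᴷ w) (λ i → c (suc i) *ᴷ b i) ⟩
      sum (λ i → (-ᴷ w) *ᴷ (c (suc i) *ᴷ b i))  ≡⟨ sum-cong-≗
          (λ i → trans (sym (*-assoc (-ᴷ w) (c (suc i)) (b i))) (cong (_*ᴷ b i) (sym (-‿distribˡ-* w (c (suc i)))))) ⟩
      lincombᴷ (λ i → -ᴷ (w *ᴷ c (suc i))) b            ∎

  -- An independent family in W that spans W would give W a dimension, so it can be extended; the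
  -- double negation avoids deciding membership in spans.
  ¬¬-independent : (W : Pred 𝔽 0ℓ) → ∀ r → (∀ d → d < r → ¬ Over𝔽q.HasDimension W d) →
    W 0# → (∀ {x y} → W x → W y → W (x +ᴷ y)) → (∀ {a x} → a ∈ 𝔽q → W x → W (a *ᴷ x)) →
    ¬ ¬ (Σ[ b ∈ Vector 𝔽 r ] Independentᴷ b × (∀ i → W (b i)))
  ¬¬-independent W zero _ _ _ _ k = k ([] , (λ _ _ _ ()) , λ ())
  ¬¬-independent W (suc r) large W-0 W-+ W-* k = ¬¬-independent W r (λ d d<r → large d (ℕ.m<n⇒m<1+n d<r)) W-0 W-+ W-*
      λ (b , indep , b∈) →
    ¬¬-∀ {P = λ i → W (element i) → Spanᴷ b (element i)} (λ i not-spanned → not-spanned λ x∈ → ⊥-elim (k (element i ∷ b ,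
        independent-∷ indep (λ x∈span → not-spanned λ _ → x∈span) , λ { zero → x∈ ; (suc i) → b∈ i })))
      λ W⊆ → large r (ℕ.n<1+n r) (b , indep , (λ {x} x∈ → subst (Spanᴷ b) (element-index x)
          (W⊆ (index x) (subst W (sym (element-index x)) x∈))) ,
        λ { (c , c∈ , refl) → combination c c∈ b b∈ })
    where
    combination : ∀ {d} (c : Vector 𝔽 d) → (∀ i → c i ∈ 𝔽q) → (b : Vector 𝔽 d) → (∀ i → W (b i)) → W (lincombᴷ c b)
    combination {zero} c c∈ b b∈ = W-0
    combination {suc d} c c∈ b b∈ = W-+ (W-* (c∈ zero) (b∈ zero)) (combination (c ∘ suc) (c∈ ∘ suc) (b ∘ suc) (b∈ ∘ suc))

  -- The q^r combinations of `b` with scalars in 𝔽_q are distinct, and all of them are roots of the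
  -- 𝔽_q-linear φ.
  independent-roots : ∀ {r D φ} → Monic D φ → φ 0# ≡ 0# → (∀ x y → φ (x +ᴷ y) ≡ φ x +ᴷ φ y) →
      (∀ {a} x → a ∈ 𝔽q → φ (a *ᴷ x) ≡ a *ᴷ φ x) →
    (b : Vector 𝔽 r) → Independentᴷ b → (∀ i → φ (b i) ≡ 0#) → q ^ r ≤ D
  independent-roots {r} {φ = φ} M φ-0 φ-+ φ-* b indep root = monic-roots M (λ k → lincombᴷ (ι ∘ finToFun k) b)
      (λ {k} {l} p → finToFun-injective {r} λ i → ι-injective
          (x-y≡0⇒x≡y _ _ (indep (λ j → ι (finToFun k j) +ᴷ (-ᴷ ι (finToFun l j)))
        (λ j → +-∈𝔽q (ι∈ _) (-‿∈𝔽q (ι∈ _))) (difference (ι ∘ finToFun k) (ι ∘ finToFun l) p) i)))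
      λ k → vanish (ι ∘ finToFun k) (λ _ → ι∈ _) b root
    where
    ι : Fin q → 𝔽
    ι = proj₁ 𝔽q-elements
    ι-injective : ∀ {i k} → ι i ≡ ι k → i ≡ k
    ι-injective = proj₁ (proj₂ 𝔽q-elements)
    ι∈ : ∀ i → ι i ∈ 𝔽q
    ι∈ = proj₂ (proj₂ 𝔽q-elements)
    difference : ∀ c c′ → lincombᴷ c b ≡ lincombᴷ c′ b → lincombᴷ (λ j → c j +ᴷ (-ᴷ c′ j)) b ≡ 0#
    difference c c′ p = +-cancelʳ (lincombᴷ c′ b) _ _ (trans (sym
        (∑-distrib-+ (λ j → (c j +ᴷ (-ᴷ c′ j)) *ᴷ b j) (λ j → c′ j *ᴷ b j)))
      (trans (sum-cong-≗ λ j → trans (sym (distribʳ (b j) _ _))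
          (cong (_*ᴷ b j) (trans (+-assoc _ _ _) (trans (cong (c j +ᴷ_) (-‿inverseˡ _)) (+-identityʳ _)))))
        (trans p (sym (+-identityˡ _)))))
    vanish : ∀ {d} (c : Vector 𝔽 d) → (∀ i → c i ∈ 𝔽q) → (b : Vector 𝔽 d) → (∀ i → φ (b i) ≡ 0#) → φ (lincombᴷ c b) ≡ 0#
    vanish {zero} c c∈ b root = φ-0
    vanish {suc d} c c∈ b root = trans (φ-+ _ _) (trans (cong₂ _+ᴷ_
        (trans (φ-* (b zero) (c∈ zero)) (trans (cong (c zero *ᴷ_) (root zero)) (zeroʳ _)))
      (vanish (c ∘ suc) (c∈ ∘ suc) (b ∘ suc) (root ∘ suc))) (+-identityˡ 0#))

module _ {q : ℕ} (q-primePower : IsPrimePower q) (K : FiniteField (q ^ 6)) where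
  open LinearizedPolynomials q 6 K
  open FieldProperties K hiding (_^ᴷ_; productᴷ)
  open FrobeniusProperties {q} {6} q-primePower K
  open LinearizedAlgebra {q} {6} q-primePower K
  open SparseCodes {q} {6} q-primePower K
  open Subfield {q} {6} q-primePower K

  cardinality≤ : ∀ {d N} (b : Vector 𝓛 d) → HasCardinality ⟨ b ⟩ N → N ≤ (q ^ 6) ^ d
  cardinality≤ {d} b (fs , unique , members , refl) = count-vectors (λ k → proj₁ (coordinates k)) λ {k} {l} p →
      lookup-injective unique
      (trans (proj₂ (proj₂ (coordinates k))) (trans (𝓛-ext λ i → trans (coef-lincomb _ b i)
          (trans (sum-cong-≗ λ j → cong (_*ᴷ coef (b j) i) (p j)) (sym (coef-lincomb _ b i))))
        (sym (proj₂ (proj₂ (coordinates l))))))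
    where
    coordinates : ∀ k → List.lookup fs k ∈ ⟨ b ⟩
    coordinates k = Equivalence.from (members _) (∈-lookup {xs = fs} k)

  -- x^{[4]} − x maps into the roots of y^{[4]} + y^{[2]} + y, hence has rank at most 4.
  𝒞₁-MRD⇒δ≢0 : ∀ δ → IsMRD (𝒞₁ δ) → δ ≢ 0#
  -- The goal is an absurdity, so five independent elements of the image may be used under a double
  -- negation. As roots of a monic polynomial of degree q^4 they would give q^5 ≤ q^4.
  𝒞₁-MRD⇒δ≢0 δ (d , (_ , minimal) , cardinality) δ≡0 = ¬¬-independent W 5 large W-0 W-+ W-* λ (v , indep , v∈) →
      ℕ.<⇒≱ (ℕ.^-monoʳ-< q 2≤q {4} {5} (ℕ.n<1+n 4)) (independent-roots χ-monic χ-0 χ-+ χ-* v indep (λ i → W⇒root (v∈ i)))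
    where
    open ≡-Reasoning
    b : Vector 𝓛 2
    b = x^[ 0 ] ∷ δ ·x^[ 1 ] ⊕ x^[ 4 ] ∷ []
    f g : 𝓛
    f = δ ·x^[ 1 ] ⊕ x^[ 4 ]
    g = x^[ 0 ]
    f≢g : f ≢ g
    f≢g p = 1≢0 (trans (sym (coef-⊕ʳ {δ ·x^[ 1 ]} {x^[ 4 ]} {4} (off 1 4 λ ()) (on 4 4 refl)))
        (trans (cong (λ h → coef h 4) p) (off 0 4 λ ())))

    -- A span of two elements has at most q^{12} members, and the MRD count q^{6(6 - d + 1)} stays
    -- below this only for d ≥ 5.
    5≤d : 5 ≤ d
    5≤d = ℕ.≮⇒≥ λ d<5 → ℕ.<⇒≱ (ℕ.*-monoʳ-< 6 (ℕ.+-monoˡ-< 1 (ℕ.m+n≤o⇒m≤o∸n 2 (s≤s d<5)))) small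
      where
      small : 6 * (6 ∸ d + 1) ≤ 6 * 2
      small = ^-cancelˡ-≤ q 2≤q (subst (q ^ (6 * (6 ∸ d + 1)) ≤_) (ℕ.^-*-assoc q 6 2) (cardinality≤ b cardinality))

    -- `χ` is the trace from 𝔽_{q^6} to 𝔽_{q^2}; it kills `T x`, the difference of x and its
    -- conjugate x^{[4]}.
    T χ : 𝔽 → 𝔽
    T x = x ^[ 4 ] +ᴷ (-ᴷ x)
    χ y = y ^[ 4 ] +ᴷ (y ^[ 2 ] +ᴷ y)
    W : Pred 𝔽 0ℓ
    W y = ∃[ x ] y ≡ eval (f ⊖ g) x
    eval≡T : ∀ x → eval (f ⊖ g) x ≡ T x
    eval≡T x = begin
      eval (f ⊖ g) x  ≡⟨ ev≡eval (f ⊖ g) x ⟨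
      ev (f ⊖ g) x  ≡⟨ trans (ev-⊖ f g x) (cong₂ (λ a b → a +ᴷ (-ᴷ b)) (ev-⊕ _ _ x) (ev-id x)) ⟩
      (ev (δ ·x^[ 1 ]) x +ᴷ ev x^[ 4 ] x) +ᴷ (-ᴷ x)  ≡⟨ cong (_+ᴷ (-ᴷ x))
          (trans (cong₂ _+ᴷ_ (trans (ev-monomial δ 1 x) (trans (cong (_*ᴷ x ^[ 1 ]) δ≡0) (zeroˡ _))) (ev-x^[] 4 x))
          (+-identityˡ _)) ⟩
      T x                                               ∎

    large : ∀ r → r < 5 → ¬ Over𝔽q.HasDimension W r
    large r r<5 dim = ℕ.<⇒≱ (ℕ.<-≤-trans r<5 5≤d) (minimal r (f , g , ∈⟨⟩ b 1F , ∈⟨⟩ b 0F , f≢g , dim))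

    T-0 : T 0# ≡ 0#
    T-0 = trans (cong₂ _+ᴷ_ (^[]-0 4) -0#≈0#) (+-identityˡ 0#)
    T-+ : ∀ x y → T (x +ᴷ y) ≡ T x +ᴷ T y
    T-+ x y = trans (cong₂ _+ᴷ_ (^[]-+ x y 4) (sym (-‿+-comm x y))) (+-interchange _ _ _ _)
    T-* : ∀ {a} x → a ∈ 𝔽q → T (a *ᴷ x) ≡ a *ᴷ T x
    T-* {a} x a∈ = trans (cong₂ _+ᴷ_ (trans (^[]-* a x 4) (cong (_*ᴷ x ^[ 4 ]) (∈𝔽q⇒^[] a∈ 4))) (-‿distribʳ-* a x))
        (sym (distribˡ a _ _))
    T⇒W : ∀ {y} x → y ≡ T x → W y
    T⇒W x p = x , trans p (sym (eval≡T x))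
    W-0 : W 0#
    W-0 = T⇒W 0# (sym T-0)
    W-+ : ∀ {x y} → W x → W y → W (x +ᴷ y)
    W-+ (x , p) (y , p′) = T⇒W (x +ᴷ y) (trans (cong₂ _+ᴷ_ (trans p (eval≡T x)) (trans p′ (eval≡T y))) (sym (T-+ x y)))
    W-* : ∀ {a x} → a ∈ 𝔽q → W x → W (a *ᴷ x)
    W-* {a} a∈ (x , p) = T⇒W (a *ᴷ x) (trans (cong (a *ᴷ_) (trans p (eval≡T x))) (sym (T-* x a∈)))

    χ-monic : Monic (q ^ 4) χ
    χ-monic = monic-+ (monic-^ (q ^ 4)) (poly-+ (poly-≤ (ℕ.^-monoʳ-< q 2≤q {2} {4} (ℕ.m≤m+n 3 1)) (poly-^ (q ^ 2)))
      (poly-≤ (2≤q^ 4 z<s) (step 0# (poly-^ 0) λ x → sym (trans (+-identityʳ _) (*-identityʳ x)))))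
    χ-0 : χ 0# ≡ 0#
    χ-0 = trans (cong₂ _+ᴷ_ (^[]-0 4) (trans (+-identityʳ _) (^[]-0 2))) (+-identityˡ 0#)
    χ-+ : ∀ x y → χ (x +ᴷ y) ≡ χ x +ᴷ χ y
    χ-+ x y = trans (cong₂ _+ᴷ_ (^[]-+ x y 4) (trans (cong (_+ᴷ (x +ᴷ y)) (^[]-+ x y 2)) (+-interchange _ _ _ _)))
        (+-interchange _ _ _ _)
    χ-* : ∀ {a} x → a ∈ 𝔽q → χ (a *ᴷ x) ≡ a *ᴷ χ x
    χ-* {a} x a∈ = trans (cong₂ _+ᴷ_ (at 4) (trans (cong (_+ᴷ a *ᴷ x) (at 2)) (sym (distribˡ a _ _)))) (sym (distribˡ a _ _))
      where
      at : ∀ j → (a *ᴷ x) ^[ j ] ≡ a *ᴷ x ^[ j ]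
      at j = trans (^[]-* a x j) (cong (_*ᴷ x ^[ j ]) (∈𝔽q⇒^[] a∈ j))
    W⇒root : ∀ {y} → W y → χ y ≡ 0#
    W⇒root (x , p) = trans (cong χ (trans p (eval≡T x))) (begin
      χ (T x)  ≡⟨ cong₂ (λ a b → a +ᴷ (b +ᴷ T x)) (T^[] 4) (T^[] 2) ⟩
      (x ^[ 8 ] +ᴷ (-ᴷ (x ^[ 4 ]))) +ᴷ ((x ^[ 6 ] +ᴷ (-ᴷ (x ^[ 2 ]))) +ᴷ (x ^[ 4 ] +ᴷ (-ᴷ x)))  ≡⟨ cong₂
          (λ a b → (a +ᴷ (-ᴷ (x ^[ 4 ]))) +ᴷ ((b +ᴷ (-ᴷ (x ^[ 2 ]))) +ᴷ (x ^[ 4 ] +ᴷ (-ᴷ x))))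
                                                                                                     (^[]-cong {8} {2} x refl) (trans (^[]-cong {6} {0} x refl) (^[0] x)) ⟩
      (x₂ +ᴷ (-ᴷ x₄)) +ᴷ ((x +ᴷ (-ᴷ x₂)) +ᴷ (x₄ +ᴷ (-ᴷ x)))  ≡⟨ cong ((x₂ +ᴷ (-ᴷ x₄)) +ᴷ_) (chain x₂ x x₄) ⟩
      (x₂ +ᴷ (-ᴷ x₄)) +ᴷ (x₄ +ᴷ (-ᴷ x₂))  ≡⟨ trans (+-comm _ _) (trans (cancel x₄ x₂ (-ᴷ x₄)) (-‿inverseʳ x₄)) ⟩
      0#                                                                                        ∎)
      where
      x₂ x₄ : 𝔽
      x₂ = x ^[ 2 ]
      x₄ = x ^[ 4 ]
      T^[] : ∀ j → T x ^[ j ] ≡ x ^[ 4 + j ] +ᴷ (-ᴷ (x ^[ j ]))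
      T^[] j = trans (^[]-+ _ _ j) (cong₂ _+ᴷ_ (^[]-^[] x 4 j) (^[]-neg x j))
      cancel : ∀ a b c → (a +ᴷ (-ᴷ b)) +ᴷ (b +ᴷ c) ≡ a +ᴷ c
      cancel a b c = trans (+-assoc a _ _) (cong (a +ᴷ_) (trans (sym (+-assoc _ b c))
          (trans (cong (_+ᴷ c) (-‿inverseˡ b)) (+-identityˡ c))))
      chain : ∀ a b c → (b +ᴷ (-ᴷ a)) +ᴷ (c +ᴷ (-ᴷ b)) ≡ c +ᴷ (-ᴷ a)
      chain a b c = trans (+-comm _ _) (cancel c b (-ᴷ a))

theorem4p2 : ∀ (q : ℕ) → IsPrimePower q →
  -- (a)
  (∀ (n : ℕ) .{{_ : NonZero n}} (K : FiniteField (q ^ n)) (let open LinearizedPolynomials q n K)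
     (k s : ℕ) → gcd s n ≡ 1 → 1 ≤ k → k < n →
     ind[ 𝒢 k s ]≡ k × h[ 𝒢 k s ]≡ (k ∸ 1))
  ×
  -- (b)
  (∀ (n : ℕ) .{{_ : NonZero n}} (K : FiniteField (q ^ n)) (let open LinearizedPolynomials q n K)
     (k s : ℕ) (η : 𝔽) → gcd s n ≡ 1 → 1 < k → k < n ∸ 1 →
     η ≢ 0# → norm η ≢ (-ᴷ 1#) ^ᴷ (n * k) →
     ind[ ℋ k s η ]≡ (k ∸ 1) × h[ ℋ k s η ]≡ (k ∸ 2))
  ×
  -- (c)
  (∀ (K : FiniteField (q ^ 6)) (let open LinearizedPolynomials q 6 K) (δ : 𝔽) →
     4 < q → IsMRD (𝒞₁ δ) →
     ind[ 𝒞₁ δ ]≡ 1 × h[ 𝒞₁ δ ]≡ 0)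
  ×
  -- (d)
  (∀ (K : FiniteField (q ^ 6)) (let open LinearizedPolynomials q 6 K) (δ : 𝔽) →
     q % 2 ≡ 1 → (q % 5 ≡ 0 ⊎ q % 5 ≡ 1 ⊎ q % 5 ≡ 4) → δ ∈ 𝔽q → δ ^ᴷ 2 +ᴷ δ ≡ 1# →
     ind[ 𝒞₂ δ ]≡ 1 × h[ 𝒞₂ δ ]≡ 0)
  ×
  -- (e)
  (∀ (K : FiniteField (q ^ 7)) (let open LinearizedPolynomials q 7 K) (s : ℕ) →
     q % 2 ≡ 1 → gcd s 7 ≡ 1 →
     ind[ 𝒞₃ s ]≡ 2 × h[ 𝒞₃ s ]≡ 1)
  ×
  -- (f)
  (∀ (K : FiniteField (q ^ 8)) (let open LinearizedPolynomials q 8 K) (δ : 𝔽) →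
     q % 2 ≡ 1 → δ ^ᴷ 2 ≡ -ᴷ 1# →
     ind[ 𝒞₄ δ ]≡ 1 × h[ 𝒞₄ δ ]≡ 0)
  ×
  -- (g)
  (∀ (K : FiniteField (q ^ 8)) (let open LinearizedPolynomials q 8 K) (s : ℕ) →
     q % 3 ≡ 1 → gcd s 8 ≡ 1 →
     ind[ 𝒞₅ s ]≡ 2 × h[ 𝒞₅ s ]≡ 1)
  ×
  -- (h)
  (∀ (K : FiniteField (q ^ 6)) (let open LinearizedPolynomials q 6 K) (δ : 𝔽) →
     4 < q → IsMRD (𝒞₁ δ) →
     ind[ 𝒟₁ δ ]≡ 2 × h[ 𝒟₁ δ ]≡ 2)
  ×
  -- (i)
  (∀ (K : FiniteField (q ^ 6)) (let open LinearizedPolynomials q 6 K) (δ : 𝔽) →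
     q % 2 ≡ 1 → (q % 5 ≡ 0 ⊎ q % 5 ≡ 1 ⊎ q % 5 ≡ 4) → δ ∈ 𝔽q → δ ^ᴷ 2 +ᴷ δ ≡ 1# →
     ind[ 𝒟₂ δ ]≡ 2 × h[ 𝒟₂ δ ]≡ 2)
  ×
  -- (j)
  (∀ (K : FiniteField (q ^ 7)) (let open LinearizedPolynomials q 7 K) (s : ℕ) →
     q % 2 ≡ 1 → gcd s 7 ≡ 1 →
     ind[ 𝒟₃ s ]≡ 3 × h[ 𝒟₃ s ]≡ 2)
  ×
  -- (k)
  (∀ (K : FiniteField (q ^ 8)) (let open LinearizedPolynomials q 8 K) (δ : 𝔽) →
     q % 2 ≡ 1 → δ ^ᴷ 2 ≡ -ᴷ 1# →
     ind[ 𝒟₄ δ ]≡ 3 × h[ 𝒟₄ δ ]≡ 4)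
  ×
  -- (l)
  (∀ (K : FiniteField (q ^ 8)) (let open LinearizedPolynomials q 8 K) (s : ℕ) →
     q % 3 ≡ 1 → gcd s 8 ≡ 1 →
     ind[ 𝒟₅ s ]≡ 4 × h[ 𝒟₅ s ]≡ 3)
theorem4p2 q q-primePower =
    (λ { n K (suc k) s g _ k<n → CodeFamilies.Regular.𝒢-values q-primePower K s g k k<n }) ,
    (λ { n K (suc (suc κ)) s η g _ k<n-1 η≢0 _ → CodeFamilies.Regular.TwistedGabidulin.ℋ-values q-primePower K s g κ (<pred⇒suc< n k<n-1) η η≢0
       ; n K 1 s η g (s≤s ()) _ _ _ }) ,
    (λ K δ _ _ → 𝒞₁-values q-primePower K δ) ,
    (λ K δ _ _ _ _ → 𝒞₂-values q-primePower K δ) ,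
    (λ K s _ g → MonomialCodeValues.𝒞₃-values q-primePower K s g) ,
    (λ K δ _ δ²≡-1 → 𝒞₄-values q-primePower K δ (square≡-1⇒≢0 K δ²≡-1)) ,
    (λ K s _ g → MonomialCodeValues.𝒞₅-values q-primePower K s g) ,
    (λ K δ _ mrd → 𝒟₁-values q-primePower K δ (𝒞₁-MRD⇒δ≢0 q-primePower K δ mrd)) ,
    (λ K δ q-odd _ δ∈𝔽q δ²+δ≡1 → 𝒟₂-values q-primePower K q-odd δ δ∈𝔽q δ²+δ≡1) ,
    (λ K s _ g → MonomialCodeValues.𝒟₃-values q-primePower K s g) ,
    (λ K δ _ δ²≡-1 → 𝒟₄-values q-primePower K δ (square≡-1⇒≢0 K δ²≡-1)) ,
    (λ K s _ g → MonomialCodeValues.𝒟₅-values q-primePower K s g)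
  where
  <pred⇒suc< : ∀ n {k} → k < n ∸ 1 → suc k < n
  <pred⇒suc< (suc n) k<n = s≤s k<n

  square≡-1⇒≢0 : ∀ (K : FiniteField (q ^ 8)) (let open LinearizedPolynomials q 8 K) {δ : 𝔽} → δ ^ᴷ 2 ≡ -ᴷ 1# → δ ≢ 0#
  square≡-1⇒≢0 K p refl = 1≢0 (trans (sym (-‿involutive 1#)) (trans (cong -ᴷ_ (trans (sym p) (zeroˡ _))) -0#≈0#))
    where
    open FiniteField K
    open FieldProperties K
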